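{- Let $k\geq\ell\geq t+1$ be positive integers ($t\ge 1$) and let $r\geq 1$ be real. Let $\Omega$ be a finite set and let $\mathcal{A}\subseteq\binom{\Omega}{k}$ and $\mathcal{B}\subseteq\binom{\Omega}{\ell}$ be two weakly $(r,t)$-spread families. The following hold. (i) If $r\geq 2ek$ and $\mathcal{F}\subseteq\mathcal{A}$ is $t$-intersecting, then $|\mathcal{F}|\leq\Delta_{t}(\mathcal{A})$, with equality if and only if $\mathcal{F}=\mathcal{A}[X]$ for some $X\in\binom{\Omega}{t}$ with $|\mathcal{A}[X]|=\Delta_{t}(\mathcal{A})$. (ii) If $r\geq 2e\cdot\max\{(t+2)^2,\,k/(1-t/k)\}$ and $\mathcal{F}\subseteq\mathcal{A}$, $\mathcal{G}\subseteq\mathcal{B}$ are cross $t$-intersecting, then $|\mathcal{F}||\mathcal{G}|\leq\Delta_{t}(\mathcal{A})\Delta_{t}(\mathcal{B})$, with equality if and only if $\mathcal{F}=\mathcal{A}[X]$ and $\mathcal{G}=\mathcal{B}[X]$ for some $X\in\binom{\Omega}{t}$ with $|\mathcal{A}[X]|=\Delta_{t}(\mathcal{A})$ and $|\mathcal{B}[X]|=\Delta_{t}(\mathcal{B})$.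
   Context: Here $e$ is the base of the natural logarithm, and $\binom{\Omega}{k}$ is the family of all $k$-element subsets of $\Omega$. For a family $\mathcal{A}$ of subsets of $\Omega$ and $S\subseteq\Omega$, $\mathcal{A}[S]:=\{A\in\mathcal{A}:S\subseteq A\}$. The maximum $s$-degree of $\mathcal{A}$ is $\Delta_s(\mathcal{A}):=\max\{|\mathcal{A}[S]|:S\in\binom{\Omega}{s}\}$ (taken to be $0$ if $s>|\Omega|$). A family $\mathcal{A}$ is weakly $(r,t)$-spread if $\Delta_{t+s}(\mathcal{A})\leq r^{ -s}\Delta_t(\mathcal{A})$ for all integers $s\ge 0$. A family $\mathcal{F}$ is $t$-intersecting if $|F\cap F'|\ge t$ for all $F,F'\in\mathcal{F}$. Families $\mathcal{F},\mathcal{G}$ are cross $t$-intersecting if $|F\cap G|\ge t$ for all $F\in\mathcal{F}$, $G\in\mathcal{G}$.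
   Formalization: The equality characterizations are stated with added hypotheses, since they fail in degenerate cases: in (i) that |Ω| ≥ t (otherwise no t-set X exists), in (ii) that 𝒜 and ℬ are nonempty (if ℬ is empty, equality 0 = 0 holds for every ℱ). The inequalities are unrestricted. -}

module Defs where

open import Data.Bool using (Bool; T; _∧_)
open import Data.Fin.Subset using (Subset; inside; outside; _⊆_; _∩_; ∣_∣)
open import Data.Fin.Subset.Properties using (_⊆?_)
open import Data.Integer as ℤ using (+_; +[1+_]; -[1+_]; +≤+; +<+)
import Data.Integer.Properties as ℤ
open import Data.List using (List; []; _∷_; _++_; map; filter; filterᵇ; length)
open import Data.List.Extrema.Nat using (max)
open import Data.Nat as ℕ using (ℕ; zero; suc; _!)
import Data.Nat.Properties as ℕ
open import Data.Product using (∃-syntax; _×_; _,_; proj₁; proj₂)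
open import Data.Rational as ℚ
  using (ℚ; mkℚ; 0ℚ; 1ℚ; ½; _+_; _-_; _*_; -_; _÷_; 1/_; _/_; _⊔_; NonZero; NonNegative; *<*)
import Data.Rational.Properties as ℚ
import Data.Rational.Unnormalised as ℚᵘ
import Data.Rational.Unnormalised.Properties as ℚᵘ
open import Data.Rational.Solver using (module +-*-Solver)
open import Data.Vec using ([]; _∷_)
open import Relation.Binary.PropositionalEquality
  using (_≡_; refl; sym; trans; cong; cong₂; subst; subst₂)
open import Relation.Nullary.Decidable using (⌊_⌋)

pos-* : ∀ {p q} → 0ℚ ℚ.< p → 0ℚ ℚ.< q → 0ℚ ℚ.< p * q
pos-* {p} {q} 0<p 0<q =
  ℚ.positive⁻¹ (p * q) {{ℚ.pos*pos⇒pos p {{ℚ.positive 0<p}} q {{ℚ.positive 0<q}}}}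

pos-1/ : ∀ {p} (0<p : 0ℚ ℚ.< p) → 0ℚ ℚ.< (1/ p) {{ℚ.>-nonZero 0<p}}
pos-1/ {p} 0<p =
  ℚ.positive⁻¹ ((1/ p) {{ℚ.>-nonZero 0<p}}) {{ℚ.1/pos⇒pos p {{ℚ.positive 0<p}}}}

0<½ : 0ℚ ℚ.< ½
0<½ = *<* (+<+ (ℕ.s≤s ℕ.z≤n))

0<1 : 0ℚ ℚ.< 1ℚ
0<1 = *<* (+<+ (ℕ.s≤s ℕ.z≤n))

half+half : ∀ p → ½ * p + ½ * p ≡ p
half+half p = trans (sym (ℚ.*-distribʳ-+ p ½ ½)) (ℚ.*-identityˡ p)

*-mono-≤-0≤ : ∀ {p q r s} → 0ℚ ℚ.≤ r → 0ℚ ℚ.≤ q → p ℚ.≤ q → r ℚ.≤ s → p * r ℚ.≤ q * s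
*-mono-≤-0≤ {p} {q} {r} {s} 0≤r 0≤q p≤q r≤s = ℚ.≤-trans
  (ℚ.*-monoʳ-≤-nonNeg r {{ℚ.nonNegative 0≤r}} p≤q)
  (ℚ.*-monoˡ-≤-nonNeg q {{ℚ.nonNegative 0≤q}} r≤s)

p≤q⇒0≤q-p : ∀ {p q} → p ℚ.≤ q → 0ℚ ℚ.≤ q - p
p≤q⇒0≤q-p {p} {q} p≤q =
  subst (ℚ._≤ q - p) (ℚ.+-inverseʳ p) (ℚ.+-monoˡ-≤ (- p) p≤q)

∣-∣-swap : ∀ p q → ℚ.∣ p - q ∣ ≡ ℚ.∣ q - p ∣
∣-∣-swap p q = trans (sym (ℚ.∣-p∣≡∣p∣ (p - q)))
  (cong ℚ.∣_∣ (solve 2 (λ p q → :- (p :- q) := q :- p) refl p q))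
  where open +-*-Solver

p≤p+q : ∀ {p q} .{{_ : NonNegative q}} → p ℚ.≤ p + q
p≤p+q {p} {q} = subst (ℚ._≤ p + q) (ℚ.+-identityʳ p) (ℚ.+-monoʳ-≤ p (ℚ.nonNegative⁻¹ q))

/-mono-≤ : ∀ a b c d .{{_ : ℕ.NonZero b}} .{{_ : ℕ.NonZero d}} →
           a ℕ.* d ℕ.≤ c ℕ.* b → (+ a) / b ℚ.≤ (+ c) / d
/-mono-≤ a (suc b) c (suc d) h = ℚ.toℚᵘ-cancel-≤
  (ℚᵘ.≤-respˡ-≃ (ℚᵘ.≃-sym (ℚ.toℚᵘ-fromℚᵘ (ℚᵘ.mkℚᵘ (+ a) b)))
  (ℚᵘ.≤-respʳ-≃ (ℚᵘ.≃-sym (ℚ.toℚᵘ-fromℚᵘ (ℚᵘ.mkℚᵘ (+ c) d)))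
    (ℚᵘ.*≤* (subst₂ ℤ._≤_ (ℤ.pos-* a (suc d)) (ℤ.pos-* c (suc b)) (+≤+ h)))))

/-mono-< : ∀ a b c d .{{_ : ℕ.NonZero b}} .{{_ : ℕ.NonZero d}} →
           a ℕ.* d ℕ.< c ℕ.* b → (+ a) / b ℚ.< (+ c) / d
/-mono-< a (suc b) c (suc d) h = ℚ.toℚᵘ-cancel-<
  (ℚᵘ.<-respˡ-≃ (ℚᵘ.≃-sym (ℚ.toℚᵘ-fromℚᵘ (ℚᵘ.mkℚᵘ (+ a) b)))
  (ℚᵘ.<-respʳ-≃ (ℚᵘ.≃-sym (ℚ.toℚᵘ-fromℚᵘ (ℚᵘ.mkℚᵘ (+ c) d)))
    (ℚᵘ.*<* (subst₂ ℤ._<_ (ℤ.pos-* a (suc d)) (ℤ.pos-* c (suc b)) (+<+ h)))))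

-- Real numbers, as Cauchy sequences of rationals.  No quotient is taken:
-- equality of reals is _≤ᴿ_ in both directions.

CauchySeq : (ℕ → ℚ) → Set
CauchySeq a = ∀ ε → 0ℚ ℚ.< ε →
  ∃[ N ] ∀ m n → N ℕ.≤ m → N ℕ.≤ n → ℚ.∣ a m - a n ∣ ℚ.≤ ε

record ℝ : Set where
  constructor mkℝ
  field
    seq    : ℕ → ℚ
    cauchy : CauchySeq seq

open ℝ public

infix 4 _≤ᴿ_ _<ᴿ_
infixl 7 _*ᴿ_
infixr 8 _^ᴿ_

_≤ᴿ_ : ℝ → ℝ → Set
x ≤ᴿ y = ∀ ε → 0ℚ ℚ.< ε → ∃[ N ] ∀ n → N ℕ.≤ n → seq x n ℚ.≤ seq y n + ε

_<ᴿ_ : ℝ → ℝ → Set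
x <ᴿ y = ∃[ ε ] 0ℚ ℚ.< ε × ∃[ N ] ∀ n → N ℕ.≤ n → seq x n + ε ℚ.≤ seq y n

fromℚ : ℚ → ℝ
fromℚ q = mkℝ (λ _ → q)
  (λ ε 0<ε → 0 , λ _ _ _ _ →
    subst (λ z → ℚ.∣ z ∣ ℚ.≤ ε) (sym (ℚ.+-inverseʳ q)) (ℚ.<⇒≤ 0<ε))

fromℕ : ℕ → ℝ
fromℕ n = fromℚ ((+ n) / 1)

eventually-bounded : (x : ℝ) →
  ∃[ M ] 0ℚ ℚ.< M × ∃[ N ] ∀ n → N ℕ.≤ n → ℚ.∣ seq x n ∣ ℚ.≤ M
eventually-bounded x = M , 0<M , N , bound
  where
  N = proj₁ (cauchy x 1ℚ 0<1)
  M = 1ℚ + ℚ.∣ seq x N ∣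
  0<M : 0ℚ ℚ.< M
  0<M = ℚ.+-mono-<-≤ {0ℚ} {1ℚ} {0ℚ} 0<1 (ℚ.0≤∣p∣ (seq x N))
  bound : ∀ n → N ℕ.≤ n → ℚ.∣ seq x n ∣ ℚ.≤ M
  bound n N≤n = ℚ.≤-trans
    (ℚ.≤-trans
      (ℚ.≤-reflexive (cong ℚ.∣_∣
        (solve 2 (λ a b → a := (a :- b) :+ b) refl (seq x n) (seq x N))))
      (ℚ.∣p+q∣≤∣p∣+∣q∣ (seq x n - seq x N) (seq x N)))
    (ℚ.+-monoˡ-≤ ℚ.∣ seq x N ∣ (proj₂ (cauchy x 1ℚ 0<1) n N N≤n ℕ.≤-refl))
    where open +-*-Solver

product-estimate : ∀ a b c d M M′ δ δ′ → 0ℚ ℚ.≤ M → 0ℚ ℚ.≤ M′ →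
  ℚ.∣ a ∣ ℚ.≤ M → ℚ.∣ d ∣ ℚ.≤ M′ → ℚ.∣ b - d ∣ ℚ.≤ δ → ℚ.∣ a - c ∣ ℚ.≤ δ′ →
  ℚ.∣ a * b - c * d ∣ ℚ.≤ M * δ + M′ * δ′
product-estimate a b c d M M′ δ δ′ 0≤M 0≤M′ a≤M d≤M′ b-d≤δ a-c≤δ′ = begin
  ℚ.∣ a * b - c * d ∣
    ≡⟨ cong ℚ.∣_∣ (solve 4 (λ a b c d →
         a :* b :- c :* d := a :* (b :- d) :+ d :* (a :- c)) refl a b c d) ⟩
  ℚ.∣ a * (b - d) + d * (a - c) ∣
    ≤⟨ ℚ.∣p+q∣≤∣p∣+∣q∣ (a * (b - d)) (d * (a - c)) ⟩
  ℚ.∣ a * (b - d) ∣ + ℚ.∣ d * (a - c) ∣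
    ≡⟨ cong₂ _+_ (ℚ.∣p*q∣≡∣p∣*∣q∣ a (b - d)) (ℚ.∣p*q∣≡∣p∣*∣q∣ d (a - c)) ⟩
  ℚ.∣ a ∣ * ℚ.∣ b - d ∣ + ℚ.∣ d ∣ * ℚ.∣ a - c ∣
    ≤⟨ ℚ.+-mono-≤ (*-mono-≤-0≤ (ℚ.0≤∣p∣ (b - d)) 0≤M a≤M b-d≤δ)
                  (*-mono-≤-0≤ (ℚ.0≤∣p∣ (a - c)) 0≤M′ d≤M′ a-c≤δ′) ⟩
  M * δ + M′ * δ′ ∎
  where
  open ℚ.≤-Reasoning
  open +-*-Solver

cancel-1/ : ∀ P h .{{_ : NonZero P}} → P * (h * 1/ P) ≡ h
cancel-1/ P h = trans
  (solve 3 (λ p h i → p :* (h :* i) := h :* (p :* i)) refl P h (1/ P))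
  (trans (cong (h *_) (ℚ.*-inverseʳ P)) (ℚ.*-identityʳ h))
  where open +-*-Solver

EventuallyBoundedBy : ℚ → (ℕ → ℚ) → Set
EventuallyBoundedBy M a = ∃[ N ] ∀ n → N ℕ.≤ n → ℚ.∣ a n ∣ ℚ.≤ M

product-cauchy : ∀ a b M M′ → 0ℚ ℚ.< M → 0ℚ ℚ.< M′ →
  EventuallyBoundedBy M a → EventuallyBoundedBy M′ b →
  CauchySeq a → CauchySeq b → CauchySeq (λ n → a n * b n)
product-cauchy a b M M′ 0<M 0<M′ (N₁ , a≤M) (N₂ , b≤M′) ca cb ε 0<ε =
  combine (½ * ε * (1/ M) {{ℚ.>-nonZero 0<M}}) (½ * ε * (1/ M′) {{ℚ.>-nonZero 0<M′}})
    (cancel-1/ M (½ * ε) {{ℚ.>-nonZero 0<M}})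
    (cancel-1/ M′ (½ * ε) {{ℚ.>-nonZero 0<M′}})
    (cb _ (pos-* (pos-* 0<½ 0<ε) (pos-1/ 0<M)))
    (ca _ (pos-* (pos-* 0<½ 0<ε) (pos-1/ 0<M′)))
  where
  combine : ∀ δ δ′ → M * δ ≡ ½ * ε → M′ * δ′ ≡ ½ * ε →
    (∃[ N ] ∀ m n → N ℕ.≤ m → N ℕ.≤ n → ℚ.∣ b m - b n ∣ ℚ.≤ δ) →
    (∃[ N ] ∀ m n → N ℕ.≤ m → N ℕ.≤ n → ℚ.∣ a m - a n ∣ ℚ.≤ δ′) →
    ∃[ N ] ∀ m n → N ℕ.≤ m → N ℕ.≤ n → ℚ.∣ a m * b m - a n * b n ∣ ℚ.≤ ε
  combine δ δ′ Mδ M′δ′ (N₃ , cb′) (N₄ , ca′) =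
    (N₁ ℕ.⊔ N₂) ℕ.⊔ (N₃ ℕ.⊔ N₄) , λ m n N≤m N≤n → ℚ.≤-trans
      (product-estimate (a m) (b m) (a n) (b n) M M′ δ δ′ (ℚ.<⇒≤ 0<M) (ℚ.<⇒≤ 0<M′)
        (a≤M m (ℕ.m⊔n≤o⇒m≤o N₁ N₂ (left N≤m)))
        (b≤M′ n (ℕ.m⊔n≤o⇒n≤o N₁ N₂ (left N≤n)))
        (cb′ m n (ℕ.m⊔n≤o⇒m≤o N₃ N₄ (right N≤m)) (ℕ.m⊔n≤o⇒m≤o N₃ N₄ (right N≤n)))
        (ca′ m n (ℕ.m⊔n≤o⇒n≤o N₃ N₄ (right N≤m)) (ℕ.m⊔n≤o⇒n≤o N₃ N₄ (right N≤n))))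
      (ℚ.≤-reflexive (trans (cong₂ _+_ Mδ M′δ′) (half+half ε)))
    where
    left : ∀ {j} → (N₁ ℕ.⊔ N₂) ℕ.⊔ (N₃ ℕ.⊔ N₄) ℕ.≤ j → N₁ ℕ.⊔ N₂ ℕ.≤ j
    left = ℕ.m⊔n≤o⇒m≤o (N₁ ℕ.⊔ N₂) (N₃ ℕ.⊔ N₄)
    right : ∀ {j} → (N₁ ℕ.⊔ N₂) ℕ.⊔ (N₃ ℕ.⊔ N₄) ℕ.≤ j → N₃ ℕ.⊔ N₄ ℕ.≤ j
    right = ℕ.m⊔n≤o⇒n≤o (N₁ ℕ.⊔ N₂) (N₃ ℕ.⊔ N₄)

_*ᴿ_ : ℝ → ℝ → ℝ
x *ᴿ y = mkℝ (λ n → seq x n * seq y n)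
  (product-cauchy (seq x) (seq y) (proj₁ bx) (proj₁ by) (proj₁ (proj₂ bx)) (proj₁ (proj₂ by))
    (proj₂ (proj₂ bx)) (proj₂ (proj₂ by)) (cauchy x) (cauchy y))
  where
  bx = eventually-bounded x
  by = eventually-bounded y

_^ᴿ_ : ℝ → ℕ → ℝ
x ^ᴿ zero  = fromℕ 1
x ^ᴿ suc n = x *ᴿ (x ^ᴿ n)

⊔-pos : ∀ p {ε} → 0ℚ ℚ.< ε → 0ℚ ℚ.< p ⊔ ε
⊔-pos p {ε} 0<ε = ℚ.<-≤-trans 0<ε (ℚ.p≤q⊔p p ε)

-- From the index given by 0 < x onwards the n-th term is 1 / seq x n.  The
-- maximum with the lower bound ε only keeps the finitely many earlier
-- terms away from 0.
inv : (x : ℝ) → fromℕ 0 <ᴿ x → ℝ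
inv x (ε , 0<ε , N₀ , lower) = mkℝ (λ n → r (seq x n)) isCauchy
  where
  r : ℚ → ℚ
  r p = (1/ (p ⊔ ε)) {{ℚ.>-nonZero (⊔-pos p 0<ε)}}

  i : ℚ
  i = (1/ ε) {{ℚ.>-nonZero 0<ε}}

  inverse : ∀ p → (p ⊔ ε) * r p ≡ 1ℚ
  inverse p = ℚ.*-inverseʳ (p ⊔ ε) {{ℚ.>-nonZero (⊔-pos p 0<ε)}}

  0≤r : ∀ p → 0ℚ ℚ.≤ r p
  0≤r p = ℚ.<⇒≤ (pos-1/ (⊔-pos p 0<ε))

  ε*i : ε * i ≡ 1ℚ
  ε*i = ℚ.*-inverseʳ ε {{ℚ.>-nonZero 0<ε}}

  0≤i : 0ℚ ℚ.≤ i
  0≤i = ℚ.<⇒≤ (pos-1/ 0<ε)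

  r≤i : ∀ p → r p ℚ.≤ i
  r≤i p = begin
    r p                    ≡⟨ sym (ℚ.*-identityˡ (r p)) ⟩
    1ℚ * r p               ≡⟨ cong (_* r p) (sym ε*i) ⟩
    ε * i * r p            ≡⟨ solve 3 (λ e i r → e :* i :* r := e :* (i :* r)) refl ε i (r p) ⟩
    ε * (i * r p)          ≤⟨ ℚ.*-monoʳ-≤-nonNeg (i * r p) {{nn}} (ℚ.p≤q⊔p p ε) ⟩
    (p ⊔ ε) * (i * r p)    ≡⟨ solve 3 (λ q i r → q :* (i :* r) := i :* (q :* r)) refl (p ⊔ ε) i (r p) ⟩
    i * ((p ⊔ ε) * r p)    ≡⟨ cong (i *_) (inverse p) ⟩
    i * 1ℚ                 ≡⟨ ℚ.*-identityʳ i ⟩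
    i ∎
    where
    open ℚ.≤-Reasoning
    open +-*-Solver
    nn : NonNegative (i * r p)
    nn = ℚ.nonNeg*nonNeg⇒nonNeg i {{ℚ.nonNegative 0≤i}} (r p) {{ℚ.nonNegative (0≤r p)}}

  diff : ∀ p q → r p - r q ≡ ((q ⊔ ε) - (p ⊔ ε)) * (r p * r q)
  diff p q = sym (trans
    (solve 4 (λ u v a b → (v :- u) :* (a :* b) := (v :* b) :* a :- (u :* a) :* b)
      refl (p ⊔ ε) (q ⊔ ε) (r p) (r q))
    (cong₂ _-_
      (trans (cong (_* r p) (inverse q)) (ℚ.*-identityˡ (r p)))
      (trans (cong (_* r q) (inverse p)) (ℚ.*-identityˡ (r q)))))
    where open +-*-Solver

  eventually : ∀ n → N₀ ℕ.≤ n → seq x n ⊔ ε ≡ seq x n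
  eventually n N₀≤n = ℚ.p≥q⇒p⊔q≡p
    (subst (ℚ._≤ seq x n) (ℚ.+-identityˡ ε) (lower n N₀≤n))

  isCauchy : CauchySeq (λ n → r (seq x n))
  isCauchy η 0<η = N₀ ℕ.⊔ proj₁ cx , est
    where
    cx = cauchy x (η * (ε * ε)) (pos-* 0<η (pos-* 0<ε 0<ε))
    est : ∀ m n → N₀ ℕ.⊔ proj₁ cx ℕ.≤ m → N₀ ℕ.⊔ proj₁ cx ℕ.≤ n →
          ℚ.∣ r (seq x m) - r (seq x n) ∣ ℚ.≤ η
    est m n N≤m N≤n = begin
      ℚ.∣ r a - r b ∣
        ≡⟨ cong ℚ.∣_∣ (diff a b) ⟩
      ℚ.∣ ((b ⊔ ε) - (a ⊔ ε)) * (r a * r b) ∣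
        ≡⟨ ℚ.∣p*q∣≡∣p∣*∣q∣ ((b ⊔ ε) - (a ⊔ ε)) (r a * r b) ⟩
      ℚ.∣ (b ⊔ ε) - (a ⊔ ε) ∣ * ℚ.∣ r a * r b ∣
        ≡⟨ cong₂ (λ u v → ℚ.∣ u ∣ * v)
             (cong₂ _-_ (eventually n (₀≤ N≤n)) (eventually m (₀≤ N≤m)))
             (trans (ℚ.∣p*q∣≡∣p∣*∣q∣ (r a) (r b))
               (cong₂ _*_ (ℚ.0≤p⇒∣p∣≡p (0≤r a)) (ℚ.0≤p⇒∣p∣≡p (0≤r b)))) ⟩
      ℚ.∣ b - a ∣ * (r a * r b)
        ≤⟨ *-mono-≤-0≤ (ℚ.nonNegative⁻¹ (r a * r b) {{nn}})
             (ℚ.<⇒≤ (pos-* 0<η (pos-* 0<ε 0<ε)))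
             (proj₂ cx n m (x≤ N≤n) (x≤ N≤m))
             (*-mono-≤-0≤ (0≤r b) 0≤i (r≤i a) (r≤i b)) ⟩
      η * (ε * ε) * (i * i)
        ≡⟨ solve 3 (λ h e i → h :* (e :* e) :* (i :* i) := h :* ((e :* i) :* (e :* i)))
             refl η ε i ⟩
      η * ((ε * i) * (ε * i))
        ≡⟨ cong (λ z → η * (z * z)) ε*i ⟩
      η * (1ℚ * 1ℚ)
        ≡⟨ ℚ.*-identityʳ η ⟩
      η ∎
      where
      open ℚ.≤-Reasoning
      open +-*-Solver
      a = seq x m
      b = seq x n
      ₀≤ : ∀ {j} → N₀ ℕ.⊔ proj₁ cx ℕ.≤ j → N₀ ℕ.≤ j
      ₀≤ = ℕ.≤-trans (ℕ.m≤m⊔n N₀ (proj₁ cx))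
      x≤ : ∀ {j} → N₀ ℕ.⊔ proj₁ cx ℕ.≤ j → proj₁ cx ℕ.≤ j
      x≤ = ℕ.≤-trans (ℕ.m≤n⊔m N₀ (proj₁ cx))
      nn : NonNegative (r a * r b)
      nn = ℚ.nonNeg*nonNeg⇒nonNeg (r a) {{ℚ.nonNegative (0≤r a)}}
                                  (r b) {{ℚ.nonNegative (0≤r b)}}

1≤⇒0< : ∀ {x} → fromℕ 1 ≤ᴿ x → fromℕ 0 <ᴿ x
1≤⇒0< {x} 1≤x = ½ , 0<½ , proj₁ (1≤x ½ 0<½) , λ n N≤n →
  ℚ.≤-trans (ℚ.+-monoˡ-≤ (- ½) (proj₂ (1≤x ½ 0<½) n N≤n))
    (ℚ.≤-reflexive (solve 2 (λ a h → a :+ h :+ :- h := a) refl (seq x n) ½))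
  where open +-*-Solver

1/!_ : ℕ → ℚ
1/! i = ((+ 1) / (i !)) {{i ℕ.!≢0}}

expSum : ℕ → ℚ
expSum zero    = 1/! 0
expSum (suc n) = expSum n + 1/! suc n

0≤1/! : ∀ i → 0ℚ ℚ.≤ 1/! i
0≤1/! i = /-mono-≤ 0 1 1 (i !) {{_}} {{i ℕ.!≢0}} ℕ.z≤n

1/!-half : ∀ n → 1 ℕ.≤ n → 1/! suc n ℚ.≤ ½ * 1/! n
1/!-half n 1≤n = begin
  1/! suc n
    ≤⟨ /-mono-≤ 1 (suc n !) 1 (2 ℕ.* n !) {{suc n ℕ.!≢0}} {{nz}}
         (ℕ.*-monoʳ-≤ 1 (ℕ.*-monoˡ-≤ (n !) (ℕ.s≤s 1≤n))) ⟩
  ((+ 1) / (2 ℕ.* n !)) {{nz}}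
    ≡⟨ split (n !) {{n ℕ.!≢0}} {{nz}} ⟩
  ½ * 1/! n ∎
  where
  open ℚ.≤-Reasoning
  nz = ℕ.m*n≢0 2 (n !) {{_}} {{n ℕ.!≢0}}
  split : ∀ d .{{_ : ℕ.NonZero d}} .{{_ : ℕ.NonZero (2 ℕ.* d)}} →
          (+ 1) / (2 ℕ.* d) ≡ ½ * ((+ 1) / d)
  split d@(suc d-1) = ℚ.toℚᵘ-injective
    (ℚᵘ.≃-trans (ℚ.toℚᵘ-fromℚᵘ (ℚᵘ.mkℚᵘ (+ 1) (ℕ.pred (2 ℕ.* d))))
    (ℚᵘ.≃-sym (ℚᵘ.≃-trans (ℚ.toℚᵘ-homo-* ½ ((+ 1) / d))
      (ℚᵘ.*-congˡ {ℚ.toℚᵘ ½} (ℚ.toℚᵘ-fromℚᵘ (ℚᵘ.mkℚᵘ (+ 1) d-1))))))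

expSum-mono : ∀ n j → expSum n ℚ.≤ expSum (j ℕ.+ n)
expSum-mono n zero    = ℚ.≤-refl
expSum-mono n (suc j) = ℚ.≤-trans (expSum-mono n j)
  (p≤p+q {expSum (j ℕ.+ n)} {1/! suc (j ℕ.+ n)} {{ℚ.nonNegative (0≤1/! (suc (j ℕ.+ n)))}})

expSum-upper : ∀ n j → 1 ℕ.≤ n →
               expSum (j ℕ.+ n) + 1/! (j ℕ.+ n) ℚ.≤ expSum n + 1/! n
expSum-upper n zero    1≤n = ℚ.≤-refl
expSum-upper n (suc j) 1≤n = ℚ.≤-trans step (expSum-upper n j 1≤n)
  where
  open ℚ.≤-Reasoning
  k = j ℕ.+ n
  h = 1/!-half k (ℕ.≤-trans 1≤n (ℕ.m≤n+m n j))
  step : expSum k + 1/! suc k + 1/! suc k ℚ.≤ expSum k + 1/! k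
  step = begin
    expSum k + 1/! suc k + 1/! suc k   ≡⟨ ℚ.+-assoc (expSum k) (1/! suc k) (1/! suc k) ⟩
    expSum k + (1/! suc k + 1/! suc k) ≤⟨ ℚ.+-monoʳ-≤ (expSum k) (ℚ.+-mono-≤ h h) ⟩
    expSum k + (½ * 1/! k + ½ * 1/! k) ≡⟨ cong (λ z → expSum k + z) (half+half (1/! k)) ⟩
    expSum k + 1/! k ∎

expSum-close : ∀ n m → 1 ℕ.≤ n → n ℕ.≤ m → ℚ.∣ expSum m - expSum n ∣ ℚ.≤ 1/! n
expSum-close n m 1≤n n≤m =
  subst (λ m → ℚ.∣ expSum m - expSum n ∣ ℚ.≤ 1/! n) (ℕ.m∸n+n≡m n≤m) close
  where
  open ℚ.≤-Reasoning
  open +-*-Solver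
  j = m ℕ.∸ n
  close : ℚ.∣ expSum (j ℕ.+ n) - expSum n ∣ ℚ.≤ 1/! n
  close = begin
    ℚ.∣ expSum (j ℕ.+ n) - expSum n ∣
      ≡⟨ ℚ.0≤p⇒∣p∣≡p (p≤q⇒0≤q-p (expSum-mono n j)) ⟩
    expSum (j ℕ.+ n) - expSum n
      ≤⟨ ℚ.+-monoˡ-≤ (- expSum n) (ℚ.≤-trans
           (p≤p+q {expSum (j ℕ.+ n)} {1/! (j ℕ.+ n)} {{ℚ.nonNegative (0≤1/! (j ℕ.+ n))}})
           (expSum-upper n j 1≤n)) ⟩
    expSum n + 1/! n - expSum n
      ≡⟨ solve 2 (λ a b → a :+ b :- a := b) refl (expSum n) (1/! n) ⟩
    1/! n ∎

n≤n! : ∀ n → n ℕ.≤ n !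
n≤n! zero    = ℕ.z≤n
n≤n! (suc n) = ℕ.m≤m*n (suc n) (n !) {{n ℕ.!≢0}}

1/!-small : ∀ ε → 0ℚ ℚ.< ε → ∃[ n ] 1 ℕ.≤ n × 1/! n ℚ.≤ ε
1/!-small ε@(mkℚ +[1+ a ] d _) _ = suc d , ℕ.s≤s ℕ.z≤n ,
  subst (1/! suc d ℚ.≤_) (ℚ.↥p/↧p≡p ε)
    (/-mono-≤ 1 (suc d !) (suc a) (suc d) {{suc d ℕ.!≢0}}
      (ℕ.*-mono-≤ {1} {suc a} (ℕ.s≤s ℕ.z≤n) (n≤n! (suc d))))
1/!-small (mkℚ (+ 0) _ _) (*<* (+<+ ()))
1/!-small (mkℚ -[1+ _ ] _ _) (*<* ())

e : ℝ
e = mkℝ expSum isCauchy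
  where
  isCauchy : CauchySeq expSum
  isCauchy ε 0<ε with 1/!-small (½ * ε) (pos-* 0<½ 0<ε)
  ... | N , 1≤N , small = N , λ m n N≤m N≤n → begin
      ℚ.∣ expSum m - expSum n ∣
        ≡⟨ cong ℚ.∣_∣ (solve 3 (λ a b c → a :- b := (a :- c) :+ (c :- b))
             refl (expSum m) (expSum n) (expSum N)) ⟩
      ℚ.∣ (expSum m - expSum N) + (expSum N - expSum n) ∣
        ≤⟨ ℚ.∣p+q∣≤∣p∣+∣q∣ (expSum m - expSum N) (expSum N - expSum n) ⟩
      ℚ.∣ expSum m - expSum N ∣ + ℚ.∣ expSum N - expSum n ∣
        ≡⟨ cong (λ z → ℚ.∣ expSum m - expSum N ∣ + z) (∣-∣-swap (expSum N) (expSum n)) ⟩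
      ℚ.∣ expSum m - expSum N ∣ + ℚ.∣ expSum n - expSum N ∣
        ≤⟨ ℚ.+-mono-≤ (ℚ.≤-trans (expSum-close N m 1≤N N≤m) small)
                      (ℚ.≤-trans (expSum-close N n 1≤N N≤n) small) ⟩
      ½ * ε + ½ * ε
        ≡⟨ half+half ε ⟩
      ε ∎
    where
    open ℚ.≤-Reasoning
    open +-*-Solver

t<k⇒k≢0 : ∀ {t k} → t ℕ.< k → ℕ.NonZero k
t<k⇒k≢0 (ℕ.s≤s _) = _

1-t/k≢0 : ∀ {t k} (t<k : t ℕ.< k) →
          NonZero (1ℚ - ((+ t) / k) {{t<k⇒k≢0 t<k}})
1-t/k≢0 {t} {k} t<k = ℚ.>-nonZero (subst (ℚ._< 1ℚ - q) (ℚ.+-inverseʳ q)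
  (ℚ.+-monoˡ-< (- q) (/-mono-< t k 1 1 {{t<k⇒k≢0 t<k}}
    (subst₂ ℕ._<_ (sym (ℕ.*-identityʳ t)) (sym (ℕ.*-identityˡ k)) t<k))))
  where q = ((+ t) / k) {{t<k⇒k≢0 t<k}}

-- max{(t+2)², k/(1-t/k)}
crossBound : (k t : ℕ) → t ℕ.< k → ℚ
crossBound k t t<k =
  ((+ ((t ℕ.+ 2) ℕ.^ 2)) / 1) ⊔ (((+ k) / 1) ÷ (1ℚ - (+ t) / k))
  where
  instance
    _ = t<k⇒k≢0 t<k
    _ = 1-t/k≢0 t<k

-- Ω = Fin n.  Families are compared extensionally, with _≗_.
Family : ℕ → Set
Family n = Subset n → Bool

infix 4 _∈ᶠ_ _⊆ᶠ_

_∈ᶠ_ : ∀ {n} → Subset n → Family n → Set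
S ∈ᶠ 𝓐 = T (𝓐 S)

_⊆ᶠ_ : ∀ {n} → Family n → Family n → Set
𝓕 ⊆ᶠ 𝓐 = ∀ S → S ∈ᶠ 𝓕 → S ∈ᶠ 𝓐

Nonempty : ∀ {n} → Family n → Set
Nonempty 𝓐 = ∃[ S ] S ∈ᶠ 𝓐

Uniform : ∀ {n} → ℕ → Family n → Set
Uniform k 𝓐 = ∀ S → S ∈ᶠ 𝓐 → ∣ S ∣ ≡ k

subsets : ∀ n → List (Subset n)
subsets zero    = [] ∷ []
subsets (suc n) = map (outside ∷_) (subsets n) ++ map (inside ∷_) (subsets n)

card : ∀ {n} → Family n → ℕ
card {n} 𝓐 = length (filterᵇ 𝓐 (subsets n))

infix 9 _[_]

_[_] : ∀ {n} → Family n → Subset n → Family n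
(𝓐 [ S ]) A = 𝓐 A ∧ ⌊ S ⊆? A ⌋

-- The maximum with base value 0 gives 0 when there is no S of size s.
Δ : ∀ {n} → ℕ → Family n → ℕ
Δ {n} s 𝓐 = max 0 (map (λ S → card (𝓐 [ S ])) (filter (λ S → ∣ S ∣ ℕ.≟ s) (subsets n)))

-- r⁻ˢ is (inv r)ˢ; the argument 0 < r is what makes the inverse defined.
WeaklySpread : ∀ {n} (r : ℝ) → fromℕ 0 <ᴿ r → ℕ → Family n → Set
WeaklySpread r 0<r t 𝓐 =
  ∀ s → fromℕ (Δ (t ℕ.+ s) 𝓐) ≤ᴿ (inv r 0<r ^ᴿ s) *ᴿ fromℕ (Δ t 𝓐)

Intersecting : ∀ {n} → ℕ → Family n → Set
Intersecting t 𝓕 = ∀ F F′ → F ∈ᶠ 𝓕 → F′ ∈ᶠ 𝓕 → t ℕ.≤ ∣ F ∩ F′ ∣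

CrossIntersecting : ∀ {n} → ℕ → Family n → Family n → Set
CrossIntersecting t 𝓕 𝓖 = ∀ F G → F ∈ᶠ 𝓕 → G ∈ᶠ 𝓖 → t ℕ.≤ ∣ F ∩ G ∣

module Submission where

-- Generate the families by sets of size at most t + J, for J descending from k - t to 0,
-- saturated so that every set of size less than t + J meeting all generators (of the
-- other family) in t elements is itself a generator.  A member without a generator of
-- size less than t + J contains no set of that size meeting all generators, so it can be
-- traced inside one fixed generator A and then be completed to t + J elements outside A,
-- each time choosing from T ∖ A for a generator T that the current set meets in fewer
-- than t elements.  Since T and A meet (directly, or through a third generator) T ∖ A
-- has O(J) elements instead of k, and together with Δ_{t+J} ≤ r^{-J} Δ_t the members
-- lost at all levels J ≥ 1 are a small part of Δ_t.  If the descent reaches J = 0, the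
-- only generator is one set X of size t, and a member missing X forces all members
-- containing X through an additional element.  Otherwise one family is exhausted at a
-- level L, and the other has at most (t + L choose t) Δ_t members not yet counted.

-- Everything rests on a numerical budget. Since 2e > 16/3, level I carries the weight (3/(16 M))^I,
-- with M = k in (i) and M = max((t+2)^2, k) in (ii); denominators are cleared, so the counting
-- stays in the natural numbers. In (i) all levels together cost 171/224 of `Δ t 𝓐`, and a star
-- missed by some member retains at most 3/16 of it; the sum is below 1. In (ii) an exhausted family
-- is small, but its partner may have (t + L choose t) `Δ t` members, so the level sums are needed
-- with an extra binomial factor. Another binomial comes from the tracing inside A, and M ≥ (t+2)^2
-- absorbs the resulting squares as long as I is not large compared with t. Every outcome except a
-- common star loses by a strict margin, which is why equality forces the star. The equality clauses
-- carry t ≤ n because otherwise no X exists, and in (ii) nonemptiness of 𝓐 and 𝓑 because with 𝓐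
-- empty both products vanish for every 𝓖.

open import Defs
open import Data.Nat as ℕ using (ℕ; zero; suc; _∸_; _^_; _⊓_; _≤_; _<_; z≤n; s≤s; NonZero)
import Data.Nat.Properties as ℕ
open import Data.Product using (∃-syntax; _×_; _,_; proj₁; proj₂)
import Data.Rational as ℚ
import Data.Rational.Properties as ℚ
open import Data.Sum using (_⊎_; inj₁; inj₂) renaming ([_,_] to either)
open import Relation.Binary.PropositionalEquality hiding ([_]; J)
open import Relation.Nullary using (¬_; Dec; yes; no; contradiction)

-- From the real parameter r to natural numbers

module Spreadness where

  open import Data.Integer using (+_)
  import Data.Integer.Properties as ℤ
  open import Data.Rational using (ℚ; 0ℚ; 1ℚ; _/_; 1/_; _÷_; _⊔_; _+_; _-_; _*_; -_)
  import Data.Rational.Unnormalised as ℚᵘ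
  import Data.Rational.Unnormalised.Properties as ℚᵘ
  open import Data.Rational.Solver using (module +-*-Solver)

  infix 8 _/1
  _/1 : ℕ → ℚ
  n /1 = (+ n) / 1

  /1-mono-≤ : ∀ {a b} → a ≤ b → a /1 ℚ.≤ b /1
  /1-mono-≤ {a} {b} a≤b = /-mono-≤ a 1 b 1 (ℕ.*-monoˡ-≤ 1 a≤b)

  /1-cancel-≤ : ∀ {a b} → a /1 ℚ.≤ b /1 → a ≤ b
  /1-cancel-≤ {a} {b} a≤b with a ℕ.≤? b
  ... | yes p = p
  ... | no ¬p = contradiction (ℚ.<-≤-trans (/-mono-< b 1 a 1 (ℕ.*-monoˡ-< 1 (ℕ.≰⇒> ¬p))) a≤b) (ℚ.<-irrefl refl)

  /1-homo-* : ∀ a b → (a ℕ.* b) /1 ≡ a /1 * b /1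
  /1-homo-* a b = ℚ.toℚᵘ-injective
    (ℚᵘ.≃-trans (ℚ.toℚᵘ-fromℚᵘ (ℚᵘ.mkℚᵘ (+ (a ℕ.* b)) 0))
    (ℚᵘ.≃-trans (ℚᵘ.≃-reflexive (cong (λ z → ℚᵘ.mkℚᵘ z 0) (ℤ.pos-* a b)))
    (ℚᵘ.≃-sym (ℚᵘ.≃-trans (ℚ.toℚᵘ-homo-* (a /1) (b /1))
      (ℚᵘ.*-cong (ℚ.toℚᵘ-fromℚᵘ (ℚᵘ.mkℚᵘ (+ a) 0)) (ℚ.toℚᵘ-fromℚᵘ (ℚᵘ.mkℚᵘ (+ b) 0)))))))

  0≤/1 : ∀ n → 0ℚ ℚ.≤ n /1
  0≤/1 n = /1-mono-≤ {0} {n} z≤n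

  ≤+ε⇒≤ : ∀ {p q} → (∀ ε → 0ℚ ℚ.< ε → p ℚ.≤ q + ε) → p ℚ.≤ q
  ≤+ε⇒≤ {p} {q} h with p ℚ.≤? q
  ... | yes p≤q = p≤q
  ... | no p≰q with ℚ.<-dense (ℚ.≰⇒> p≰q)
  ...   | m , q<m , m<p = contradiction (ℚ.<-≤-trans m<p p≤m) (ℚ.<-irrefl refl)
    where
    open +-*-Solver
    p≤m : p ℚ.≤ m
    p≤m = ℚ.≤-trans (h (m - q) (subst (ℚ._< m - q) (ℚ.+-inverseʳ q) (ℚ.+-monoˡ-< (- q) q<m)))
      (ℚ.≤-reflexive (solve 2 (λ q m → q :+ (m :- q) := m) refl q m))

  -- Stated for the terms of the sequence instead of with `_≤ᴿ_`, so that no error term appears when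
  -- it is raised to the power s.
  EventuallyAtLeast16/3 : ℝ → ℕ → Set
  EventuallyAtLeast16/3 r M = ∃[ N ] ∀ j → N ≤ j → (16 ℕ.* M) /1 ℚ.≤ 3 /1 * seq r j

  -- e > 65/24, so 2e > 65/12, and the slack 1/12 absorbs the error of the approximations.
  2eM≤r⇒16M≤3r : ∀ r c M → 1 ≤ M → M /1 ℚ.≤ c → (fromℕ 2 *ᴿ e) *ᴿ fromℚ c ≤ᴿ r → EventuallyAtLeast16/3 r M
  2eM≤r⇒16M≤3r r c M 1≤M M≤c 2ec≤r = 4 ℕ.⊔ proj₁ eventually , λ j N≤j → bound j
    (ℕ.m⊔n≤o⇒m≤o 4 (proj₁ eventually) N≤j) (proj₂ eventually j (ℕ.m⊔n≤o⇒n≤o 4 (proj₁ eventually) N≤j))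
    where
    m κ a ε : ℚ
    m = M /1
    κ = (+ 1) / 12
    -- This is `expSum 4` = 1 + 1 + 1/2 + 1/6 + 1/24, hence the restriction to indices from 4 on.
    a = (+ 65) / 24
    ε = m * κ
    0<ε : 0ℚ ℚ.< ε
    0<ε = pos-* (ℚ.<-≤-trans 0<1 (/1-mono-≤ 1≤M)) (/-mono-< 0 1 1 12 (s≤s z≤n))
    eventually = 2ec≤r ε 0<ε
    bound : ∀ j → 4 ≤ j → (2 /1 * expSum j) * c ℚ.≤ seq r j + ε → (16 ℕ.* M) /1 ℚ.≤ 3 /1 * seq r j
    bound j 4≤j h = begin
      (16 ℕ.* M) /1
        ≡⟨ /1-homo-* 16 M ⟩
      16 /1 * m
        ≡⟨ solve 1 (λ m → con (16 /1) :* m := con (3 /1) :* ((con (2 /1) :* con a) :* m :- m :* con κ)) refl m ⟩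
      3 /1 * ((2 /1 * a) * m - ε)
        ≤⟨ ℚ.*-monoˡ-≤-nonNeg (3 /1) (ℚ.+-monoˡ-≤ (- ε) (ℚ.≤-trans
             (*-mono-≤-0≤ (0≤/1 M) (ℚ.≤-trans (ℚ.<⇒≤ (/-mono-< 0 1 65 12 (s≤s z≤n))) 2a≤) 2a≤ M≤c) h)) ⟩
      3 /1 * (seq r j + ε - ε)
        ≡⟨ cong (3 /1 *_) (solve 2 (λ x y → x :+ y :- y := x) refl (seq r j) ε) ⟩
      3 /1 * seq r j ∎
      where
      open ℚ.≤-Reasoning
      open +-*-Solver
      2a≤ : 2 /1 * a ℚ.≤ 2 /1 * expSum j
      2a≤ = ℚ.*-monoˡ-≤-nonNeg (2 /1) (subst (λ j → a ℚ.≤ expSum j) (ℕ.m∸n+n≡m 4≤j) (expSum-mono 4 (j ∸ 4)))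

  -- Both sides of the conclusion are constants, so for each ε one late index j suffices: there the
  -- term of the inverse is at most 3/(16 M), and its s-th power can be compared with the hypothesis
  -- at the same j.
  spread⇒ℕ : ∀ {n} r (0<r : fromℕ 0 <ᴿ r) t (𝓐 : Family n) M → 1 ≤ M → EventuallyAtLeast16/3 r M →
             WeaklySpread r 0<r t 𝓐 → ∀ s → Δ (t ℕ.+ s) 𝓐 ℕ.* (16 ℕ.* M) ^ s ≤ 3 ^ s ℕ.* Δ t 𝓐
  spread⇒ℕ r 0<r@(η , 0<η , N₀ , lower) t 𝓐 M 1≤M (N₁ , 16M≤3r) spread s =
    /1-cancel-≤ (≤+ε⇒≤ limit)
    where
    R P : ℕ
    R = 16 ℕ.* M
    P = R ^ s

    y : ℕ → ℚ
    y j = seq (inv r 0<r) j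

    0≤y : ∀ j → 0ℚ ℚ.≤ y j
    0≤y j = ℚ.<⇒≤ (pos-1/ (⊔-pos (seq r j) 0<η))

    yR≤3 : ∀ j → N₁ ≤ j → y j * R /1 ℚ.≤ 3 /1
    yR≤3 j N≤j = begin
      y j * R /1                        ≤⟨ ℚ.*-monoˡ-≤-nonNeg (y j) {{ℚ.nonNegative (0≤y j)}} (ℚ.≤-trans (16M≤3r j N≤j)
                                             (ℚ.*-monoˡ-≤-nonNeg (3 /1) (ℚ.p≤p⊔q (seq r j) η))) ⟩
      y j * (3 /1 * (seq r j ⊔ η))      ≡⟨ solve 3 (λ y t p → y :* (t :* p) := t :* (p :* y)) refl (y j) (3 /1) (seq r j ⊔ η) ⟩
      3 /1 * ((seq r j ⊔ η) * y j)      ≡⟨ cong (3 /1 *_) (ℚ.*-inverseʳ (seq r j ⊔ η) {{ℚ.>-nonZero (⊔-pos (seq r j) 0<η)}}) ⟩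
      3 /1 * 1ℚ                         ≡⟨ ℚ.*-identityʳ (3 /1) ⟩
      3 /1                              ∎
      where
      open ℚ.≤-Reasoning
      open +-*-Solver

    power≤ : ∀ j → N₁ ≤ j → ∀ s → seq (inv r 0<r ^ᴿ s) j * (R ^ s) /1 ℚ.≤ (3 ^ s) /1
    power≤ j N≤j zero    = ℚ.≤-refl
    power≤ j N≤j (suc s) = begin
      y j * p * (R ℕ.* R ^ s) /1        ≡⟨ cong (y j * p *_) (/1-homo-* R (R ^ s)) ⟩
      y j * p * (R /1 * (R ^ s) /1)     ≡⟨ solve 4 (λ y p a b → y :* p :* (a :* b) := (y :* a) :* (p :* b)) refl (y j) p (R /1) ((R ^ s) /1) ⟩
      (y j * R /1) * (p * (R ^ s) /1)   ≤⟨ *-mono-≤-0≤ (0≤p*R s) (0≤/1 3) (yR≤3 j N≤j) (power≤ j N≤j s) ⟩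
      3 /1 * (3 ^ s) /1                 ≡⟨ /1-homo-* 3 (3 ^ s) ⟨
      (3 ℕ.* 3 ^ s) /1                  ∎
      where
      open ℚ.≤-Reasoning
      open +-*-Solver
      p = seq (inv r 0<r ^ᴿ s) j
      0≤* : ∀ {a b} → 0ℚ ℚ.≤ a → 0ℚ ℚ.≤ b → 0ℚ ℚ.≤ a * b
      0≤* {a} {b} 0≤a 0≤b = ℚ.nonNegative⁻¹ (a * b)
        {{ℚ.nonNeg*nonNeg⇒nonNeg a {{ℚ.nonNegative 0≤a}} b {{ℚ.nonNegative 0≤b}}}}
      0≤p : ∀ s → 0ℚ ℚ.≤ seq (inv r 0<r ^ᴿ s) j
      0≤p zero    = 0≤/1 1
      0≤p (suc s) = 0≤* (0≤y j) (0≤p s)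
      0≤p*R : ∀ s → 0ℚ ℚ.≤ seq (inv r 0<r ^ᴿ s) j * (R ^ s) /1
      0≤p*R s = 0≤* (0≤p s) (0≤/1 (R ^ s))

    0<P : 0ℚ ℚ.< P /1
    0<P = ℚ.<-≤-trans 0<1 (/1-mono-≤ {1} (ℕ.m^n>0 R {{ℕ.>-nonZero (ℕ.*-mono-≤ {1} {16} (s≤s z≤n) 1≤M)}} s))

    limit : ∀ ε → 0ℚ ℚ.< ε → (Δ (t ℕ.+ s) 𝓐 ℕ.* P) /1 ℚ.≤ (3 ^ s ℕ.* Δ t 𝓐) /1 + ε
    limit ε 0<ε = begin
      (Δ (t ℕ.+ s) 𝓐 ℕ.* P) /1
        ≡⟨ /1-homo-* (Δ (t ℕ.+ s) 𝓐) P ⟩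
      Δ (t ℕ.+ s) 𝓐 /1 * P /1
        ≤⟨ ℚ.*-monoʳ-≤-nonNeg (P /1) {{ℚ.nonNegative (0≤/1 P)}} (proj₂ ev j (ℕ.m≤n⊔m N₁ (proj₁ ev))) ⟩
      (p * Δ t 𝓐 /1 + δ) * P /1
        ≡⟨ solve 4 (λ p d δ P → (p :* d :+ δ) :* P := (p :* P) :* d :+ P :* δ) refl p (Δ t 𝓐 /1) δ (P /1) ⟩
      p * P /1 * Δ t 𝓐 /1 + P /1 * δ
        ≤⟨ ℚ.+-mono-≤ (ℚ.*-monoʳ-≤-nonNeg (Δ t 𝓐 /1) {{ℚ.nonNegative (0≤/1 (Δ t 𝓐))}} (power≤ j (ℕ.m≤m⊔n N₁ (proj₁ ev)) s))
             (ℚ.≤-reflexive (cancel-1/ (P /1) ε {{ℚ.>-nonZero 0<P}})) ⟩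
      (3 ^ s) /1 * Δ t 𝓐 /1 + ε
        ≡⟨ cong (_+ ε) (/1-homo-* (3 ^ s) (Δ t 𝓐)) ⟨
      (3 ^ s ℕ.* Δ t 𝓐) /1 + ε ∎
      where
      open ℚ.≤-Reasoning
      open +-*-Solver
      -- The error gets multiplied by P below.
      δ  = ε * (1/ (P /1)) {{ℚ.>-nonZero 0<P}}
      ev = spread s δ (pos-* 0<ε (pos-1/ 0<P))
      j  = N₁ ℕ.⊔ proj₁ ev
      p  = seq (inv r 0<r ^ᴿ s) j

  crossBound≥[t+2]² : ∀ k t (t<k : t < k) → ((t ℕ.+ 2) ℕ.* (t ℕ.+ 2)) /1 ℚ.≤ crossBound k t t<k
  crossBound≥[t+2]² k t t<k = ℚ.≤-trans
    (ℚ.≤-reflexive (cong (λ x → ((t ℕ.+ 2) ℕ.* x) /1) (sym (ℕ.*-identityʳ (t ℕ.+ 2)))))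
    (ℚ.p≤p⊔q _ _)

  -- Dividing by 1 - t/k, which lies in (0, 1], does not decrease k.
  crossBound≥k : ∀ k t (t<k : t < k) → k /1 ℚ.≤ crossBound k t t<k
  crossBound≥k k t t<k = ℚ.≤-trans k≤k/x (ℚ.p≤q⊔p (((t ℕ.+ 2) ℕ.^ 2) /1) _)
    where
    instance
      _ = t<k⇒k≢0 t<k
      _ = 1-t/k≢0 t<k
    open ℚ.≤-Reasoning
    open +-*-Solver
    q x x⁻¹ : ℚ
    q = (+ t) / k
    x = 1ℚ - q
    x⁻¹ = 1/ x
    0<x : 0ℚ ℚ.< x
    0<x = subst (ℚ._< 1ℚ - q) (ℚ.+-inverseʳ q)
      (ℚ.+-monoˡ-< (- q) (/-mono-< t k 1 1
        (subst₂ ℕ._<_ (sym (ℕ.*-identityʳ t)) (sym (ℕ.*-identityˡ k)) t<k)))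
    0≤x⁻¹ : 0ℚ ℚ.≤ x⁻¹
    0≤x⁻¹ = ℚ.<⇒≤ (pos-1/ 0<x)
    x≤1 : x ℚ.≤ 1ℚ
    x≤1 = begin
      1ℚ - q       ≤⟨ p≤p+q {1ℚ - q} {q} {{ℚ.nonNegative (/-mono-≤ 0 1 t k z≤n)}} ⟩
      1ℚ - q + q   ≡⟨ solve 2 (λ a b → a :- b :+ b := a) refl 1ℚ q ⟩
      1ℚ           ∎
    k≤k/x : k /1 ℚ.≤ k /1 ÷ x
    k≤k/x = begin
      k /1               ≡⟨ ℚ.*-identityʳ (k /1) ⟨
      k /1 * 1ℚ          ≡⟨ cong (k /1 *_) (ℚ.*-inverseʳ x) ⟨
      k /1 * (x * x⁻¹)   ≤⟨ ℚ.*-monoˡ-≤-nonNeg (k /1) {{ℚ.nonNegative (0≤/1 k)}}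
                              (ℚ.*-monoʳ-≤-nonNeg x⁻¹ {{ℚ.nonNegative 0≤x⁻¹}} x≤1) ⟩
      k /1 * (1ℚ * x⁻¹)  ≡⟨ cong (k /1 *_) (ℚ.*-identityˡ x⁻¹) ⟩
      k /1 * x⁻¹         ∎

  -- Replaces the rational threshold by a natural number, the M of the counting in (ii).
  max≤crossBound : ∀ k t (t<k : t < k) → ((t ℕ.+ 2) ℕ.* (t ℕ.+ 2) ℕ.⊔ k) /1 ℚ.≤ crossBound k t t<k
  max≤crossBound k t t<k = bound (ℕ.⊔-sel ((t ℕ.+ 2) ℕ.* (t ℕ.+ 2)) k)
    where
    bound : ∀ {m} → m ≡ (t ℕ.+ 2) ℕ.* (t ℕ.+ 2) ⊎ m ≡ k → m /1 ℚ.≤ crossBound k t t<k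
    bound (inj₁ refl) = crossBound≥[t+2]² k t t<k
    bound (inj₂ refl) = crossBound≥k k t t<k

open Spreadness using (_/1; spread⇒ℕ; 2eM≤r⇒16M≤3r; max≤crossBound)

-- Finite sets and their cardinalities

open import Data.Bool as Bool using (Bool; true; false; T; T?; not; _xor_)
open import Data.Bool.Properties using (T-∧)
open import Data.Empty using (⊥-elim)
open import Data.Fin as Fin using (Fin; zero; suc)
import Data.Fin.Properties as Fin
open import Data.Fin.Subset as Sub
  using (Subset; inside; outside; _⊆_; _⊈_; _∈_; _∉_; _∩_; _∪_; _─_; _-_; ∣_∣; ⁅_⁆)
open import Data.Fin.Subset.Properties
open import Data.List as List using (List; []; _∷_; _++_; map; filterᵇ; filter; length)
open import Data.List.Extrema.Nat using (xs≤max)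
open import Data.List.Membership.Propositional using (find) renaming (_∈_ to _∈ˡ_)
open import Data.List.Membership.Propositional.Properties
  using (∈-map⁺; ∈-++⁺ˡ; ∈-++⁺ʳ; ∈-filter⁺; ∈-filter⁻)
open import Data.List.Relation.Unary.All as All using (All; []; _∷_; all?)
open import Data.List.Relation.Unary.All.Properties using (¬All⇒Any¬)
open import Data.List.Relation.Unary.Any as Any using (here; there; any?)
open import Data.Nat.Combinatorics using (_C_; nCk+nC[k+1]≡[n+1]C[k+1]; nC1≡n; nCk≡nC[n∸k])
open import Data.Nat.Combinatorics.Specification using (k>n⇒nCk≡0)
open import Data.Nat.Tactic.RingSolver using (solve-∀)
open import Data.Vec using ([]; _∷_; here; there)
open import Function using (_∘_; id; const)
open import Function.Bundles using (Equivalence; _⇔_; mk⇔)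
open import Relation.Nullary.Decidable
  using (¬?; _×-dec_; _→-dec_; decidable-stable; fromWitness)
open import Data.Nat using (_+_; _*_; _⊔_)
open import Data.Nat.Properties hiding (_≟_; _≤?_; _<?_)

private variable
  n m m₁ m₂ : ℕ
  Elem : Set

∣p∪⁅x⁆∣≡1+∣p∣ : {p : Subset n} {x : Fin n} → x ∉ p → ∣ p ∪ ⁅ x ⁆ ∣ ≡ suc ∣ p ∣
∣p∪⁅x⁆∣≡1+∣p∣ {p = inside  ∷ p} {zero}  x∉p = contradiction here x∉p
∣p∪⁅x⁆∣≡1+∣p∣ {p = outside ∷ p} {zero}  x∉p = cong (suc ∘ ∣_∣) (∪-identityʳ p)
∣p∪⁅x⁆∣≡1+∣p∣ {p = inside  ∷ p} {suc x} x∉p = cong suc (∣p∪⁅x⁆∣≡1+∣p∣ (x∉p ∘ there))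
∣p∪⁅x⁆∣≡1+∣p∣ {p = outside ∷ p} {suc x} x∉p = ∣p∪⁅x⁆∣≡1+∣p∣ (x∉p ∘ there)

1+∣p-x∣≡∣p∣ : {p : Subset n} {x : Fin n} → x ∈ p → suc ∣ p - x ∣ ≡ ∣ p ∣
1+∣p-x∣≡∣p∣ {p = inside  ∷ p} here        = cong (suc ∘ ∣_∣) (p─⊥≡p p)
1+∣p-x∣≡∣p∣ {p = inside  ∷ p} (there x∈p) = cong suc (1+∣p-x∣≡∣p∣ x∈p)
1+∣p-x∣≡∣p∣ {p = outside ∷ p} (there x∈p) = 1+∣p-x∣≡∣p∣ x∈p

x∉p-x : (p : Subset n) (x : Fin n) → x ∉ p - x
x∉p-x (inside  ∷ p) (suc x) (there x∈) = x∉p-x p x x∈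
x∉p-x (outside ∷ p) (suc x) (there x∈) = x∉p-x p x x∈

x∈p─q⇒x∉q : (p q : Subset n) {x : Fin n} → x ∈ p ─ q → x ∉ q
x∈p─q⇒x∉q (_ ∷ p) (outside ∷ q) (there x∈) (there x∈q) = x∈p─q⇒x∉q p q x∈ x∈q
x∈p─q⇒x∉q (_ ∷ p) (inside  ∷ q) (there x∈) (there x∈q) = x∈p─q⇒x∉q p q x∈ x∈q

∣p∣<∣q∣⇒∃∈∖ : (p q : Subset n) → ∣ p ∣ < ∣ q ∣ → ∃[ x ] x ∈ q × x ∉ p
∣p∣<∣q∣⇒∃∈∖ p q p<q with Fin.any? (λ x → (x ∈? q) ×-dec ¬? (x ∈? p))
... | yes found = found
... | no  none  = contradiction (p⊆q⇒∣p∣≤∣q∣ q⊆p) (<⇒≱ p<q)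
  where
  q⊆p : q ⊆ p
  q⊆p {x} x∈q = decidable-stable (x ∈? p) (λ x∉p → none (x , x∈q , x∉p))

∣p─q∣+∣p∩q∣≡∣p∣ : (p q : Subset n) → ∣ p ─ q ∣ + ∣ p ∩ q ∣ ≡ ∣ p ∣
∣p─q∣+∣p∩q∣≡∣p∣ []            []            = refl
∣p─q∣+∣p∩q∣≡∣p∣ (inside  ∷ p) (inside  ∷ q) =
  trans (+-suc ∣ p ─ q ∣ ∣ p ∩ q ∣) (cong suc (∣p─q∣+∣p∩q∣≡∣p∣ p q))
∣p─q∣+∣p∩q∣≡∣p∣ (inside  ∷ p) (outside ∷ q) = cong suc (∣p─q∣+∣p∩q∣≡∣p∣ p q)
∣p─q∣+∣p∩q∣≡∣p∣ (outside ∷ p) (inside  ∷ q) = ∣p─q∣+∣p∩q∣≡∣p∣ p q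
∣p─q∣+∣p∩q∣≡∣p∣ (outside ∷ p) (outside ∷ q) = ∣p─q∣+∣p∩q∣≡∣p∣ p q

∣p∪q∣+∣p∩q∣≡∣p∣+∣q∣ : (p q : Subset n) → ∣ p ∪ q ∣ + ∣ p ∩ q ∣ ≡ ∣ p ∣ + ∣ q ∣
∣p∪q∣+∣p∩q∣≡∣p∣+∣q∣ []            []            = refl
∣p∪q∣+∣p∩q∣≡∣p∣+∣q∣ (outside ∷ p) (outside ∷ q) = ∣p∪q∣+∣p∩q∣≡∣p∣+∣q∣ p q
∣p∪q∣+∣p∩q∣≡∣p∣+∣q∣ (inside  ∷ p) (outside ∷ q) = cong suc (∣p∪q∣+∣p∩q∣≡∣p∣+∣q∣ p q)
∣p∪q∣+∣p∩q∣≡∣p∣+∣q∣ (outside ∷ p) (inside  ∷ q) =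
  trans (cong suc (∣p∪q∣+∣p∩q∣≡∣p∣+∣q∣ p q)) (sym (+-suc ∣ p ∣ ∣ q ∣))
∣p∪q∣+∣p∩q∣≡∣p∣+∣q∣ (inside  ∷ p) (inside  ∷ q) = cong suc
  (trans (+-suc ∣ p ∪ q ∣ ∣ p ∩ q ∣)
    (trans (cong suc (∣p∪q∣+∣p∩q∣≡∣p∣+∣q∣ p q)) (sym (+-suc ∣ p ∣ ∣ q ∣))))

∣p∪q∣≤∣p∣+∣q∣ : (p q : Subset n) → ∣ p ∪ q ∣ ≤ ∣ p ∣ + ∣ q ∣
∣p∪q∣≤∣p∣+∣q∣ p q = subst (∣ p ∪ q ∣ ≤_) (∣p∪q∣+∣p∩q∣≡∣p∣+∣q∣ p q) (m≤m+n _ _)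

-- Inclusion-exclusion for the traces of p and q on s. It makes two generators meet when both meet a
-- third.
∣p∩s∣+∣q∩s∣≤∣s∣+∣p∩q∣ : (s p q : Subset n) → ∣ p ∩ s ∣ + ∣ q ∩ s ∣ ≤ ∣ s ∣ + ∣ p ∩ q ∣
∣p∩s∣+∣q∩s∣≤∣s∣+∣p∩q∣ s p q = begin
  ∣ p ∩ s ∣ + ∣ q ∩ s ∣                             ≡⟨ ∣p∪q∣+∣p∩q∣≡∣p∣+∣q∣ (p ∩ s) (q ∩ s) ⟨
  ∣ p ∩ s ∪ q ∩ s ∣ + ∣ (p ∩ s) ∩ (q ∩ s) ∣         ≤⟨ +-mono-≤ (p⊆q⇒∣p∣≤∣q∣ ∪⊆s) (p⊆q⇒∣p∣≤∣q∣ ∩⊆p∩q) ⟩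
  ∣ s ∣ + ∣ p ∩ q ∣                                 ∎
  where
  open ≤-Reasoning
  ∪⊆s : p ∩ s ∪ q ∩ s ⊆ s
  ∪⊆s x∈ = either (p∩q⊆q p s) (p∩q⊆q q s) (x∈p∪q⁻ (p ∩ s) (q ∩ s) x∈)
  ∩⊆p∩q : (p ∩ s) ∩ (q ∩ s) ⊆ p ∩ q
  ∩⊆p∩q x∈ = let x∈p∩s , x∈q∩s = x∈p∩q⁻ (p ∩ s) (q ∩ s) x∈ in
    x∈p∩q⁺ (p∩q⊆p p s x∈p∩s , p∩q⊆p q s x∈q∩s)

∣p∣≡1+m⇒∃∈ : (p : Subset n) → ∣ p ∣ ≡ suc m → ∃[ x ] x ∈ p
∣p∣≡1+m⇒∃∈ {n} p ∣p∣≡1+m with nonempty? p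
... | yes p≢∅ = p≢∅
... | no  p≡∅ = contradiction
  (trans (sym ∣p∣≡1+m) (trans (cong ∣_∣ (Empty-unique p≡∅)) (∣⊥∣≡0 n))) λ ()

∣p∣≡0⇒x∉p : (p : Subset n) {x : Fin n} → ∣ p ∣ ≡ 0 → x ∉ p
∣p∣≡0⇒x∉p p ∣p∣≡0 x∈p = contradiction (trans (1+∣p-x∣≡∣p∣ x∈p) ∣p∣≡0) λ ()

p⊆q∧∣q∣≤∣p∣⇒p≡q : (p q : Subset n) → p ⊆ q → ∣ q ∣ ≤ ∣ p ∣ → p ≡ q
p⊆q∧∣q∣≤∣p∣⇒p≡q p q p⊆q ∣q∣≤∣p∣ = ⊆-antisym p⊆q λ {x} x∈q →
  decidable-stable (x ∈? p) λ x∉p → <⇒≱ (p⊂q⇒∣p∣<∣q∣ (p⊆q , x , x∈q , x∉p)) ∣q∣≤∣p∣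

-- Counting

∈-subsets : (S : Subset n) → S ∈ˡ subsets n
∈-subsets []            = here refl
∈-subsets (outside ∷ S) = ∈-++⁺ˡ (∈-map⁺ _ (∈-subsets S))
∈-subsets (inside  ∷ S) = ∈-++⁺ʳ _ (∈-map⁺ _ (∈-subsets S))

countᵇ : (Elem → Bool) → List Elem → ℕ
countᵇ p xs = length (filterᵇ p xs)

countᵇ-⊎ : (f g h : Elem → Bool) → (∀ x → T (f x) → T (g x) ⊎ T (h x)) →
           ∀ xs → countᵇ f xs ≤ countᵇ g xs + countᵇ h xs
countᵇ-⊎ f g h split []       = z≤n
countᵇ-⊎ f g h split (x ∷ xs) with f x | g x | h x | split x | countᵇ-⊎ f g h split xs
... | false | false | false | _ | ih = ih
... | false | false | true  | _ | ih = ≤-trans ih (+-monoʳ-≤ (countᵇ g xs) (n≤1+n _))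
... | false | true  | false | _ | ih = m≤n⇒m≤1+n ih
... | false | true  | true  | _ | ih = m≤n⇒m≤1+n (≤-trans ih (+-monoʳ-≤ (countᵇ g xs) (n≤1+n _)))
... | true  | false | false | s | _  = either ⊥-elim ⊥-elim (s _)
... | true  | false | true  | _ | ih = ≤-trans (s≤s ih) (≤-reflexive (sym (+-suc (countᵇ g xs) _)))
... | true  | true  | false | _ | ih = s≤s ih
... | true  | true  | true  | _ | ih = s≤s (≤-trans ih (+-monoʳ-≤ (countᵇ g xs) (n≤1+n _)))

countᵇ-∅ : (f : Elem → Bool) → (∀ x → ¬ T (f x)) → ∀ xs → countᵇ f xs ≡ 0
countᵇ-∅ f ∅ []       = refl
countᵇ-∅ f ∅ (x ∷ xs) with f x | ∅ x
... | false | _  = countᵇ-∅ f ∅ xs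
... | true  | ¬t = contradiction _ ¬t

countᵇ-mono : (f g : Elem → Bool) → (∀ x → T (f x) → T (g x)) → ∀ xs → countᵇ f xs ≤ countᵇ g xs
countᵇ-mono f g f⇒g xs = ≤-trans (countᵇ-⊎ f g (const false) (λ x → inj₁ ∘ f⇒g x) xs)
  (≤-reflexive (trans (cong (countᵇ g xs +_) (countᵇ-∅ _ (λ _ ()) xs)) (+-identityʳ _)))

-- At a position where g holds and f fails, the rest of the list would have to count more for f than
-- for g. This turns equal cardinalities into extensional equality of families.
countᵇ-squeeze : (f g : Elem → Bool) → (∀ x → T (f x) → T (g x)) → ∀ xs → countᵇ g xs ≤ countᵇ f xs →
                 ∀ {x} → x ∈ˡ xs → T (g x) → T (f x)
countᵇ-squeeze f g f⇒g (y ∷ ys) g≤f x∈ gx with f y in fy | g y in gy | f⇒g y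
countᵇ-squeeze f g f⇒g (y ∷ ys) g≤f (here refl) gx | true  | _ | _ = subst T (sym fy) _
countᵇ-squeeze f g f⇒g (y ∷ ys) g≤f (here refl) gx | false | false | _ = ⊥-elim (subst T gy gx)
countᵇ-squeeze f g f⇒g (y ∷ ys) g≤f _ gx | false | true | _ =
  contradiction (countᵇ-mono f g f⇒g ys) (<⇒≱ g≤f)
countᵇ-squeeze f g f⇒g (y ∷ ys) g≤f (there x∈) gx | true | true | _ =
  countᵇ-squeeze f g f⇒g ys (ℕ.s≤s⁻¹ g≤f) x∈ gx
countᵇ-squeeze f g f⇒g (y ∷ ys) g≤f _ gx | true | false | t⇒f = ⊥-elim (t⇒f _)
countᵇ-squeeze f g f⇒g (y ∷ ys) g≤f (there x∈) gx | false | false | _ =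
  countᵇ-squeeze f g f⇒g ys g≤f x∈ gx

countᵇ-pos : (f : Elem → Bool) {x : Elem} {xs : List Elem} → x ∈ˡ xs → T (f x) → 1 ≤ countᵇ f xs
countᵇ-pos f {xs = y ∷ _} (here refl) fx with f y
... | true = s≤s z≤n
countᵇ-pos f {xs = y ∷ _} (there x∈) fx with f y | countᵇ-pos f x∈ fx
... | true  | _  = s≤s z≤n
... | false | ih = ih

card-pos : (𝓕 : Family n) {S : Subset n} → S ∈ᶠ 𝓕 → 1 ≤ card 𝓕
card-pos 𝓕 {S} = countᵇ-pos 𝓕 (∈-subsets S)

card-cong : {𝓕 𝓖 : Family n} → 𝓕 ≗ 𝓖 → card 𝓕 ≡ card 𝓖
card-cong {n} {𝓕} {𝓖} 𝓕≗𝓖 = ≤-antisym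
  (countᵇ-mono 𝓕 𝓖 (λ S → subst T (𝓕≗𝓖 S)) (subsets n))
  (countᵇ-mono 𝓖 𝓕 (λ S → subst T (sym (𝓕≗𝓖 S))) (subsets n))

T-ext : {a b : Bool} → (T a → T b) → (T b → T a) → a ≡ b
T-ext {false} {false} _ _ = refl
T-ext {false} {true}  _ g = ⊥-elim (g _)
T-ext {true}  {false} f _ = ⊥-elim (f _)
T-ext {true}  {true}  _ _ = refl

⊆ᶠ∧card≥⇒≗ : (𝓕 𝓖 : Family n) → 𝓕 ⊆ᶠ 𝓖 → card 𝓖 ≤ card 𝓕 → 𝓕 ≗ 𝓖
⊆ᶠ∧card≥⇒≗ {n} 𝓕 𝓖 𝓕⊆𝓖 𝓖≤𝓕 S = T-ext (𝓕⊆𝓖 S)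
  (countᵇ-squeeze 𝓕 𝓖 𝓕⊆𝓖 (subsets n) 𝓖≤𝓕 (∈-subsets S))

∈-[]⁺ : (𝓐 : Family n) {X S : Subset n} → S ∈ᶠ 𝓐 → X ⊆ S → S ∈ᶠ 𝓐 [ X ]
∈-[]⁺ 𝓐 {X} {S} S∈ X⊆S = Equivalence.from T-∧ (S∈ , fromWitness {a? = X ⊆? S} X⊆S)

card[X]≤Δ : (𝓐 : Family n) (X : Subset n) → card (𝓐 [ X ]) ≤ Δ ∣ X ∣ 𝓐
card[X]≤Δ {n} 𝓐 X = All.lookup (xs≤max 0 degrees)
  (∈-map⁺ (λ S → card (𝓐 [ S ])) (∈-filter⁺ (λ S → ∣ S ∣ ℕ.≟ ∣ X ∣) (∈-subsets X) refl))
  where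
  degrees = map (λ S → card (𝓐 [ S ])) (filter (λ S → ∣ S ∣ ℕ.≟ ∣ X ∣) (subsets n))

-- Quantifying over all families inside 𝓟 makes the count of a predicate
-- available without any decidability assumption on 𝓟.
AtMost : (Subset n → Set) → ℕ → Set
AtMost {n} 𝓟 m = (𝓕 : Family n) → (∀ S → S ∈ᶠ 𝓕 → 𝓟 S) → card 𝓕 ≤ m

private variable
  𝓟 𝓠 𝓡 : Subset n → Set

atMost-mono : (∀ S → 𝓟 S → 𝓠 S) → m₁ ≤ m₂ → AtMost 𝓠 m₁ → AtMost 𝓟 m₂
atMost-mono P⇒Q m₁≤m₂ Q≤ 𝓕 𝓕⊆P = ≤-trans (Q≤ 𝓕 (λ S → P⇒Q S ∘ 𝓕⊆P S)) m₁≤m₂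

atMost-∅ : (∀ S → ¬ 𝓟 S) → AtMost 𝓟 m
atMost-∅ P≡∅ 𝓕 𝓕⊆P =
  ≤-trans (≤-reflexive (countᵇ-∅ 𝓕 (λ S → P≡∅ S ∘ 𝓕⊆P S) (subsets _))) z≤n

atMost-⊎ : (∀ S → 𝓟 S → 𝓠 S ⊎ 𝓡 S) → AtMost 𝓠 m₁ → AtMost 𝓡 m₂ → AtMost 𝓟 (m₁ + m₂)
atMost-⊎ {𝓟 = 𝓟} {𝓠 = 𝓠} {𝓡 = 𝓡} split Q≤ R≤ 𝓕 𝓕⊆P = ≤-trans
  (countᵇ-⊎ 𝓕 (λ S → ℓ S (T? (𝓕 S))) (λ S → r S (T? (𝓕 S))) (λ S → cover S (T? (𝓕 S))) (subsets _))
  (+-mono-≤ (Q≤ _ (λ S → ℓ⊆Q S (T? (𝓕 S)))) (R≤ _ (λ S → r⊆R S (T? (𝓕 S)))))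
  where
  isInj₁ isInj₂ : {B C : Set} → B ⊎ C → Bool
  isInj₁ = either (const true) (const false)
  isInj₂ = either (const false) (const true)
  -- Deciding `S ∈ᶠ 𝓕` supplies the membership proof on which `split` is run; its answer defines
  -- Boolean subfamilies although 𝓠 and 𝓡 are mere predicates.
  ℓ r : ∀ S → Dec (S ∈ᶠ 𝓕) → Bool
  ℓ S (yes S∈) = isInj₁ (split S (𝓕⊆P S S∈))
  ℓ S (no _)   = false
  r S (yes S∈) = isInj₂ (split S (𝓕⊆P S S∈))
  r S (no _)   = false
  cover : ∀ S d → S ∈ᶠ 𝓕 → T (ℓ S d) ⊎ T (r S d)
  cover S (no S∉)  S∈ = contradiction S∈ S∉
  cover S (yes S∈) _ with split S (𝓕⊆P S S∈)
  ... | inj₁ _ = inj₁ _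
  ... | inj₂ _ = inj₂ _
  ℓ⊆Q : ∀ S d → T (ℓ S d) → 𝓠 S
  ℓ⊆Q S (yes S∈) t with split S (𝓕⊆P S S∈)
  ... | inj₁ q = q
  r⊆R : ∀ S d → T (r S d) → 𝓡 S
  r⊆R S (yes S∈) t with split S (𝓕⊆P S S∈)
  ... | inj₂ q = q

atMost-⋃ : ∀ {n} {𝓟 : Subset n → Set} {𝓠 : Fin n → Subset n → Set} {m} k (Z : Subset n) → ∣ Z ∣ ≡ k →
           (∀ S → 𝓟 S → ∃[ z ] z ∈ Z × 𝓠 z S) → (∀ z → z ∈ Z → AtMost (𝓠 z) m) → AtMost 𝓟 (k * m)
atMost-⋃ zero Z ∣Z∣≡0 cover Q≤ =
  atMost-∅ λ S p → let z , z∈Z , _ = cover S p in ∣p∣≡0⇒x∉p Z ∣Z∣≡0 z∈Z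
atMost-⋃ {𝓟 = 𝓟} {𝓠} (suc k) Z ∣Z∣≡1+k cover Q≤ = atMost-⊎ split (Q≤ z₀ z₀∈Z)
  (atMost-⋃ {𝓟 = λ S → ∃[ z ] z ∈ Z - z₀ × 𝓠 z S} k (Z - z₀)
    (suc-injective (trans (1+∣p-x∣≡∣p∣ z₀∈Z) ∣Z∣≡1+k)) (λ _ → id)
    (λ z z∈ → Q≤ z (p─q⊆p Z ⁅ z₀ ⁆ z∈)))
  where
  z₀   = proj₁ (∣p∣≡1+m⇒∃∈ Z ∣Z∣≡1+k)
  z₀∈Z = proj₂ (∣p∣≡1+m⇒∃∈ Z ∣Z∣≡1+k)
  split : ∀ S → 𝓟 S → 𝓠 z₀ S ⊎ ∃[ z ] z ∈ Z - z₀ × 𝓠 z S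
  split S p with cover S p
  ... | z , z∈Z , q with z Fin.≟ z₀
  ...   | yes refl = inj₁ q
  ...   | no z≢z₀  = inj₂ (z , x∈p∧x≢y⇒x∈p-y z∈Z z≢z₀ , q)

atMost-⊇ : (𝓐 : Family n) (X : Subset n) {s : ℕ} → ∣ X ∣ ≡ s → AtMost (λ S → S ∈ᶠ 𝓐 × X ⊆ S) (Δ s 𝓐)
atMost-⊇ {n} 𝓐 X refl 𝓕 𝓕⊆ = ≤-trans
  (countᵇ-mono 𝓕 (𝓐 [ X ]) (λ S S∈ → let S∈𝓐 , X⊆S = 𝓕⊆ S S∈ in ∈-[]⁺ 𝓐 S∈𝓐 X⊆S) (subsets n))
  (card[X]≤Δ 𝓐 X)

card≤atMost : (𝓕 : Family n) → AtMost (_∈ᶠ 𝓕) m → card 𝓕 ≤ m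
card≤atMost 𝓕 ≤m = ≤m 𝓕 (λ _ → id)

-- Branching

⊆-∪⁅⁆ : {U H : Subset n} {z : Fin n} → U ⊆ H → z ∈ H → U ∪ ⁅ z ⁆ ⊆ H
⊆-∪⁅⁆ {U = U} {H} {z} U⊆H z∈H x∈ =
  either U⊆H (λ x∈⁅z⁆ → subst (_∈ H) (sym (x∈⁅y⁆⇒x≡y z x∈⁅z⁆)) z∈H) (x∈p∪q⁻ U ⁅ z ⁆ x∈)

module _ {U V : Subset n} {z : Fin n} where

  V-z#U∪z : (∀ {x} → x ∈ V → x ∉ U) → ∀ {x} → x ∈ V - z → x ∉ U ∪ ⁅ z ⁆
  V-z#U∪z V#U x∈V-z x∈U∪z with x∈p∪q⁻ U ⁅ z ⁆ x∈U∪z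
  ... | inj₁ x∈U   = V#U (p─q⊆p V ⁅ z ⁆ x∈V-z) x∈U
  ... | inj₂ x∈⁅z⁆ = x∉p-x V z (subst (_∈ V - z) (x∈⁅y⁆⇒x≡y z x∈⁅z⁆) x∈V-z)

  U∪V⊆[U∪z]∪[V-z] : U ∪ V ⊆ (U ∪ ⁅ z ⁆) ∪ (V - z)
  U∪V⊆[U∪z]∪[V-z] {x} x∈ with x∈p∪q⁻ U V x∈ | x Fin.≟ z
  ... | inj₁ x∈U | _        = p⊆p∪q (V - z) (p⊆p∪q ⁅ z ⁆ x∈U)
  ... | inj₂ x∈V | yes refl = p⊆p∪q (V - z) (q⊆p∪q U ⁅ z ⁆ (x∈⁅x⁆ z))
  ... | inj₂ x∈V | no x≢z   = q⊆p∪q (U ∪ ⁅ z ⁆) (V - z) (x∈p∧x≢y⇒x∈p-y x∈V x≢z)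

  ∈U∪V⇒∈U∪[V-z] : ∀ {x} → x ≢ z → x ∈ U ∪ V → x ∈ U ∪ (V - z)
  ∈U∪V⇒∈U∪[V-z] x≢z x∈ with x∈p∪q⁻ U V x∈
  ... | inj₁ x∈U = p⊆p∪q (V - z) x∈U
  ... | inj₂ x∈V = q⊆p∪q U (V - z) (x∈p∧x≢y⇒x∈p-y x∈V x≢z)

-- traceSum D v a = ∑ (m ≤ a) (v C m) * D ^ m
traceSum : ℕ → ℕ → ℕ → ℕ
traceSum D zero    a       = 1
traceSum D (suc v) zero    = traceSum D v zero
traceSum D (suc v) (suc a) = traceSum D v (suc a) + D * traceSum D v a

-- A generator A may have fewer than t + J elements; the w missing ones are treated as elements
-- always left out, each giving a factor D. In the recursion this keeps only the second summand.
traceSum-shift : ∀ D w v a → D ^ w * traceSum D v a ≤ traceSum D (w + v) (w + a)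
traceSum-shift D zero    v a = ≤-reflexive (+-identityʳ _)
traceSum-shift D (suc w) v a = begin
  D * D ^ w * traceSum D v a        ≡⟨ *-assoc D (D ^ w) _ ⟩
  D * (D ^ w * traceSum D v a)      ≤⟨ *-monoʳ-≤ D (traceSum-shift D w v a) ⟩
  D * traceSum D (w + v) (w + a)    ≤⟨ m≤n+m _ _ ⟩
  traceSum D (suc w + v) (suc w + a) ∎
  where open ≤-Reasoning

t≤∣U∣+v : ∀ {t v : ℕ} (U V H A : Subset n) → ∣ V ∣ ≡ v → H ∩ A ⊆ U ∪ V → t ≤ ∣ H ∩ A ∣ → t ≤ ∣ U ∣ + v
t≤∣U∣+v U V H A refl H∩A⊆ t≤ = ≤-trans t≤ (≤-trans (p⊆q⇒∣p∣≤∣q∣ H∩A⊆) (∣p∪q∣≤∣p∣+∣q∣ U V))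

-- P collects the members to be counted, 𝒯 the generators they have to meet, and s is the size to
-- which partial sets are grown before `Δ s` is applied. Saturation will provide `uncovered`.
module Level {n} (t s D : ℕ) (𝓐 : Family n) (P 𝒯 : Subset n → Set)
  (P⊆𝓐 : ∀ {H} → P H → H ∈ᶠ 𝓐)
  (covers : ∀ {H T} → P H → 𝒯 T → t ≤ ∣ H ∩ T ∣)
  (A : Subset n) (A∈𝒯 : 𝒯 A) (∣─A∣≤D : ∀ {T} → 𝒯 T → ∣ T ─ A ∣ ≤ D)
  (uncovered : ∀ U → ∣ U ∣ < s → (∃[ T ] 𝒯 T × ∣ U ∩ T ∣ < t) ⊎ (∀ {H} → P H → ¬ U ⊆ H))
  where

  -- A generator T that U meets in fewer than t elements contains an element of H outside U, and
  -- this element avoids A because the trace of H on A already lies in U. So each of the p steps has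
  -- at most D choices.
  branch : ∀ p U → ∣ U ∣ + p ≡ s →
           AtMost (λ H → P H × U ⊆ H × H ∩ A ⊆ U) (D ^ p * Δ s 𝓐)
  branch zero U ∣U∣≡s = atMost-mono (λ H (p , U⊆H , _) → P⊆𝓐 p , λ {x} → U⊆H {x}) (m≤m+n _ 0)
    (atMost-⊇ 𝓐 U (trans (sym (+-identityʳ _)) ∣U∣≡s))
  branch (suc p) U ∣U∣≡ with uncovered U (subst (∣ U ∣ <_) ∣U∣≡ (m<m+n ∣ U ∣ (s≤s z≤n)))
  ... | inj₂ none = atMost-∅ λ H (p , U⊆H , _) → none p U⊆H
  ... | inj₁ (T , T∈ , U∩T<t) = atMost-mono (λ _ → id)
    (≤-trans (*-monoˡ-≤ (D ^ p * Δ s 𝓐) (≤-trans (∣p─q∣≤∣p∣ (T ─ A) U) (∣─A∣≤D T∈)))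
      (≤-reflexive (sym (*-assoc D (D ^ p) _))))
    (atMost-⋃ _ Z refl split extend)
    where
    Z = (T ─ A) ─ U
    Q : Fin n → Subset n → Set
    Q z H = P H × (U ∪ ⁅ z ⁆) ⊆ H × (H ∩ A) ⊆ (U ∪ ⁅ z ⁆)
    split : ∀ H → P H × U ⊆ H × H ∩ A ⊆ U → ∃[ z ] z ∈ Z × Q z H
    split H (pH , U⊆H , H∩A⊆U) with ∣p∣<∣q∣⇒∃∈∖ (U ∩ T) (H ∩ T) (≤-trans U∩T<t (covers pH T∈))
    ... | z , z∈H∩T , z∉U∩T = z
      , x∈p∧x∉q⇒x∈p─q (x∈p∧x∉q⇒x∈p─q z∈T λ z∈A → z∉U (H∩A⊆U (x∈p∩q⁺ (z∈H , z∈A)))) z∉U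
      , pH , ⊆-∪⁅⁆ U⊆H z∈H , λ x∈ → p⊆p∪q ⁅ z ⁆ (H∩A⊆U x∈)
      where
      z∈H = proj₁ (x∈p∩q⁻ H T z∈H∩T)
      z∈T = proj₂ (x∈p∩q⁻ H T z∈H∩T)
      z∉U : z ∉ U
      z∉U z∈U = z∉U∩T (x∈p∩q⁺ (z∈U , z∈T))
    extend : ∀ z → z ∈ Z → AtMost (Q z) (D ^ p * Δ s 𝓐)
    extend z z∈Z = branch p (U ∪ ⁅ z ⁆) (trans
      (cong (_+ p) (∣p∪⁅x⁆∣≡1+∣p∣ (x∈p─q⇒x∉q (T ─ A) U z∈Z)))
      (trans (sym (+-suc ∣ U ∣ p)) ∣U∣≡))

  -- U collects the elements of A decided to lie in H, V the undecided ones.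
  trace : ∀ v w a (U V : Subset n) → ∣ V ∣ ≡ v → (∀ {x} → x ∈ V → x ∉ U) →
          ∣ U ∣ + v ≡ t + a → ∣ U ∣ + (v + w) ≡ s →
          AtMost (λ H → P H × U ⊆ H × H ∩ A ⊆ U ∪ V) (D ^ w * traceSum D v a * Δ s 𝓐)
  trace zero w a U V ∣V∣≡0 V#U _ ∣U∣+w≡s = atMost-mono
    (λ H (pH , U⊆H , H∩A⊆) → pH , (λ {x} → U⊆H {x}) , λ x∈ →
      either id (⊥-elim ∘ ∣p∣≡0⇒x∉p V ∣V∣≡0) (x∈p∪q⁻ U V (H∩A⊆ x∈)))
    (*-monoˡ-≤ (Δ s 𝓐) (≤-reflexive (sym (*-identityʳ (D ^ w)))))
    (branch w U ∣U∣+w≡s)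
  trace (suc v) w a U V ∣V∣≡ V#U ∣U∣+v≡ ∣U∣+v+w≡ = step a ∣U∣+v≡
    where
    z   = proj₁ (∣p∣≡1+m⇒∃∈ V ∣V∣≡)
    z∈V = proj₂ (∣p∣≡1+m⇒∃∈ V ∣V∣≡)
    V′  = V - z
    ∣V′∣≡ : ∣ V′ ∣ ≡ v
    ∣V′∣≡ = suc-injective (trans (1+∣p-x∣≡∣p∣ z∈V) ∣V∣≡)
    U′  = U ∪ ⁅ z ⁆
    V′⊆V : ∀ {x} → x ∈ V′ → x ∈ V
    V′⊆V = p─q⊆p V ⁅ z ⁆
    ∣U′∣≡ : ∣ U′ ∣ ≡ suc ∣ U ∣
    ∣U′∣≡ = ∣p∪⁅x⁆∣≡1+∣p∣ (V#U z∈V)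
    In Out : Subset n → Set
    In  H = P H × U′ ⊆ H × (H ∩ A) ⊆ (U′ ∪ V′)
    Out H = P H × U ⊆ H × (H ∩ A) ⊆ (U ∪ V′)
    split : ∀ H → P H × U ⊆ H × H ∩ A ⊆ U ∪ V → In H ⊎ Out H
    split H (pH , U⊆H , H∩A⊆) with z ∈? H
    ... | yes z∈H = inj₁ (pH , ⊆-∪⁅⁆ U⊆H z∈H , λ x∈ → U∪V⊆[U∪z]∪[V-z] (H∩A⊆ x∈))
    ... | no  z∉H = inj₂ (pH , (λ {x} → U⊆H {x}) , λ x∈ →
      ∈U∪V⇒∈U∪[V-z] (λ { refl → z∉H (p∩q⊆p H A x∈) }) (H∩A⊆ x∈))
    inBound : ∀ {a} → ∣ U ∣ + suc v ≡ t + a → AtMost In (D ^ w * traceSum D v a * Δ s 𝓐)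
    inBound {a} eq = trace v w a U′ V′ ∣V′∣≡ (V-z#U∪z V#U)
      (trans (cong (_+ v) ∣U′∣≡) (trans (sym (+-suc ∣ U ∣ v)) eq))
      (trans (cong (_+ (v + w)) ∣U′∣≡) (trans (sym (+-suc ∣ U ∣ (v + w))) ∣U∣+v+w≡))
    step : ∀ a → ∣ U ∣ + suc v ≡ t + a →
           AtMost (λ H → P H × U ⊆ H × H ∩ A ⊆ U ∪ V) (D ^ w * traceSum D (suc v) a * Δ s 𝓐)
    -- a counts the elements of A that may still be left out. With a = 0 every element of `U ∪ V` is
    -- needed for H to meet A in t elements, so z cannot be left out.
    step zero eq = atMost-mono (λ _ → id) (≤-reflexive (+-identityʳ _))
      (atMost-⊎ {m₂ = 0} split (inBound eq) (atMost-∅ λ H (pH , _ , H∩A⊆) →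
        <⇒≱ (subst (suc (∣ U ∣ + v) ≤_) (trans (sym (+-suc ∣ U ∣ v)) (trans eq (+-identityʳ t))) ≤-refl)
          (t≤∣U∣+v U V′ H A ∣V′∣≡ H∩A⊆ (covers pH A∈𝒯))))
    -- Leaving z out spends one unit of a and raises w, the number of choices to be made outside A,
    -- by one; the new factor D gives the second summand of `traceSum`.
    step (suc a) eq = atMost-mono (λ _ → id) (≤-reflexive (expand (D ^ w) D _ _ (Δ s 𝓐)))
      (atMost-⊎ split (inBound eq)
        (trace v (suc w) a U V′ ∣V′∣≡ (λ x∈ → V#U (V′⊆V x∈))
          (suc-injective (trans (sym (+-suc ∣ U ∣ v)) (trans eq (+-suc t a))))
          (trans (cong (∣ U ∣ +_) (+-suc v w)) ∣U∣+v+w≡)))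
      where
      expand : ∀ x d e f y → x * e * y + d * x * f * y ≡ x * (e + d * f) * y
      expand = solve-∀

  -- Start with all of A undecided: `∣ A ∣ ∸ t` elements of A may be left out, and `(t + J) ∸ ∣ A ∣`
  -- must be found outside A even if none is.
  levelBound : ∀ J → s ≡ t + J → ∣ A ∣ ≤ t + J → t ≤ ∣ A ∣ →
               AtMost P (traceSum D (t + J) J * Δ s 𝓐)
  levelBound J refl A≤ t≤A = atMost-mono
    (λ H pH → pH , (λ {x} x∈⊥ → contradiction x∈⊥ ∉⊥) , λ {x} x∈ → q⊆p∪q Sub.⊥ A (p∩q⊆q H A x∈))
    (*-monoˡ-≤ (Δ (t + J) 𝓐)
      (subst₂ (λ x y → D ^ w * traceSum D ∣ A ∣ a ≤ traceSum D x y) w+A w+a (traceSum-shift D w ∣ A ∣ a)))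
    (trace ∣ A ∣ w a Sub.⊥ A refl (λ _ → ∉⊥)
      (trans (cong (_+ ∣ A ∣) (∣⊥∣≡0 n)) (sym (m+[n∸m]≡n t≤A)))
      (trans (cong (_+ (∣ A ∣ + w)) (∣⊥∣≡0 n)) (m+[n∸m]≡n A≤)))
    where
    a = ∣ A ∣ ∸ t
    w = (t + J) ∸ ∣ A ∣
    w+A : w + ∣ A ∣ ≡ t + J
    w+A = m∸n+n≡m A≤
    w+a : w + a ≡ J
    w+a = +-cancelˡ-≡ t _ _ (trans (rearrange t w a)
      (trans (cong (w +_) (m+[n∸m]≡n t≤A)) w+A))
      where
      rearrange : ∀ t w a → t + (w + a) ≡ w + (t + a)
      rearrange = solve-∀

-- As in trace, U collects the decided elements and V the undecided ones.
subsetCover : (𝓐 : Family n) (t : ℕ) → ∀ v a (U V : Subset n) → ∣ V ∣ ≡ v → (∀ {x} → x ∈ V → x ∉ U) → ∣ U ∣ + a ≡ t →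
  AtMost (λ H → H ∈ᶠ 𝓐 × U ⊆ H × t ≤ ∣ H ∩ (U ∪ V) ∣) ((v C a) * Δ t 𝓐)
subsetCover 𝓐 t v zero U V _ _ ∣U∣≡t = atMost-mono (λ H (H∈ , U⊆H , _) → H∈ , λ {x} → U⊆H {x})
  (≤-reflexive (sym (*-identityˡ _))) (atMost-⊇ 𝓐 U (trans (sym (+-identityʳ _)) ∣U∣≡t))
subsetCover 𝓐 t zero (suc a) U V ∣V∣≡0 _ ∣U∣+a≡t = atMost-∅ λ H (_ , _ , t≤) →
  <⇒≱ (subst (suc ∣ U ∣ ≤_) ∣U∣+a≡t (m<m+n ∣ U ∣ (s≤s z≤n)))
    (≤-trans t≤ (p⊆q⇒∣p∣≤∣q∣ λ x∈ →
      either id (⊥-elim ∘ ∣p∣≡0⇒x∉p V ∣V∣≡0) (x∈p∪q⁻ U V (p∩q⊆q H (U ∪ V) x∈))))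
subsetCover {n} 𝓐 t (suc v) (suc a) U V ∣V∣≡ V#U ∣U∣+a≡t =
  atMost-mono (λ _ → id) (≤-reflexive (trans (sym (*-distribʳ-+ (Δ t 𝓐) (v C a) (v C suc a)))
      (cong (_* Δ t 𝓐) (nCk+nC[k+1]≡[n+1]C[k+1] v a))))
    (atMost-⊎ split
      (subsetCover 𝓐 t v a U′ V′ ∣V′∣≡ (V-z#U∪z V#U)
        (trans (cong (_+ a) (∣p∪⁅x⁆∣≡1+∣p∣ (V#U z∈V))) (trans (sym (+-suc ∣ U ∣ a)) ∣U∣+a≡t)))
      (subsetCover 𝓐 t v (suc a) U V′ ∣V′∣≡ (λ x∈ → V#U (V′⊆V x∈)) ∣U∣+a≡t))
  where
  z   = proj₁ (∣p∣≡1+m⇒∃∈ V ∣V∣≡)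
  z∈V = proj₂ (∣p∣≡1+m⇒∃∈ V ∣V∣≡)
  V′  = V - z
  U′  = U ∪ ⁅ z ⁆
  ∣V′∣≡ : ∣ V′ ∣ ≡ v
  ∣V′∣≡ = suc-injective (trans (1+∣p-x∣≡∣p∣ z∈V) ∣V∣≡)
  V′⊆V : ∀ {x} → x ∈ V′ → x ∈ V
  V′⊆V = p─q⊆p V ⁅ z ⁆
  In Out : Subset n → Set
  In  H = H ∈ᶠ 𝓐 × U′ ⊆ H × t ≤ ∣ H ∩ (U′ ∪ V′) ∣
  Out H = H ∈ᶠ 𝓐 × U ⊆ H × t ≤ ∣ H ∩ (U ∪ V′) ∣
  split : ∀ H → H ∈ᶠ 𝓐 × U ⊆ H × t ≤ ∣ H ∩ (U ∪ V) ∣ → In H ⊎ Out H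
  split H (H∈ , U⊆H , t≤) with z ∈? H
  ... | yes z∈H = inj₁ (H∈ , ⊆-∪⁅⁆ U⊆H z∈H , ≤-trans t≤ (p⊆q⇒∣p∣≤∣q∣ {q = H ∩ (U′ ∪ V′)} λ x∈ →
    let x∈H , x∈U∪V = x∈p∩q⁻ H (U ∪ V) x∈ in x∈p∩q⁺ (x∈H , U∪V⊆[U∪z]∪[V-z] x∈U∪V)))
  ... | no  z∉H = inj₂ (H∈ , (λ {x} → U⊆H {x}) , ≤-trans t≤ (p⊆q⇒∣p∣≤∣q∣ {q = H ∩ (U ∪ V′)} λ x∈ →
    let x∈H , x∈U∪V = x∈p∩q⁻ H (U ∪ V) x∈ in
    x∈p∩q⁺ (x∈H , ∈U∪V⇒∈U∪[V-z] (λ { refl → z∉H x∈H }) x∈U∪V)))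

-- Peeling off levels

-- Runs over the levels J + 1, ..., J + d; with J + d = K these are the ones already left behind
-- when the descent stands at J.
sumAbove : (ℕ → ℕ) → ℕ → ℕ → ℕ
sumAbove f J zero    = 0
sumAbove f J (suc d) = f (suc J) + sumAbove f (suc J) d

∩-mono-∣∣ : ∀ {n} {U V H K : Subset n} → U ⊆ H → V ⊆ K → ∣ U ∩ V ∣ ≤ ∣ H ∩ K ∣
∩-mono-∣∣ {U = U} {V} U⊆H V⊆K = p⊆q⇒∣p∣≤∣q∣ λ x∈ →
  let x∈U , x∈V = x∈p∩q⁻ U V x∈ in x∈p∩q⁺ (U⊆H x∈U , V⊆K x∈V)

-- The two families are 𝓕 false and 𝓕 true.  With _~_ constantly true and the two
-- equal this is one t-intersecting family, with _~_ inequality a cross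
-- t-intersecting pair.  Level J deals with generating sets of size t + J.
module Peeling {n : ℕ} (t K : ℕ) (_~_ : Bool → Bool → Bool)
  (~-sym : ∀ b c → T (b ~ c) → T (c ~ b)) (~-not : ∀ b → T (b ~ not b))
  (𝓐 𝓕 : Bool → Family n) (𝓕⊆𝓐 : ∀ b → 𝓕 b ⊆ᶠ 𝓐 b)
  (∣𝓕∣≤ : ∀ b S → S ∈ᶠ 𝓕 b → ∣ S ∣ ≤ t + K)
  (𝓕-meets : ∀ b c → T (b ~ c) → ∀ S S′ → S ∈ᶠ 𝓕 b → S′ ∈ᶠ 𝓕 c → t ≤ ∣ S ∩ S′ ∣)
  (𝓕-nonempty : ∀ b → Nonempty (𝓕 b))
  (D : ℕ → ℕ)
  (∣T─A∣≤D : ∀ J b {c c′} (S T₁ A : Subset n) → T (b ~ c) → T (b ~ c′) →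
             ∣ S ∣ ≤ t + suc J → ∣ T₁ ∣ ≤ t + suc J → t ≤ ∣ T₁ ∩ S ∣ → t ≤ ∣ A ∩ S ∣ →
             (T (c ~ c′) → t ≤ ∣ T₁ ∩ A ∣) → ∣ T₁ ─ A ∣ ≤ D (suc J))
  where

  Tagged : Set
  Tagged = Bool × Subset n

  Meets : Tagged → Tagged → Set
  Meets (b , U) (c , V) = T (b ~ c) → t ≤ ∣ U ∩ V ∣

  meets? : ∀ x y → Dec (Meets x y)
  meets? (b , U) (c , V) = T? (b ~ c) →-dec (t ℕ.≤? ∣ U ∩ V ∣)

  meets-sym : ∀ x y → Meets x y → Meets y x
  meets-sym (b , U) (c , V) m c~b = subst (λ p → t ≤ ∣ p ∣) (∩-comm U V) (m (~-sym c b c~b))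

  Compatible : List Tagged → Set
  Compatible xs = ∀ {x y} → x ∈ˡ xs → y ∈ˡ xs → Meets x y

  -- Greedy extension. The test of a candidate against itself demands t elements in the intersecting
  -- case and is vacuous for a cross pair.
  saturate : List Tagged → List Tagged → List Tagged
  saturate []       sys = sys
  saturate (x ∷ xs) sys with all? (meets? x) (x ∷ sys)
  ... | yes _ = saturate xs (x ∷ sys)
  ... | no  _ = saturate xs sys

  saturate-⊇ : ∀ xs {sys x} → x ∈ˡ sys → x ∈ˡ saturate xs sys
  saturate-⊇ []           x∈ = x∈
  saturate-⊇ (y ∷ ys) {sys} x∈ with all? (meets? y) (y ∷ sys)
  ... | yes _ = saturate-⊇ ys (there x∈)
  ... | no  _ = saturate-⊇ ys x∈

  saturate-from : ∀ xs {sys x} → x ∈ˡ saturate xs sys → x ∈ˡ sys ⊎ x ∈ˡ xs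
  saturate-from []       x∈ = inj₁ x∈
  saturate-from (y ∷ ys) {sys} x∈ with all? (meets? y) (y ∷ sys)
  saturate-from (y ∷ ys) x∈ | yes _ with saturate-from ys x∈
  ... | inj₁ (here refl) = inj₂ (here refl)
  ... | inj₁ (there x∈′) = inj₁ x∈′
  ... | inj₂ x∈ys        = inj₂ (there x∈ys)
  saturate-from (y ∷ ys) x∈ | no _ with saturate-from ys x∈
  ... | inj₁ x∈sys = inj₁ x∈sys
  ... | inj₂ x∈ys  = inj₂ (there x∈ys)

  saturate-compatible : ∀ xs {sys} → Compatible sys → Compatible (saturate xs sys)
  saturate-compatible []             comp = comp
  saturate-compatible (y ∷ ys) {sys} comp with all? (meets? y) (y ∷ sys)
  ... | no  _   = saturate-compatible ys comp
  ... | yes all = saturate-compatible ys comp′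
    where
    comp′ : Compatible (y ∷ sys)
    comp′ (here refl) z∈          = All.lookup all z∈
    comp′ (there x∈)  (here refl) = meets-sym y _ (All.lookup all (there x∈))
    comp′ (there x∈)  (there z∈)  = comp x∈ z∈

  -- One pass is enough: the system present when x is examined is part of the final one, so an x
  -- compatible with the final system was accepted.
  saturate-maximal : ∀ xs {sys x} → x ∈ˡ xs → Meets x x →
                     (∀ {y} → y ∈ˡ saturate xs sys → Meets x y) → x ∈ˡ saturate xs sys
  saturate-maximal (z ∷ zs) {sys} (here refl) xx m with all? (meets? z) (z ∷ sys)
  ... | yes _   = saturate-⊇ zs (here refl)
  ... | no ¬all = contradiction (xx ∷ All.tabulate (λ y∈ → m (saturate-⊇ zs y∈))) ¬all
  saturate-maximal (z ∷ zs) {sys} (there x∈) xx m with all? (meets? z) (z ∷ sys)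
  ... | yes _ = saturate-maximal zs x∈ xx m
  ... | no  _ = saturate-maximal zs x∈ xx m

  allTagged : List Tagged
  allTagged = map (false ,_) (subsets n) ++ map (true ,_) (subsets n)

  ∈-allTagged : ∀ x → x ∈ˡ allTagged
  ∈-allTagged (false , U) = ∈-++⁺ˡ (∈-map⁺ _ (∈-subsets U))
  ∈-allTagged (true  , U) = ∈-++⁺ʳ _ (∈-map⁺ _ (∈-subsets U))

  small? : ∀ s (x : Tagged) → Dec (∣ proj₂ x ∣ < s)
  small? s x = ∣ proj₂ x ∣ ℕ.<? s

  levelTerm : Bool → ℕ → ℕ
  levelTerm b J = traceSum (D J) (t + J) J * Δ (t + J) (𝓐 b)

  peeled : Bool → ℕ → ℕ → ℕ
  peeled b = sumAbove (levelTerm b)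

  Generated Live : List Tagged → Bool → Subset n → Set
  Generated sys b H = ∃[ U ] (b , U) ∈ˡ sys × U ⊆ H
  Live sys b H = H ∈ᶠ 𝓕 b × Generated sys b H

  -- `total` turns any later bound on the members that still contain a generator into a bound on the
  -- whole family; the other members are already paid for at the levels above J.
  record Stage (J d : ℕ) : Set where
    field
      sys        : List Tagged
      compatible : Compatible sys
      bounded    : ∀ {x} → x ∈ˡ sys → ∣ proj₂ x ∣ ≤ t + J
      inhabited  : ∀ b → ∃[ U ] (b , U) ∈ˡ sys
      total      : ∀ b {m} → AtMost (Live sys b) m → card (𝓕 b) ≤ m + peeled b J d

  -- In `exhausted` all generators of b have exactly t + J + 1 elements. The partner is bounded
  -- before its own level J + 1 is removed, so its sum starts one level higher.
  data Outcome : Set where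
    star : ∀ X → ∣ X ∣ ≡ t →
           (∀ b {m} → AtMost (λ H → H ∈ᶠ 𝓕 b × X ⊆ H) m → card (𝓕 b) ≤ m + peeled b 0 K) → Outcome
    exhausted : ∀ b J d → suc J + d ≡ K → card (𝓕 b) ≤ peeled b J (suc d) →
                card (𝓕 (not b)) ≤ ((t + suc J) C t) * Δ t (𝓐 (not b)) + peeled (not b) (suc J) d → Outcome

  start : Stage K 0
  start = record
    { sys        = sys₀
    ; compatible = λ {x} {y} x∈ y∈ b~c →
        𝓕-meets _ _ b~c _ _ (proj₂ (∈-filter⁻ in𝓕? {xs = allTagged} x∈)) (proj₂ (∈-filter⁻ in𝓕? {xs = allTagged} y∈))
    ; bounded    = λ {x} x∈ → ∣𝓕∣≤ _ _ (proj₂ (∈-filter⁻ in𝓕? {xs = allTagged} x∈))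
    ; inhabited  = λ b → let S , S∈ = 𝓕-nonempty b in S , ∈-sys₀ S∈
    ; total      = λ b {m} live≤m → ≤-trans
        (card≤atMost (𝓕 b) (atMost-mono (λ S S∈ → S∈ , S , ∈-sys₀ S∈ , λ {x} → id) ≤-refl live≤m))
        (m≤m+n m 0)
    }
    where
    in𝓕? : (x : Tagged) → Dec (proj₂ x ∈ᶠ 𝓕 (proj₁ x))
    in𝓕? (b , U) = T? (𝓕 b U)
    sys₀ = filter in𝓕? allTagged
    ∈-sys₀ : ∀ {b S} → S ∈ᶠ 𝓕 b → (b , S) ∈ˡ sys₀
    ∈-sys₀ S∈ = ∈-filter⁺ in𝓕? (∈-allTagged _) S∈

  module Step {J d : ℕ} (stage : Stage (suc J) d) where
    open Stage stage

    private
      s = t + suc J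
      candidates = filter (small? s) allTagged

    sys⁺ : List Tagged
    sys⁺ = saturate candidates sys

    compatible⁺ : Compatible sys⁺
    compatible⁺ = saturate-compatible candidates compatible

    bounded⁺ : ∀ {x} → x ∈ˡ sys⁺ → ∣ proj₂ x ∣ ≤ s
    bounded⁺ x∈ = either bounded (λ x∈c → <⇒≤ (proj₂ (∈-filter⁻ (small? s) {xs = allTagged} x∈c)))
      (saturate-from candidates x∈)

    inhabited⁺ : ∀ b → ∃[ U ] (b , U) ∈ˡ sys⁺
    inhabited⁺ b = let U , U∈ = inhabited b in U , saturate-⊇ candidates U∈

    size≥t : ∀ {b U} → (b , U) ∈ˡ sys⁺ → t ≤ ∣ U ∣
    size≥t {b} {U} U∈ = let V , V∈ = inhabited⁺ (not b) in
      ≤-trans (compatible⁺ U∈ V∈ (~-not b)) (∣p∩q∣≤∣p∣ U V)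

    sys⁻ : List Tagged
    sys⁻ = filter (small? s) sys⁺

    sys⁻⊆sys⁺ : ∀ {x} → x ∈ˡ sys⁻ → x ∈ˡ sys⁺
    sys⁻⊆sys⁺ = proj₁ ∘ ∈-filter⁻ (small? s)

    live⁻? : ∀ b H → Dec (Generated sys⁻ b H)
    live⁻? b H with any? (λ x → (proj₁ x Bool.≟ b) ×-dec (proj₂ x ⊆? H)) sys⁻
    ... | no none = no λ (U , U∈ , U⊆H) → none (Any.map (λ { refl → refl , λ {x} → U⊆H {x} }) U∈)
    ... | yes some with find some
    ...   | (_ , U) , U∈ , refl , U⊆H = yes (U , U∈ , U⊆H)

    module _ (b : Bool) where
      Fresh : Subset n → Set
      Fresh H = Live sys⁺ b H × ¬ Generated sys⁻ b H

      𝒯 : Subset n → Set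
      𝒯 V = ∃[ c ] T (b ~ c) × (c , V) ∈ˡ sys⁺

      covers : ∀ {H V} → Fresh H → 𝒯 V → t ≤ ∣ H ∩ V ∣
      covers ((_ , U , U∈ , U⊆H) , _) (c , b~c , V∈) =
        ≤-trans (compatible⁺ U∈ V∈ b~c) (∩-mono-∣∣ U⊆H id)

      A  = proj₁ (inhabited⁺ (not b))
      A∈ = proj₂ (inhabited⁺ (not b))

      -- This is what saturation is for: a small set compatible with all generators already belongs
      -- to `sys⁻`, and a fresh member contains no set of `sys⁻`.
      uncovered : ∀ U → ∣ U ∣ < s → (∃[ V ] 𝒯 V × ∣ U ∩ V ∣ < t) ⊎ (∀ {H} → Fresh H → ¬ U ⊆ H)
      uncovered U U<s with all? (meets? (b , U)) sys⁺
      ... | yes all = inj₂ λ (_ , ¬small) U⊆H →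
        ¬small (U , ∈-filter⁺ (small? s)
          (saturate-maximal candidates (∈-filter⁺ (small? s) (∈-allTagged (b , U)) U<s)
            -- Compatibility of U with itself asks for t elements at most, and U has them because it
            -- meets A in t.
            (λ _ → subst (λ p → t ≤ ∣ p ∣) (sym (∩-idem U))
              (≤-trans (All.lookup all A∈ (~-not b)) (∣p∩q∣≤∣p∣ U A)))
            (All.lookup all)) U<s , λ {x} → U⊆H {x})
      ... | no ¬all with find (¬All⇒Any¬ (meets? (b , U)) sys⁺ ¬all)
      ...   | (c , V) , V∈ , ¬m with T? (b ~ c)
      ...     | yes b~c = inj₁ (V , (c , b~c , V∈) , ≰⇒> λ t≤ → ¬m (const t≤))
      ...     | no ¬b~c = contradiction (λ b~c → contradiction b~c ¬b~c) ¬m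

      fresh≤ : AtMost Fresh (levelTerm b (suc J))
      fresh≤ = Level.levelBound t s (D (suc J)) (𝓐 b) Fresh 𝒯
        (λ ((H∈ , _) , _) → 𝓕⊆𝓐 b _ H∈) covers A (not b , ~-not b , A∈)
        -- S is a generator of b itself. V and A come from sides related to b, so both meet S even
        -- when they are not related to each other.
        (λ { {V} (c , b~c , V∈) → let S , S∈ = inhabited⁺ b in
           ∣T─A∣≤D J b S V A b~c (~-not b) (bounded⁺ S∈) (bounded⁺ V∈)
             (compatible⁺ V∈ S∈ (~-sym b c b~c)) (compatible⁺ A∈ S∈ (~-sym b (not b) (~-not b)))
             (compatible⁺ V∈ A∈) })
        uncovered (suc J) refl (bounded⁺ A∈) (size≥t A∈)

      total⁻ : ∀ {m} → AtMost (Live sys⁻ b) m → card (𝓕 b) ≤ m + peeled b J (suc d)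
      total⁻ {m} live≤m = ≤-trans
        (total b (atMost-⊎ split live≤m fresh≤))
        (≤-reflexive (+-assoc m _ _))
        where
        split : ∀ H → Live sys b H → Live sys⁻ b H ⊎ Fresh H
        split H (H∈ , U , U∈ , U⊆H) with live⁻? b H
        ... | yes live = inj₁ (H∈ , live)
        ... | no ¬live = inj₂ ((H∈ , U , saturate-⊇ candidates U∈ , λ {x} → U⊆H {x}) , ¬live)

    inhabited⁻? : ∀ b → (∃[ U ] (b , U) ∈ˡ sys⁻) ⊎ (∀ {U} → ¬ (b , U) ∈ˡ sys⁻)
    inhabited⁻? b with any? (λ x → proj₁ x Bool.≟ b) sys⁻
    ... | no none = inj₂ λ U∈ → none (Any.map (λ { refl → refl }) U∈)
    ... | yes some with find some
    ...   | (_ , U) , U∈ , refl = inj₁ (U , U∈)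

    next : (∀ b → ∃[ U ] (b , U) ∈ˡ sys⁻) → Stage J (suc d)
    next inh = record
      { sys        = sys⁻
      ; compatible = λ x∈ y∈ → compatible⁺ (sys⁻⊆sys⁺ x∈) (sys⁻⊆sys⁺ y∈)
      ; bounded    = λ {x} x∈ → ℕ.s≤s⁻¹ (subst (∣ proj₂ x ∣ <_) (+-suc t J) (proj₂ (∈-filter⁻ (small? s) {xs = sys⁺} x∈)))
      ; inhabited  = inh
      ; total      = total⁻
      }

    exhaust : suc J + d ≡ K → ∀ b → (∀ {U} → ¬ (b , U) ∈ˡ sys⁻) → Outcome
    exhaust J+d≡K b none = exhausted b J d J+d≡K
      (total⁻ b {0} (atMost-∅ λ _ (_ , _ , U∈ , _) → none U∈))
      -- Each live member of the partner meets S in t elements, hence contains one of the t-subsets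
      -- of S.
      (total (not b) (subst (λ x → AtMost (Live sys (not b)) ((x C t) * Δ t (𝓐 (not b)))) ∣S∣≡s
        (atMost-mono within ≤-refl (subsetCover (𝓐 (not b)) t ∣ S ∣ t Sub.⊥ S refl (λ _ → ∉⊥) (cong (_+ t) (∣⊥∣≡0 n))))))
      where
      S  = proj₁ (inhabited⁺ b)
      S∈ = proj₂ (inhabited⁺ b)
      ∣S∣≡s : ∣ S ∣ ≡ s
      ∣S∣≡s = ≤-antisym (bounded⁺ S∈) (≮⇒≥ λ S<s → none (∈-filter⁺ (small? s) S∈ S<s))
      within : ∀ H → Live sys (not b) H → H ∈ᶠ 𝓐 (not b) × Sub.⊥ ⊆ H × t ≤ ∣ H ∩ (Sub.⊥ ∪ S) ∣
      within H (H∈ , U , U∈ , U⊆H) = 𝓕⊆𝓐 (not b) H H∈ , (λ {x} x∈⊥ → contradiction x∈⊥ ∉⊥)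
        , ≤-trans (compatible⁺ (saturate-⊇ candidates U∈) S∈ (~-sym b (not b) (~-not b)))
            (∩-mono-∣∣ U⊆H (q⊆p∪q Sub.⊥ S))

  finish : ∀ {d} → Stage 0 d → d ≡ K → Outcome
  finish stage refl = star X ∣X∣≡t λ b live≤m → total b (atMost-mono (λ H → contains b H) ≤-refl live≤m)
    where
    open Stage stage
    X  = proj₁ (inhabited false)
    X∈ = proj₂ (inhabited false)
    Y  = proj₁ (inhabited true)
    Y∈ = proj₂ (inhabited true)
    equal : ∀ {b U V} → (b , U) ∈ˡ sys → (not b , V) ∈ˡ sys → U ≡ V
    equal {b} {U} {V} U∈ V∈ = trans
      (sym (p⊆q∧∣q∣≤∣p∣⇒p≡q (U ∩ V) U (p∩q⊆p U V) (≤-trans (small U∈) t≤)))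
      (p⊆q∧∣q∣≤∣p∣⇒p≡q (U ∩ V) V (p∩q⊆q U V) (≤-trans (small V∈) t≤))
      where
      t≤ = compatible U∈ V∈ (~-not b)
      small : ∀ {x} → x ∈ˡ sys → ∣ proj₂ x ∣ ≤ t
      small {x} x∈ = subst (∣ proj₂ x ∣ ≤_) (+-identityʳ t) (bounded x∈)
    ∣X∣≡t : ∣ X ∣ ≡ t
    ∣X∣≡t = ≤-antisym (subst (∣ X ∣ ≤_) (+-identityʳ t) (bounded X∈))
      (≤-trans (compatible X∈ Y∈ (~-not false)) (∣p∩q∣≤∣p∣ X Y))
    contains : ∀ b H → Live sys b H → H ∈ᶠ 𝓕 b × X ⊆ H
    contains true  H (H∈ , U , U∈ , U⊆H) = H∈ , subst (_⊆ H) (equal U∈ X∈) U⊆H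
    -- Only opposite tags are known to be related, so two generators on the side of X are compared
    -- through Y.
    contains false H (H∈ , U , U∈ , U⊆H) =
      H∈ , subst (_⊆ H) (trans (equal U∈ Y∈) (sym (equal X∈ Y∈))) U⊆H

  descend : ∀ J d → J + d ≡ K → Stage J d → Outcome
  descend zero    d d≡K   stage = finish stage d≡K
  descend (suc J) d J+d≡K stage with inhabited⁻? false | inhabited⁻? true
    where open Step stage
  ... | inj₂ none | _         = Step.exhaust stage J+d≡K false none
  ... | inj₁ _    | inj₂ none = Step.exhaust stage J+d≡K true none
  ... | inj₁ U    | inj₁ V    = descend J (suc d) (trans (+-suc J d) J+d≡K)
    (Step.next stage λ { false → U ; true → V })

  outcome : Outcome
  outcome = descend K 0 (+-identityʳ K) start

-- Powers of 1 + 1/N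

≤-by : ∀ {m n o} → m + o ≡ n → m ≤ n
≤-by {m} {n} {o} eq = ≤-trans (m≤m+n m o) (≤-reflexive eq)

-- After division by N^(i+2): (1 + 1/N)^i ≤ 1 + i/N + (i/N)^2. The induction step has the surplus i
-- (N - i) + N, nonnegative since i ≤ N.
quadratic-bound : ∀ N i → i ≤ N → suc N ^ i * (N * N) ≤ N ^ i * (N * N + i * N + i * i)
quadratic-bound N zero    _   = ≤-reflexive (solve₀ N)
  where
  solve₀ : ∀ N → 1 * (N * N) ≡ 1 * (N * N + 0 * N + 0 * 0)
  solve₀ = solve-∀
quadratic-bound N (suc i) i<N = begin
  suc N * suc N ^ i * (N * N)                          ≡⟨ *-assoc (suc N) (suc N ^ i) (N * N) ⟩
  suc N * (suc N ^ i * (N * N))                        ≤⟨ *-monoʳ-≤ (suc N) (quadratic-bound N i (<⇒≤ i<N)) ⟩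
  suc N * (N ^ i * (N * N + i * N + i * i))            ≡⟨ swap (suc N) (N ^ i) _ ⟩
  N ^ i * (suc N * (N * N + i * N + i * i))            ≤⟨ *-monoʳ-≤ (N ^ i) grow ⟩
  N ^ i * (N * (N * N + suc i * N + suc i * suc i))    ≡⟨ reassoc (N ^ i) N _ ⟩
  N * N ^ i * (N * N + suc i * N + suc i * suc i)      ∎
  where
  open ≤-Reasoning
  swap : ∀ a b c → a * (b * c) ≡ b * (a * c)
  swap = solve-∀
  reassoc : ∀ a b c → a * (b * c) ≡ b * a * c
  reassoc = solve-∀
  r = N ∸ i
  N≡ : i + r ≡ N
  N≡ = m+[n∸m]≡n (<⇒≤ i<N)
  identity : ∀ i r → let N = i + r in
    suc N * (N * N + i * N + i * i) + (i * r + N) ≡ N * (N * N + suc i * N + suc i * suc i)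
  identity = solve-∀
  grow : suc N * (N * N + i * N + i * i) ≤ N * (N * N + suc i * N + suc i * suc i)
  grow = subst (λ N → suc N * (N * N + i * N + i * i) ≤ N * (N * N + suc i * N + suc i * suc i)) N≡
    (≤-by (identity i r))

-- Each of the three terms of the quadratic bound is at most 1. The 3 stands in for e in all later
-- growth estimates.
[1+N]^i≤3N^i : ∀ N i → i ≤ N → suc N ^ i ≤ 3 * N ^ i
[1+N]^i≤3N^i zero      zero _   = s≤s z≤n
[1+N]^i≤3N^i N@(suc _) i    i≤N = *-cancelʳ-≤ _ _ (N * N) (begin
  suc N ^ i * (N * N)                ≤⟨ quadratic-bound N i i≤N ⟩
  N ^ i * (N * N + i * N + i * i)    ≤⟨ *-monoʳ-≤ (N ^ i) (+-mono-≤ (+-monoʳ-≤ (N * N) (*-monoˡ-≤ N i≤N)) (*-mono-≤ i≤N i≤N)) ⟩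
  N ^ i * (N * N + N * N + N * N)    ≡⟨ triple (N ^ i) (N * N) ⟩
  3 * N ^ i * (N * N)                ∎)
  where
  open ≤-Reasoning
  triple : ∀ a b → a * (b + b + b) ≡ 3 * a * b
  triple = solve-∀

-- Binomial coefficients

absorption : ∀ v a → suc a * (suc v C suc a) ≡ suc v * (v C a)
absorption v zero = trans (+-identityʳ _) (trans (nC1≡n (suc v)) (sym (*-identityʳ (suc v))))
absorption zero (suc a) = trans (cong (suc (suc a) *_) (k>n⇒nCk≡0 {1} {suc (suc a)} (s≤s (s≤s z≤n))))
  (trans (*-zeroʳ (suc (suc a))) (cong (1 *_) (sym (k>n⇒nCk≡0 {0} {suc a} (s≤s z≤n)))))
absorption (suc v) (suc a) = begin
  suc (suc a) * (suc (suc v) C suc (suc a))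
    ≡⟨ cong (suc (suc a) *_) (nCk+nC[k+1]≡[n+1]C[k+1] (suc v) (suc a)) ⟨
  suc (suc a) * (x + y)
    ≡⟨ expand (suc a) x y ⟩
  x + suc a * x + suc (suc a) * y
    ≡⟨ cong₂ (λ p q → x + p + q) (absorption v a) (absorption v (suc a)) ⟩
  x + suc v * (v C a) + suc v * (v C suc a)
    ≡⟨ collect x (suc v) (v C a) (v C suc a) ⟩
  x + suc v * (v C a + v C suc a)
    ≡⟨ cong (λ p → x + suc v * p) (nCk+nC[k+1]≡[n+1]C[k+1] v a) ⟩
  suc (suc v) * x ∎
  where
  open ≡-Reasoning
  x = suc v C suc a
  y = suc v C suc (suc a)
  expand : ∀ a x y → suc a * (x + y) ≡ x + a * x + suc a * y
  expand = solve-∀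
  collect : ∀ x v p q → x + v * p + v * q ≡ x + v * (p + q)
  collect = solve-∀

[1+a]*vC[1+a]≡b*vCa : ∀ a b → suc a * ((a + b) C suc a) ≡ b * ((a + b) C a)
[1+a]*vC[1+a]≡b*vCa a b = +-cancelˡ-≡ (suc a * x) _ _ (begin
  suc a * x + suc a * y        ≡⟨ *-distribˡ-+ (suc a) x y ⟨
  suc a * (x + y)              ≡⟨ cong (suc a *_) (nCk+nC[k+1]≡[n+1]C[k+1] (a + b) a) ⟩
  suc a * (suc (a + b) C suc a) ≡⟨ absorption (a + b) a ⟩
  suc (a + b) * x              ≡⟨ *-distribʳ-+ x (suc a) b ⟩
  suc a * x + b * x            ∎)
  where
  open ≡-Reasoning
  x = (a + b) C a
  y = (a + b) C suc a

[1+J]*C≡ : ∀ t J → suc J * ((t + suc J) C suc J) ≡ (t + suc J) * ((t + J) C J)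
[1+J]*C≡ t J = subst (λ x → suc J * (x C suc J) ≡ x * ((t + J) C J)) (sym (+-suc t J)) (absorption (t + J) J)

C-step : ∀ t J → (t + J) C J ≤ (t + suc J) C suc J
C-step t J = subst (λ x → (t + J) C J ≤ x C suc J) (sym (+-suc t J))
  (≤-trans (m≤m+n _ _) (≤-reflexive (nCk+nC[k+1]≡[n+1]C[k+1] (t + J) J)))

C-mono : ∀ t {I J} → I ≤ J → (t + I) C I ≤ (t + J) C J
C-mono t {I} {J} I≤J = subst (λ J → (t + I) C I ≤ (t + J) C J) (m∸n+n≡m I≤J) (up (J ∸ I))
  where
  up : ∀ d → (t + I) C I ≤ (t + (d + I)) C (d + I)
  up zero    = ≤-refl
  up (suc d) = ≤-trans (up d) (C-step t (d + I))

C₁≡ : ∀ t → (t + 1) C 1 ≡ t + 1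
C₁≡ t = nC1≡n (t + 1)

2*C₂≡ : ∀ t → 2 * ((t + 2) C 2) ≡ (t + 2) * (t + 1)
2*C₂≡ t = trans ([1+J]*C≡ t 1) (cong ((t + 2) *_) (C₁≡ t))

6*C₃≡ : ∀ t → 6 * ((t + 3) C 3) ≡ (t + 3) * ((t + 2) * (t + 1))
6*C₃≡ t = begin
  6 * ((t + 3) C 3)              ≡⟨ *-assoc 2 3 ((t + 3) C 3) ⟩
  2 * (3 * ((t + 3) C 3))        ≡⟨ cong (2 *_) ([1+J]*C≡ t 2) ⟩
  2 * ((t + 3) * ((t + 2) C 2))  ≡⟨ swap 2 (t + 3) ((t + 2) C 2) ⟩
  (t + 3) * (2 * ((t + 2) C 2))  ≡⟨ cong ((t + 3) *_) (2*C₂≡ t) ⟩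
  (t + 3) * ((t + 2) * (t + 1))  ∎
  where
  open ≡-Reasoning
  swap : ∀ a b c → a * (b * c) ≡ b * (a * c)
  swap = solve-∀

-- Geometric estimates for `traceSum` and `sumAbove`

traceSum₀ : ∀ D v → traceSum D v 0 ≡ 1
traceSum₀ D zero    = refl
traceSum₀ D (suc v) = traceSum₀ D v

traceSum-suc : ∀ D v a → traceSum D v (suc a) ≡ traceSum D v a + (v C suc a) * D ^ suc a
traceSum-suc D zero a = sym (trans (cong (λ x → 1 + x * D ^ suc a) (k>n⇒nCk≡0 {0} {suc a} (s≤s z≤n))) refl)
traceSum-suc D (suc v) zero = begin
  traceSum D v 1 + D * traceSum D v 0
    ≡⟨ cong₂ (λ x y → x + D * y) (traceSum-suc D v 0) (traceSum₀ D v) ⟩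
  traceSum D v 0 + (v C 1) * D ^ 1 + D * 1
    ≡⟨ collect (traceSum D v 0) (v C 1) D ⟩
  traceSum D v 0 + (1 + v C 1) * D ^ 1
    ≡⟨ cong (λ x → traceSum D v 0 + x * D ^ 1) (nCk+nC[k+1]≡[n+1]C[k+1] v 0) ⟩
  traceSum D v 0 + (suc v C 1) * D ^ 1 ∎
  where
  open ≡-Reasoning
  collect : ∀ e c D → e + c * (D * 1) + D * 1 ≡ e + (1 + c) * (D * 1)
  collect = solve-∀
traceSum-suc D (suc v) (suc a) = begin
  traceSum D v (suc (suc a)) + D * traceSum D v (suc a)
    ≡⟨ cong₂ (λ x y → x + D * y) (traceSum-suc D v (suc a)) (traceSum-suc D v a) ⟩
  traceSum D v (suc a) + y * (D * (D * D ^ a)) + D * (traceSum D v a + x * (D * D ^ a))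
    ≡⟨ collect (traceSum D v (suc a)) (traceSum D v a) x y D (D ^ a) ⟩
  traceSum D v (suc a) + D * traceSum D v a + (x + y) * (D * (D * D ^ a))
    ≡⟨ cong (λ z → traceSum D v (suc a) + D * traceSum D v a + z * (D * (D * D ^ a)))
         (nCk+nC[k+1]≡[n+1]C[k+1] v (suc a)) ⟩
  traceSum D (suc v) (suc a) + (suc v C suc (suc a)) * D ^ suc (suc a) ∎
  where
  open ≡-Reasoning
  x = v C suc a
  y = v C suc (suc a)
  collect : ∀ e f x y D p → e + y * (D * (D * p)) + D * (f + x * (D * p)) ≡ e + D * f + (x + y) * (D * (D * p))
  collect = solve-∀

-- Under the hypothesis each summand is at least 1 + μ times the preceding one.
traceSum-geometric : ∀ μ D a c → suc μ * a ≤ D * suc c →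
  μ * traceSum D (a + c) a ≤ suc μ * (((a + c) C a) * D ^ a)
traceSum-geometric μ D zero c _ =
  subst (λ x → μ * x ≤ suc μ * 1) (sym (traceSum₀ D c)) (*-monoˡ-≤ 1 (n≤1+n μ))
traceSum-geometric μ D (suc m) c μm≤Dc = begin
  μ * traceSum D v (suc m)
    ≡⟨ cong (μ *_) (traceSum-suc D v m) ⟩
  μ * (traceSum D v m + y * (D * p))
    ≡⟨ *-distribˡ-+ μ (traceSum D v m) _ ⟩
  μ * traceSum D v m + μ * (y * (D * p))
    ≤⟨ +-monoˡ-≤ (μ * (y * (D * p))) ih ⟩
  suc μ * (x * p) + μ * (y * (D * p))
    ≤⟨ +-monoˡ-≤ (μ * (y * (D * p))) ratio ⟩
  y * (D * p) + μ * (y * (D * p)) ∎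
  where
  open ≤-Reasoning
  v = suc m + c
  x = v C m
  y = v C suc m
  p = D ^ m
  v≡ : m + suc c ≡ v
  v≡ = +-suc m c
  ih : μ * traceSum D v m ≤ suc μ * (x * p)
  -- The hypothesis concerns the topmost ratio, which is the smallest; further down m falls and c
  -- rises.
  ih = subst (λ v → μ * traceSum D v m ≤ suc μ * ((v C m) * p)) v≡
    (traceSum-geometric μ D m (suc c) (≤-trans (*-monoʳ-≤ (suc μ) (n≤1+n m))
      (≤-trans μm≤Dc (*-monoʳ-≤ D (n≤1+n (suc c))))))
  y≡ : suc m * y ≡ suc c * x
  y≡ = subst (λ v → suc m * (v C suc m) ≡ suc c * (v C m)) v≡ ([1+a]*vC[1+a]≡b*vCa m (suc c))
  ratio : suc μ * (x * p) ≤ y * (D * p)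
  ratio = *-cancelˡ-≤ (suc m) (begin
    suc m * (suc μ * (x * p))   ≡⟨ re₁ (suc m) (suc μ) x p ⟩
    suc μ * suc m * (x * p)     ≤⟨ *-monoˡ-≤ (x * p) μm≤Dc ⟩
    D * suc c * (x * p)         ≡⟨ re₂ D (suc c) x p ⟩
    suc c * x * (D * p)         ≡⟨ cong (_* (D * p)) y≡ ⟨
    suc m * y * (D * p)         ≡⟨ *-assoc (suc m) y (D * p) ⟩
    suc m * (y * (D * p))       ∎)
    where
    re₁ : ∀ a b c d → a * (b * (c * d)) ≡ b * a * (c * d)
    re₁ = solve-∀
    re₂ : ∀ a b c d → a * b * (c * d) ≡ b * c * (a * d)
    re₂ = solve-∀

-- Applied with μ = 1, at the cost of a factor 2 over the top summand, and with μ = 3, at the cost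
-- of 4/3.
traceSum≤ : ∀ μ D t J → suc μ * J ≤ D * suc t →
  μ * traceSum D (t + J) J ≤ suc μ * (((t + J) C J) * D ^ J)
traceSum≤ μ D t J h = subst (λ v → μ * traceSum D v J ≤ suc μ * ((v C J) * D ^ J)) (+-comm J t)
  (traceSum-geometric μ D J t h)

sumAbove-mono : ∀ {f g} q J d → (∀ I → J < I → q * f I ≤ g I) → q * sumAbove f J d ≤ sumAbove g J d
sumAbove-mono q J zero    h = ≤-reflexive (*-zeroʳ q)
sumAbove-mono q J (suc d) h = ≤-trans (≤-reflexive (*-distribˡ-+ q _ _))
  (+-mono-≤ (h (suc J) ≤-refl) (sumAbove-mono q (suc J) d (λ I J<I → h I (<-trans (n<1+n J) J<I))))

sumAbove-drop : ∀ f J₀ J d → sumAbove f (J + J₀) d ≤ sumAbove f J₀ (J + d)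
sumAbove-drop f J₀ zero    d = ≤-refl
sumAbove-drop f J₀ (suc J) d = ≤-trans (m≤n+m _ (f (suc (J + J₀))))
  (≤-trans (sumAbove-drop f J₀ J (suc d)) (≤-reflexive (cong (sumAbove f J₀) (+-suc J d))))

-- The series of (B/A) (p/q)^I Y with q = p + e: its tail beyond J is (B/A) (p/q)^J (p/e) Y, where e
-- = q - p comes from 1/(1 - p/q).
sumAbove-geometric : ∀ f p e A B Y J d .{{_ : NonZero (p + e)}} →
  (∀ I → J < I → I ≤ J + d → A * (p + e) ^ I * f I ≤ B * p ^ I * Y) →
  e * (A * (p + e) ^ J) * sumAbove f J d ≤ p * (B * p ^ J * Y)
sumAbove-geometric f p e A B Y J zero    h = ≤-trans (≤-reflexive (*-zeroʳ (e * (A * (p + e) ^ J)))) z≤n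
sumAbove-geometric f p e A B Y J (suc d) h = *-cancelˡ-≤ q (begin
  q * (e * (A * q ^ J) * (f (suc J) + S))
    ≡⟨ re₁ q e A (q ^ J) (f (suc J)) S ⟩
  e * (A * (q * q ^ J) * f (suc J)) + e * (A * (q * q ^ J)) * S
    ≤⟨ +-mono-≤ (*-monoʳ-≤ e (h (suc J) ≤-refl (≤-trans (s≤s (m≤m+n J d)) (≤-reflexive (sym (+-suc J d))))))
         (sumAbove-geometric f p e A B Y (suc J) d
           (λ I J<I I≤ → h I (<-trans (n<1+n J) J<I) (≤-trans I≤ (≤-reflexive (sym (+-suc J d)))))) ⟩
  e * (B * (p * p ^ J) * Y) + p * (B * (p * p ^ J) * Y)
    ≡⟨ re₂ p e B (p ^ J) Y ⟩
  q * (p * (B * p ^ J * Y)) ∎)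
  where
  open ≤-Reasoning
  q = p + e
  S = sumAbove f (suc J) d
  re₁ : ∀ q e A x f S → q * (e * (A * x) * (f + S)) ≡ e * (A * (q * x) * f) + e * (A * (q * x)) * S
  re₁ = solve-∀
  re₂ : ∀ p e B x Y → e * (B * (p * x) * Y) + p * (B * (p * x) * Y) ≡ (p + e) * (p * (B * x * Y))
  re₂ = solve-∀

^-distrib-* : ∀ a b n → (a * b) ^ n ≡ a ^ n * b ^ n
^-distrib-* a b zero    = refl
^-distrib-* a b (suc n) = trans (cong (a * b *_) (^-distrib-* a b n)) (interchange a b (a ^ n) (b ^ n))
  where
  interchange : ∀ a b c d → a * b * (c * d) ≡ a * c * (b * d)
  interchange = solve-∀

-- N X is the bound on the number of members lost at level I, with X = Δ (t + I).
scale : ∀ M X Y I N α β → α * N ≤ β * M ^ I → X * (16 * M) ^ I ≤ 3 ^ I * Y →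
        α * 16 ^ I * (N * X) ≤ β * (3 ^ I * Y)
scale M X Y I N α β αN≤ X≤ = begin
  α * 16 ^ I * (N * X)          ≡⟨ re₁ α (16 ^ I) N X ⟩
  α * N * (16 ^ I * X)          ≤⟨ *-monoˡ-≤ (16 ^ I * X) αN≤ ⟩
  β * M ^ I * (16 ^ I * X)      ≡⟨ re₂ β (M ^ I) (16 ^ I) X ⟩
  β * (X * (16 ^ I * M ^ I))    ≡⟨ cong (λ z → β * (X * z)) (^-distrib-* 16 M I) ⟨
  β * (X * (16 * M) ^ I)        ≤⟨ *-monoʳ-≤ β X≤ ⟩
  β * (3 ^ I * Y)               ∎
  where
  open ≤-Reasoning
  re₁ : ∀ a b c d → a * b * (c * d) ≡ a * c * (b * d)
  re₁ = solve-∀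
  re₂ : ∀ a b c d → a * b * (c * d) ≡ a * (d * (c * b))
  re₂ = solve-∀

-- The sizes of all levels together

module IntersectingSum (t K : ℕ) (1≤t : 1 ≤ t) (X : ℕ → ℕ) (Y : ℕ)
  (spread : ∀ I → X I * (16 * (t + K)) ^ I ≤ 3 ^ I * Y) where

  private
    k = t + K

  term : ℕ → ℕ
  term I = traceSum I (t + I) I * X I

  -- From J to J + 1 the binomial grows by (t + J + 1)/(J + 1) and the power by at most 3 (J + 1),
  -- together by at most 3 k.
  coefficient : ∀ j → suc j ≤ K → 3 * (((t + suc j) C suc j) * suc j ^ suc j) ≤ 3 ^ suc j * k ^ suc j
  coefficient zero 1≤K = begin
    3 * (((t + 1) C 1) * 1)   ≡⟨ cong (λ x → 3 * (x * 1)) (C₁≡ t) ⟩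
    3 * ((t + 1) * 1)         ≤⟨ *-monoʳ-≤ 3 (*-monoˡ-≤ 1 (+-monoʳ-≤ t 1≤K)) ⟩
    3 * (k * 1)               ∎
    where open ≤-Reasoning
  coefficient (suc j) i≤K = begin
    3 * (c′ * (i * i ^ J))             ≡⟨ re₁ c′ i (i ^ J) ⟩
    3 * (i * c′ * i ^ J)               ≡⟨ cong (λ x → 3 * (x * i ^ J)) ([1+J]*C≡ t J) ⟩
    3 * ((t + i) * c * i ^ J)          ≤⟨ *-monoʳ-≤ 3 (*-mono-≤ (*-monoˡ-≤ c (+-monoʳ-≤ t i≤K)) ([1+N]^i≤3N^i J J ≤-refl)) ⟩
    3 * (k * c * (3 * J ^ J))          ≡⟨ re₂ k c (J ^ J) ⟩
    3 * k * (3 * (c * J ^ J))          ≤⟨ *-monoʳ-≤ (3 * k) (coefficient j (<⇒≤ i≤K)) ⟩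
    3 * k * (3 ^ J * k ^ J)            ≡⟨ re₃ k (3 ^ J) (k ^ J) ⟩
    3 * 3 ^ J * (k * k ^ J)            ∎
    where
    open ≤-Reasoning
    J  = suc j
    i  = suc J
    c  = (t + J) C J
    c′ = (t + i) C i
    re₁ : ∀ c i p → 3 * (c * (i * p)) ≡ 3 * (i * c * p)
    re₁ = solve-∀
    re₂ : ∀ k c p → 3 * (k * c * (3 * p)) ≡ 3 * k * (3 * (c * p))
    re₂ = solve-∀
    re₃ : ∀ k p q → 3 * k * (p * q) ≡ 3 * p * (k * q)
    re₃ = solve-∀

  -- Ratio 9/16 per level: 3 from `coefficient` and 3/16 from spreadness.
  term≤ : ∀ I → 0 < I → I ≤ K → 3 * 16 ^ I * term I ≤ 2 * 9 ^ I * Y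
  term≤ I@(suc j) _ I≤K = ≤-trans (scale k (X I) Y I N 3 (2 * 3 ^ I) N≤ (spread I))
    (≤-reflexive (trans (re (3 ^ I) Y) (cong (λ z → 2 * z * Y) (sym (^-distrib-* 3 3 I)))))
    where
    open ≤-Reasoning
    re : ∀ p Y → 2 * p * (p * Y) ≡ 2 * (p * p) * Y
    re = solve-∀
    N = traceSum I (t + I) I
    g = ((t + I) C I) * I ^ I
    re₁ : ∀ N → 3 * N ≡ 3 * (1 * N)
    re₁ = solve-∀
    re₂ : ∀ g → 3 * (2 * g) ≡ 2 * (3 * g)
    re₂ = solve-∀
    re₃ : ∀ p q → 2 * (p * q) ≡ 2 * p * q
    re₃ = solve-∀
    N≤ : 3 * N ≤ 2 * 3 ^ I * k ^ I
    N≤ = begin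
      3 * N                     ≡⟨ re₁ N ⟩
      3 * (1 * N)               ≤⟨ *-monoʳ-≤ 3 (traceSum≤ 1 I t I (≤-trans (≤-reflexive (*-comm 2 I)) (*-monoʳ-≤ I (s≤s 1≤t)))) ⟩
      3 * (2 * g)               ≡⟨ re₂ g ⟩
      2 * (3 * g)               ≤⟨ *-monoʳ-≤ 2 (coefficient j I≤K) ⟩
      2 * (3 ^ I * k ^ I)       ≡⟨ re₃ (3 ^ I) (k ^ I) ⟩
      2 * 3 ^ I * k ^ I         ∎

  -- Computed directly as t + 2 ≤ 3/2 (t + 1): the general estimate would make the levels cost 6/7,
  -- and 6/7 + 3/16 exceeds 1.
  term₁≤ : 1 ≤ K → 32 * term 1 ≤ 9 * Y
  term₁≤ 1≤K = ≤-trans (scale k (X 1) Y 1 N 2 3 N≤ (spread 1)) (≤-reflexive (re Y))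
    where
    open ≤-Reasoning
    re : ∀ Y → 3 * (3 * Y) ≡ 9 * Y
    re = solve-∀
    N = traceSum 1 (t + 1) 1
    identity : ∀ x → 2 * (1 + (1 + x + 1) * 1) + x ≡ 3 * (1 + x + 1) 
    identity = solve-∀
    N≤ : 2 * N ≤ 3 * (k * 1)
    N≤ = begin
      2 * N                           ≡⟨ cong (2 *_) (traceSum-suc 1 (t + 1) 0) ⟩
      2 * (traceSum 1 (t + 1) 0 + ((t + 1) C 1) * 1)
                                      ≡⟨ cong₂ (λ x y → 2 * (x + y * 1)) (traceSum₀ 1 (t + 1)) (C₁≡ t) ⟩
      2 * (1 + (t + 1) * 1)           ≤⟨ subst (λ t → 2 * (1 + (t + 1) * 1) ≤ 3 * (t + 1)) (m+[n∸m]≡n 1≤t) (≤-by (identity (t ∸ 1))) ⟩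
      3 * (t + 1)                     ≤⟨ *-monoʳ-≤ 3 (≤-trans (+-monoʳ-≤ t 1≤K) (≤-reflexive (sym (*-identityʳ k)))) ⟩
      3 * (k * 1)                     ∎

  -- 9/32 for level 1 and a geometric tail of 27/56 from level 2 on.
  sum≤ : ∀ d → d ≡ K → 224 * sumAbove term 0 d ≤ 171 * Y
  sum≤ zero    _    = z≤n
  sum≤ (suc d) refl = begin
    224 * (term 1 + S)              ≡⟨ re₁ (term 1) S ⟩
    7 * (32 * term 1) + 224 * S     ≤⟨ +-mono-≤ (*-monoʳ-≤ 7 (term₁≤ (s≤s z≤n))) (*-cancelˡ-≤ 3 tail) ⟩
    7 * (9 * Y) + 108 * Y           ≡⟨ re₂ Y ⟩
    171 * Y                         ∎
    where
    open ≤-Reasoning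
    S = sumAbove term 1 d
    re₁ : ∀ a S → 224 * (a + S) ≡ 7 * (32 * a) + 224 * S
    re₁ = solve-∀
    re₂ : ∀ Y → 7 * (9 * Y) + 108 * Y ≡ 171 * Y
    re₂ = solve-∀
    re₃ : ∀ S → 3 * (224 * S) ≡ 2 * (336 * S)
    re₃ = solve-∀
    re₄ : ∀ Y → 2 * (9 * (18 * Y)) ≡ 3 * (108 * Y)
    re₄ = solve-∀
    tail : 3 * (224 * S) ≤ 3 * (108 * Y)
    tail = begin
      3 * (224 * S)         ≡⟨ re₃ S ⟩
      2 * (336 * S)         ≤⟨ *-monoʳ-≤ 2 (sumAbove-geometric term 9 7 3 2 Y 1 d
                                 (λ I 1<I I≤ → term≤ I (<-trans (s≤s z≤n) 1<I) I≤)) ⟩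
      2 * (9 * (18 * Y))    ≡⟨ re₄ Y ⟩
      3 * (108 * Y)         ∎

-- Bounds the choices outside A at level I, which are at most 2 I and at most I + t;
-- for I ≤ 3 the bound 2 I is good enough and easier to evaluate.
branching : ℕ → ℕ → ℕ
branching t 0 = 0
branching t 1 = 2
branching t 2 = 4
branching t 3 = 6
branching t I = I + (I ⊓ t)

module CrossSum (t K M : ℕ) (1≤t : 1 ≤ t) (M≥[t+2]² : (t + 2) * (t + 2) ≤ M) (M≥k : t + K ≤ M)
  (X : ℕ → ℕ) (Y : ℕ) (spread : ∀ I → X I * (16 * M) ^ I ≤ 3 ^ I * Y) where

  term : ℕ → ℕ
  term I = traceSum (branching t I) (t + I) I * X I

  -- If a family is exhausted at level L, the factor (t + L choose L) of its partner is at most (t +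
  -- I choose I) on every level I ≥ L, so it can be distributed over the terms.
  weighted : ℕ → ℕ
  weighted I = ((t + I) C I) * term I

  -- For I ≥ 4 the top summand of `weighted I` without `X I`: one binomial from `traceSum`, one from
  -- the weight.
  square : ℕ → ℕ
  square I = ((t + I) C I) * ((t + I) C I) * (I + (I ⊓ t)) ^ I

  -- Serves `square-step` for i ≤ t, where the squared binomial grows by ((t + i)/i)^2 and the power
  -- by at most 6 i. The polynomial in `identity` is the difference of the two sides, with
  -- nonnegative coefficients once i = 3 + x and t = i + d.
  cubic-small : ∀ i → 3 ≤ i → i ≤ t → 3 * ((t + i) * (t + i)) ≤ 2 * M * i
  cubic-small i 3≤i i≤t = begin
    3 * ((t + i) * (t + i))         ≤⟨ subst₂ (λ t i → 3 * ((t + i) * (t + i)) ≤ 2 * ((t + 2) * (t + 2)) * i) t≡ i≡ (≤-by (identity (i ∸ 3) (t ∸ i))) ⟩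
    2 * ((t + 2) * (t + 2)) * i     ≤⟨ *-monoˡ-≤ i (*-monoʳ-≤ 2 M≥[t+2]²) ⟩
    2 * M * i                       ∎
    where
    open ≤-Reasoning
    i≡ : 3 + (i ∸ 3) ≡ i
    i≡ = m+[n∸m]≡n 3≤i
    t≡ : 3 + (i ∸ 3) + (t ∸ i) ≡ t
    t≡ = trans (cong (_+ (t ∸ i)) i≡) (m+[n∸m]≡n i≤t)
    identity : ∀ x d → let i = 3 + x; t = 3 + x + d in
      3 * ((t + i) * (t + i)) + (42 + 24 * d + 3 * (d * d) + 38 * x + 14 * (x * x) + 2 * (x * x * x)
        + 20 * (x * d) + 4 * (x * x * d) + 2 * (x * (d * d)))
      ≡ 2 * ((t + 2) * (t + 2)) * i
    identity = solve-∀

  -- (t + 2)^2 - 8 t = (t - 2)^2.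
  8t≤M : 8 * t ≤ M
  8t≤M = ≤-trans (square≥ t 1≤t) M≥[t+2]²
    where
    identity : ∀ s → 8 * (2 + s) + s * s ≡ (2 + s + 2) * (2 + s + 2)
    identity = solve-∀
    square≥ : ∀ t → 1 ≤ t → 8 * t ≤ (t + 2) * (t + 2)
    square≥ (suc zero)    _ = n≤1+n 8
    square≥ (suc (suc s)) _ = ≤-by (identity s)

  -- Serves `square-step` for i > t, where the power grows by at most 3 (t + i). If i > 7 t, then (t
  -- + i)/i < 8/7 and 3 (8/7)^2 < 4, so M ≥ t + i suffices; for smaller i it is M ≥ 8 t that helps.
  cubic-large : ∀ i → t ≤ i → t + i ≤ M → 3 * ((t + i) * (t + i) * (t + i)) ≤ 4 * M * (i * i)
  cubic-large i t≤i t+i≤M with i ℕ.≤? 7 * t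
  ... | yes i≤7t = begin
    3 * ((t + i) * (t + i) * (t + i))   ≤⟨ +-cancelʳ-≤ (7 * t * d * (3 * i + t)) _ _ shifted ⟩
    4 * (8 * t) * (i * i)               ≤⟨ *-monoˡ-≤ (i * i) (*-monoʳ-≤ 4 8t≤M) ⟩
    4 * M * (i * i)                     ∎
    where
    open ≤-Reasoning
    d = i ∸ t
    -- 32 t i² − 3 (t + i)³ = (i − t) (7t − i) (3i + t) + 4t²i + 4t³
    identity : ∀ t d → let i = t + d in
      3 * ((t + i) * (t + i) * (t + i)) + 7 * t * d * (3 * i + t) + (4 * (t * t * i) + 4 * (t * t * t))
      ≡ 4 * (8 * t) * (i * i) + i * d * (3 * i + t)
    identity = solve-∀
    shifted : 3 * ((t + i) * (t + i) * (t + i)) + 7 * t * d * (3 * i + t)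
              ≤ 4 * (8 * t) * (i * i) + 7 * t * d * (3 * i + t)
    shifted = ≤-trans
      (subst (λ i → 3 * ((t + i) * (t + i) * (t + i)) + 7 * t * d * (3 * i + t)
                    ≤ 4 * (8 * t) * (i * i) + i * d * (3 * i + t))
        (m+[n∸m]≡n t≤i) (≤-by (identity t d)))
      (+-monoʳ-≤ (4 * (8 * t) * (i * i)) (*-monoˡ-≤ (3 * i + t) (*-monoˡ-≤ d i≤7t)))
  ... | no i≰7t = begin
    3 * ((t + i) * (t + i) * (t + i))   ≡⟨ re₁ (t + i) ⟩
    3 * ((t + i) * (t + i)) * (t + i)   ≤⟨ *-mono-≤ (*-cancelˡ-≤ {3 * ((t + i) * (t + i))} {4 * (i * i)} 49 quadratic) t+i≤M ⟩
    4 * (i * i) * M                     ≡⟨ re₂ i M ⟩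
    4 * M * (i * i)                     ∎
    where
    open ≤-Reasoning
    re₁ : ∀ a → 3 * (a * a * a) ≡ 3 * (a * a) * a
    re₁ = solve-∀
    re₂ : ∀ i M → 4 * (i * i) * M ≡ 4 * M * (i * i)
    re₂ = solve-∀
    re₃ : ∀ a → 49 * (3 * (a * a)) ≡ 3 * (7 * a * (7 * a))
    re₃ = solve-∀
    re₄ : ∀ i → 3 * (8 * i * (8 * i)) + 4 * (i * i) ≡ 49 * (4 * (i * i))
    re₄ = solve-∀
    7[t+i]≤8i : 7 * (t + i) ≤ 8 * i
    7[t+i]≤8i = ≤-trans (≤-reflexive (*-distribˡ-+ 7 t i)) (+-monoˡ-≤ (7 * i) (<⇒≤ (≰⇒> i≰7t)))
    quadratic : 49 * (3 * ((t + i) * (t + i))) ≤ 49 * (4 * (i * i))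
    quadratic = begin
      49 * (3 * ((t + i) * (t + i)))       ≡⟨ re₃ (t + i) ⟩
      3 * (7 * (t + i) * (7 * (t + i)))    ≤⟨ *-monoʳ-≤ 3 (*-mono-≤ 7[t+i]≤8i 7[t+i]≤8i) ⟩
      3 * (8 * i * (8 * i))                ≤⟨ ≤-by (re₄ i) ⟩
      49 * (4 * (i * i))                   ∎

  -- Together with the factor 3 / (16 M) per level this gives the ratio 3 / 4.
  square-step : ∀ I → 3 ≤ I → t + suc I ≤ M → square (suc I) ≤ 4 * M * square I
  square-step I 3≤I t+i≤M with suc I ℕ.≤? t
  ... | yes i≤t rewrite m≤n⇒m⊓n≡m i≤t | m≤n⇒m⊓n≡m (<⇒≤ i≤t) = *-cancelˡ-≤ (i * i) (begin
    i * i * (c′ * c′ * (i + i) ^ i)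
      ≡⟨ re₁ i c′ ((i + i) ^ i) ⟩
    i * c′ * (i * c′) * (i + i) ^ i
      ≡⟨ cong (λ x → x * x * (i + i) ^ i) ([1+J]*C≡ t I) ⟩
    (t + i) * c * ((t + i) * c) * ((i + i) * (i + i) ^ I)
      ≤⟨ *-monoʳ-≤ ((t + i) * c * ((t + i) * c)) (*-monoʳ-≤ (i + i) power) ⟩
    (t + i) * c * ((t + i) * c) * ((i + i) * (3 * p))
      ≡⟨ re₂ (t + i) c i p ⟩
    3 * ((t + i) * (t + i)) * (2 * i * (c * c * p))
      ≤⟨ *-monoˡ-≤ (2 * i * (c * c * p)) (cubic-small i (m≤n⇒m≤1+n 3≤I) i≤t) ⟩
    2 * M * i * (2 * i * (c * c * p))
      ≡⟨ re₃ M i (c * c * p) ⟩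
    i * i * (4 * M * (c * c * p)) ∎)
    where
    open ≤-Reasoning
    i  = suc I
    c  = (t + I) C I
    c′ = (t + i) C i
    p  = (I + I) ^ I
    re₁ : ∀ i c p → i * i * (c * c * p) ≡ i * c * (i * c) * p
    re₁ = solve-∀
    re₂ : ∀ s c i p → s * c * (s * c) * ((i + i) * (3 * p)) ≡ 3 * (s * s) * (2 * i * (c * c * p))
    re₂ = solve-∀
    re₃ : ∀ M i q → 2 * M * i * (2 * i * q) ≡ i * i * (4 * M * q)
    re₃ = solve-∀
    double : ∀ I → I + I ≡ 2 * I
    double = solve-∀
    re₄ : ∀ a b → a * (3 * b) ≡ 3 * (a * b)
    re₄ = solve-∀
    power : (i + i) ^ I ≤ 3 * p
    power = begin
      (i + i) ^ I          ≡⟨ trans (cong (_^ I) (double i)) (^-distrib-* 2 i I) ⟩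
      2 ^ I * i ^ I        ≤⟨ *-monoʳ-≤ (2 ^ I) ([1+N]^i≤3N^i I I ≤-refl) ⟩
      2 ^ I * (3 * I ^ I)  ≡⟨ re₄ (2 ^ I) (I ^ I) ⟩
      3 * (2 ^ I * I ^ I)  ≡⟨ cong (3 *_) (trans (cong (_^ I) (double I)) (^-distrib-* 2 I I)) ⟨
      3 * p                ∎
  ... | no i≰t rewrite m≥n⇒m⊓n≡n (ℕ.s≤s⁻¹ (≰⇒> i≰t)) | m≥n⇒m⊓n≡n (<⇒≤ (≰⇒> i≰t)) = *-cancelˡ-≤ (i * i) (begin
    i * i * (c′ * c′ * (i + t) ^ i)
      ≡⟨ re₁ i c′ ((i + t) ^ i) ⟩
    i * c′ * (i * c′) * (i + t) ^ i
      ≡⟨ cong (λ x → x * x * (i + t) ^ i) ([1+J]*C≡ t I) ⟩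
    (t + i) * c * ((t + i) * c) * ((i + t) * (i + t) ^ I)
      ≤⟨ *-monoʳ-≤ ((t + i) * c * ((t + i) * c)) (*-monoʳ-≤ (i + t) ([1+N]^i≤3N^i (I + t) I (m≤m+n I t))) ⟩
    (t + i) * c * ((t + i) * c) * ((i + t) * (3 * p))
      ≡⟨ re₂ t i c p ⟩
    3 * ((t + i) * (t + i) * (t + i)) * (c * c * p)
      ≤⟨ *-monoˡ-≤ (c * c * p) (cubic-large i (<⇒≤ (≰⇒> i≰t)) t+i≤M) ⟩
    4 * M * (i * i) * (c * c * p)
      ≡⟨ re₃ M i (c * c * p) ⟩
    i * i * (4 * M * (c * c * p)) ∎)
    where
    open ≤-Reasoning
    i  = suc I
    c  = (t + I) C I
    c′ = (t + i) C i
    p  = (I + t) ^ I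
    re₁ : ∀ i c p → i * i * (c * c * p) ≡ i * c * (i * c) * p
    re₁ = solve-∀
    re₂ : ∀ t i c p → (t + i) * c * ((t + i) * c) * ((i + t) * (3 * p)) ≡ 3 * ((t + i) * (t + i) * (t + i)) * (c * c * p)
    re₂ = solve-∀
    re₃ : ∀ M i q → 4 * M * (i * i) * q ≡ i * i * (4 * M * q)
    re₃ = solve-∀

  [t+1][t+2]≤M : (t + 2) * (t + 1) ≤ M
  [t+1][t+2]≤M = ≤-trans (*-monoʳ-≤ (t + 2) (+-monoʳ-≤ t (s≤s z≤n))) M≥[t+2]²

  C₂²≤ : 4 * (((t + 2) C 2) * ((t + 2) C 2)) ≤ M * M
  C₂²≤ = ≤-trans (≤-reflexive (re ((t + 2) C 2)))
    (*-mono-≤ 2C≤M 2C≤M)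
    where
    re : ∀ c → 4 * (c * c) ≡ 2 * c * (2 * c)
    re = solve-∀
    2C≤M : 2 * ((t + 2) C 2) ≤ M
    2C≤M = ≤-trans (≤-reflexive (2*C₂≡ t)) [t+1][t+2]≤M

  -- The left side is (t + 2)^2 times the square of (t + 1)(t + 3) = (t + 2)^2 - 1: three factors of
  -- at most M.
  C₃²≤ : 36 * (((t + 3) C 3) * ((t + 3) C 3)) ≤ M * (M * M)
  C₃²≤ = begin
    36 * (c * c)
      ≡⟨ re₁ c ⟩
    6 * c * (6 * c)
      ≡⟨ cong (λ x → x * x) (6*C₃≡ t) ⟩
    (t + 3) * ((t + 2) * (t + 1)) * ((t + 3) * ((t + 2) * (t + 1)))
      ≡⟨ re₂ t ⟩
    (t + 2) * (t + 2) * ((t + 3) * (t + 1) * ((t + 3) * (t + 1)))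
      ≤⟨ *-mono-≤ M≥[t+2]² (*-mono-≤ outer≤ outer≤) ⟩
    M * (M * M) ∎
    where
    open ≤-Reasoning
    c = (t + 3) C 3
    re₁ : ∀ c → 36 * (c * c) ≡ 6 * c * (6 * c)
    re₁ = solve-∀
    re₂ : ∀ t → (t + 3) * ((t + 2) * (t + 1)) * ((t + 3) * ((t + 2) * (t + 1)))
                ≡ (t + 2) * (t + 2) * ((t + 3) * (t + 1) * ((t + 3) * (t + 1)))
    re₂ = solve-∀
    identity : ∀ t → (t + 3) * (t + 1) + 1 ≡ (t + 2) * (t + 2)
    identity = solve-∀
    outer≤ : (t + 3) * (t + 1) ≤ M
    outer≤ = ≤-trans (≤-by (identity t)) M≥[t+2]²

  square≤ : ∀ j → 3 + j ≤ K → 32 * square (3 + j) ≤ 3 * 4 ^ (3 + j) * M ^ (3 + j)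
  square≤ zero 3≤K = begin
    32 * (c * c * D ^ 3)          ≤⟨ *-monoʳ-≤ 32 (*-monoʳ-≤ (c * c) (^-monoˡ-≤ 3 (+-monoʳ-≤ 3 (m⊓n≤m 3 t)))) ⟩
    32 * (c * c * 216)            ≡⟨ re₁ (c * c) ⟩
    192 * (36 * (c * c))          ≤⟨ *-monoʳ-≤ 192 C₃²≤ ⟩
    192 * (M * (M * M))           ≡⟨ re₂ M ⟩
    192 * (M * (M * (M * 1)))     ∎
    where
    open ≤-Reasoning
    c = (t + 3) C 3
    D = 3 + (3 ⊓ t)
    re₁ : ∀ x → 32 * (x * 216) ≡ 192 * (36 * x)
    re₁ = solve-∀
    re₂ : ∀ M → 192 * (M * (M * M)) ≡ 192 * (M * (M * (M * 1)))
    re₂ = solve-∀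
  square≤ (suc j) i≤K = begin
    32 * square (suc I)                   ≤⟨ *-monoʳ-≤ 32 (square-step I (m≤m+n 3 j) (≤-trans (+-monoʳ-≤ t i≤K) M≥k)) ⟩
    32 * (4 * M * square I)               ≡⟨ re₁ M (square I) ⟩
    4 * M * (32 * square I)               ≤⟨ *-monoʳ-≤ (4 * M) (square≤ j (<⇒≤ i≤K)) ⟩
    4 * M * (3 * 4 ^ I * M ^ I)           ≡⟨ re₂ M (4 ^ I) (M ^ I) ⟩
    3 * (4 * 4 ^ I) * (M * M ^ I)         ∎
    where
    open ≤-Reasoning
    I = 3 + j
    re₁ : ∀ M s → 32 * (4 * M * s) ≡ 4 * M * (32 * s)
    re₁ = solve-∀
    re₂ : ∀ M p q → 4 * M * (3 * p * q) ≡ 3 * (4 * p) * (M * q)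
    re₂ = solve-∀

  -- `square-step` only starts at level 3, so the first levels are evaluated separately. Here (t +
  -- 1)(2 t + 3) ≤ 2 M, and 2 · 3/16 = 384/1024.
  weighted₁≤ : 1024 * weighted 1 ≤ 384 * Y
  weighted₁≤ = ≤-trans (≤-reflexive (re₁ (weighted 1))) (≤-trans (*-monoʳ-≤ 64 (subst (λ x → 16 * x ≤ 2 * (3 * Y)) (*-assoc c N (X 1))
      (scale M (X 1) Y 1 (c * N) 1 2 bound (spread 1)))) (≤-reflexive (re₂ Y)))
    where
    open ≤-Reasoning
    c = (t + 1) C 1
    N = traceSum 2 (t + 1) 1
    re₁ : ∀ w → 1024 * w ≡ 64 * (16 * w)
    re₁ = solve-∀
    re₂ : ∀ Y → 64 * (2 * (3 * Y)) ≡ 384 * Y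
    re₂ = solve-∀
    identity : ∀ t → 1 * ((t + 1) * (1 + (t + 1) * 2)) + (3 * t + 5) ≡ 2 * ((t + 2) * (t + 2))
    identity = solve-∀
    bound : 1 * (c * N) ≤ 2 * (M * 1)
    bound = begin
      1 * (c * N)                            ≡⟨ cong (λ x → 1 * (c * x)) (traceSum-suc 2 (t + 1) 0) ⟩
      1 * (c * (traceSum 2 (t + 1) 0 + c * 2)) ≡⟨ cong₂ (λ x y → 1 * (y * (x + y * 2))) (traceSum₀ 2 (t + 1)) (C₁≡ t) ⟩
      1 * ((t + 1) * (1 + (t + 1) * 2))      ≤⟨ ≤-by (identity t) ⟩
      2 * ((t + 2) * (t + 2))                ≤⟨ *-monoʳ-≤ 2 (≤-trans M≥[t+2]² (≤-reflexive (sym (*-identityʳ M)))) ⟩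
      2 * (M * 1)                            ∎

  private
    -- μ = 3 for the levels 2 and 3: with the factor 2 of μ = 1 the total would exceed 7/8.
    coefficient≤ : ∀ I D → 4 * I ≤ D * suc t → let c = (t + I) C I in
      3 * (c * traceSum D (t + I) I) ≤ 4 * (c * c * D ^ I)
    coefficient≤ I D h = begin
      3 * (c * N)           ≡⟨ re₁ c N ⟩
      c * (3 * N)           ≤⟨ *-monoʳ-≤ c (traceSum≤ 3 D t I h) ⟩
      c * (4 * (c * D ^ I)) ≡⟨ re₂ c (D ^ I) ⟩
      4 * (c * c * D ^ I)   ∎
      where
      open ≤-Reasoning
      c = (t + I) C I
      N = traceSum D (t + I) I
      re₁ : ∀ c N → 3 * (c * N) ≡ c * (3 * N)
      re₁ = solve-∀
      re₂ : ∀ c p → c * (4 * (c * p)) ≡ 4 * (c * c * p)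
      re₂ = solve-∀

  weighted₂≤ : 1024 * weighted 2 ≤ 192 * Y
  weighted₂≤ = *-cancelˡ-≤ 3 (begin
    3 * (1024 * weighted 2)    ≡⟨ re₁ (weighted 2) ⟩
    4 * (768 * weighted 2)     ≤⟨ *-monoʳ-≤ 4 (subst (λ x → 768 * x ≤ 16 * (9 * Y)) (*-assoc c N (X 2))
                                    (scale M (X 2) Y 2 (c * N) 3 16 bound (spread 2))) ⟩
    4 * (16 * (9 * Y))         ≡⟨ re₂ Y ⟩
    3 * (192 * Y)              ∎)
    where
    open ≤-Reasoning
    c = (t + 2) C 2
    N = traceSum 4 (t + 2) 2
    re₁ : ∀ w → 3 * (1024 * w) ≡ 4 * (768 * w)
    re₁ = solve-∀
    re₂ : ∀ Y → 4 * (16 * (9 * Y)) ≡ 3 * (192 * Y)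
    re₂ = solve-∀
    re₃ : ∀ x → 4 * (x * 16) ≡ 16 * (4 * x)
    re₃ = solve-∀
    bound : 3 * (c * N) ≤ 16 * (M * (M * 1))
    bound = begin
      3 * (c * N)           ≤⟨ coefficient≤ 2 4 (*-monoʳ-≤ 4 (s≤s 1≤t)) ⟩
      4 * (c * c * 16)      ≡⟨ re₃ (c * c) ⟩
      16 * (4 * (c * c))    ≤⟨ *-monoʳ-≤ 16 C₂²≤ ⟩
      16 * (M * M)          ≡⟨ cong (λ x → 16 * (M * x)) (*-identityʳ M) ⟨
      16 * (M * (M * 1))    ∎

  weighted₃≤ : 1024 * weighted 3 ≤ 54 * Y
  weighted₃≤ = *-cancelˡ-≤ 12 (begin
    12 * (1024 * weighted 3)   ≡⟨ re₁ (weighted 3) ⟩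
    3 * 4096 * weighted 3      ≤⟨ subst (λ x → 12288 * x ≤ 24 * (27 * Y)) (*-assoc c N (X 3))
                                    (scale M (X 3) Y 3 (c * N) 3 24 bound (spread 3)) ⟩
    24 * (27 * Y)              ≡⟨ re₂ Y ⟩
    12 * (54 * Y)              ∎)
    where
    open ≤-Reasoning
    c = (t + 3) C 3
    N = traceSum 6 (t + 3) 3
    re₁ : ∀ w → 12 * (1024 * w) ≡ 3 * 4096 * w
    re₁ = solve-∀
    re₂ : ∀ Y → 24 * (27 * Y) ≡ 12 * (54 * Y)
    re₂ = solve-∀
    re₃ : ∀ x → 4 * (x * 216) ≡ 24 * (36 * x)
    re₃ = solve-∀
    bound : 3 * (c * N) ≤ 24 * (M * (M * (M * 1)))
    bound = begin
      3 * (c * N)              ≤⟨ coefficient≤ 3 6 (*-monoʳ-≤ 6 (s≤s 1≤t)) ⟩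
      4 * (c * c * 216)        ≡⟨ re₃ (c * c) ⟩
      24 * (36 * (c * c))      ≤⟨ *-monoʳ-≤ 24 C₃²≤ ⟩
      24 * (M * (M * M))       ≡⟨ cong (λ x → 24 * (M * (M * x))) (*-identityʳ M) ⟨
      24 * (M * (M * (M * 1))) ∎

  weighted≤ : ∀ I → 3 < I → I ≤ K → 16 * 16 ^ I * weighted I ≤ 3 * 12 ^ I * Y
  weighted≤ 1 (s≤s ())
  weighted≤ 2 (s≤s (s≤s ()))
  weighted≤ 3 (s≤s (s≤s (s≤s ())))
  -- Four constructors are exposed to let `branching t I` compute to `I + (I ⊓ t)`.
  weighted≤ I@(suc (suc (suc (suc j)))) _ I≤K = ≤-trans
    (subst (λ x → 16 * 16 ^ I * x ≤ 3 * 4 ^ I * (3 ^ I * Y)) (*-assoc c N (X I))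
      (scale M (X I) Y I (c * N) 16 (3 * 4 ^ I) bound (spread I)))
    (≤-reflexive (trans (re₁ (4 ^ I) (3 ^ I) Y) (cong (λ z → 3 * z * Y) (sym (^-distrib-* 4 3 I)))))
    where
    open ≤-Reasoning
    c = (t + I) C I
    D = I + (I ⊓ t)
    N = traceSum D (t + I) I
    re₁ : ∀ p q Y → 3 * p * (q * Y) ≡ 3 * (p * q) * Y
    re₁ = solve-∀
    re₂ : ∀ c N → 16 * (c * N) ≡ 16 * c * (1 * N)
    re₂ = solve-∀
    re₃ : ∀ c p → 16 * c * (2 * (c * p)) ≡ 32 * (c * c * p)
    re₃ = solve-∀
    enough : 2 * I ≤ D * suc t
    enough = ≤-trans (≤-reflexive (*-comm 2 I)) (*-mono-≤ (m≤m+n I (I ⊓ t)) (s≤s 1≤t))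
    bound : 16 * (c * N) ≤ 3 * 4 ^ I * M ^ I
    bound = begin
      16 * (c * N)                ≡⟨ re₂ c N ⟩
      16 * c * (1 * N)            ≤⟨ *-monoʳ-≤ (16 * c) (traceSum≤ 1 D t I enough) ⟩
      16 * c * (2 * (c * D ^ I))  ≡⟨ re₃ c (D ^ I) ⟩
      32 * square I               ≤⟨ square≤ (suc j) I≤K ⟩
      3 * 4 ^ I * M ^ I           ∎

  -- (3/16) (3/4)^4 · 4 = 243/1024.
  tail₃≤ : ∀ d → 3 + d ≡ K → 1024 * sumAbove weighted 3 d ≤ 243 * Y
  tail₃≤ d refl = *-cancelˡ-≤ 256 (begin
    256 * (1024 * S)       ≡⟨ re₁ S ⟩
    262144 * S             ≤⟨ sumAbove-geometric weighted 12 4 16 3 Y 3 d weighted≤ ⟩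
    12 * (5184 * Y)        ≡⟨ re₂ Y ⟩
    256 * (243 * Y)        ∎)
    where
    open ≤-Reasoning
    S = sumAbove weighted 3 d
    re₁ : ∀ w → 256 * (1024 * w) ≡ 262144 * w
    re₁ = solve-∀
    re₂ : ∀ Y → 12 * (5184 * Y) ≡ 256 * (243 * Y)
    re₂ = solve-∀

  private
    cons : ∀ u v a S → 1024 * a ≤ u * Y → 1024 * S ≤ v * Y → 1024 * (a + S) ≤ (u + v) * Y
    cons u v a S a≤ S≤ = ≤-trans (≤-reflexive (*-distribˡ-+ 1024 a S))
      (≤-trans (+-mono-≤ a≤ S≤) (≤-reflexive (sym (*-distribʳ-+ Y u v))))

  tail₂≤ : ∀ d → 2 + d ≡ K → 1024 * sumAbove weighted 2 d ≤ 297 * Y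
  tail₂≤ zero    _  = z≤n
  tail₂≤ (suc d) eq = cons 54 243 (weighted 3) (sumAbove weighted 3 d) weighted₃≤ (tail₃≤ d eq)

  tail₁≤ : ∀ d → 1 + d ≡ K → 1024 * sumAbove weighted 1 d ≤ 489 * Y
  tail₁≤ zero    _  = z≤n
  tail₁≤ (suc d) eq = cons 192 297 (weighted 2) (sumAbove weighted 2 d) weighted₂≤ (tail₂≤ d eq)

  total≤ : ∀ d → d ≡ K → 1024 * sumAbove weighted 0 d ≤ 873 * Y
  total≤ zero    _  = z≤n
  total≤ (suc d) eq = cons 384 489 (weighted 1) (sumAbove weighted 1 d) weighted₁≤ (tail₁≤ d eq)

  private
    coarsen : ∀ m b c d x .{{_ : NonZero m}} → b ≤ m * d → m * c * x ≤ b * Y → c * x ≤ d * Y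
    coarsen m b c d x b≤ h = *-cancelˡ-≤ m (begin
      m * (c * x)    ≡⟨ *-assoc m c x ⟨
      m * c * x      ≤⟨ h ⟩
      b * Y          ≤⟨ *-monoˡ-≤ Y b≤ ⟩
      m * d * Y      ≡⟨ *-assoc m d Y ⟩
      m * (d * Y)    ∎)
      where open ≤-Reasoning

  -- The weights are at least t + 1 ≥ 2, so dropping them halves the bound 7/8 that 873/1024 is
  -- rounded to.
  sum≤ : 16 * sumAbove term 0 K ≤ 7 * Y
  sum≤ = begin
    16 * S                   ≡⟨ *-assoc 8 2 S ⟩
    8 * (2 * S)              ≤⟨ *-monoʳ-≤ 8 (sumAbove-mono 2 0 K λ I 0<I → *-monoˡ-≤ (term I)
                                  (≤-trans (+-monoˡ-≤ 1 1≤t) (≤-trans (≤-reflexive (sym (C₁≡ t))) (C-mono t 0<I)))) ⟩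
    8 * sumAbove weighted 0 K ≤⟨ coarsen 128 873 8 7 (sumAbove weighted 0 K) (m≤m+n 873 23) (total≤ K refl) ⟩
    7 * Y                    ∎
    where
    open ≤-Reasoning
    S = sumAbove term 0 K

  3≤C₂ : 3 ≤ (t + 2) C 2
  3≤C₂ = *-cancelˡ-≤ 2 (≤-trans (*-mono-≤ (+-monoˡ-≤ 2 1≤t) (+-monoˡ-≤ 1 1≤t)) (≤-reflexive (sym (2*C₂≡ t))))

  -- Only levels from 2 on occur; there the weights are at least 3 and the weighted sum is below
  -- 1/2.
  sum⁺≤ : ∀ J d → suc J + d ≡ K → 6 * sumAbove term (suc J) d ≤ Y
  sum⁺≤ J d eq = begin
    6 * S                              ≡⟨ *-assoc 2 3 S ⟩
    2 * (3 * S)                        ≤⟨ *-monoʳ-≤ 2 (sumAbove-mono 3 (suc J) d λ I J<I → *-monoˡ-≤ (term I)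
                                            (≤-trans 3≤C₂ (C-mono t (≤-trans (s≤s (s≤s z≤n)) J<I)))) ⟩
    2 * sumAbove weighted (suc J) d    ≡⟨ cong (λ x → 2 * sumAbove weighted x d) (+-comm 1 J) ⟩
    2 * sumAbove weighted (J + 1) d    ≤⟨ *-monoʳ-≤ 2 (sumAbove-drop weighted 1 J d) ⟩
    2 * sumAbove weighted 1 (J + d)    ≤⟨ coarsen 512 489 2 1 (sumAbove weighted 1 (J + d)) (m≤m+n 489 23) (tail₁≤ (J + d) eq) ⟩
    1 * Y                              ≡⟨ *-identityˡ Y ⟩
    Y                                  ∎
    where
    open ≤-Reasoning
    S = sumAbove term (suc J) d

  C*sum≤ : ∀ J d → suc J + d ≡ K → 8 * (((t + suc J) C suc J) * sumAbove term J (suc d)) ≤ 7 * Y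
  C*sum≤ J d eq = begin
    8 * (c * sumAbove term J (suc d))     ≤⟨ *-monoʳ-≤ 8 (sumAbove-mono c J (suc d) λ I J<I → *-monoˡ-≤ (term I) (C-mono t J<I)) ⟩
    8 * sumAbove weighted J (suc d)       ≡⟨ cong (λ x → 8 * sumAbove weighted x (suc d)) (+-identityʳ J) ⟨
    8 * sumAbove weighted (J + 0) (suc d) ≤⟨ *-monoʳ-≤ 8 (sumAbove-drop weighted 0 J (suc d)) ⟩
    8 * sumAbove weighted 0 (J + suc d)   ≤⟨ coarsen 128 873 8 7 (sumAbove weighted 0 (J + suc d)) (m≤m+n 873 23) (total≤ (J + suc d) (trans (+-suc J d) eq)) ⟩
    7 * Y                                 ∎
    where
    open ≤-Reasoning
    c = (t + suc J) C suc J

-- The two parts of the theorem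

subset-of-size : (S : Subset n) (m : ℕ) → m ≤ ∣ S ∣ → ∃[ X ] X ⊆ S × ∣ X ∣ ≡ m
subset-of-size {n} S zero _ = Sub.⊥ , (λ x∈⊥ → contradiction x∈⊥ ∉⊥) , ∣⊥∣≡0 n
subset-of-size (outside ∷ S) (suc m) m<S =
  let X , X⊆S , ∣X∣≡ = subset-of-size S (suc m) m<S in outside ∷ X , s⊆s X⊆S , ∣X∣≡
subset-of-size (inside ∷ S) (suc m) (s≤s m≤S) =
  let X , X⊆S , ∣X∣≡ = subset-of-size S m m≤S in inside ∷ X , s⊆s X⊆S , cong suc ∣X∣≡

Δ-pos : (𝓐 : Family n) {S : Subset n} {t : ℕ} → S ∈ᶠ 𝓐 → t ≤ ∣ S ∣ → 1 ≤ Δ t 𝓐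
Δ-pos 𝓐 {S} {t} S∈ t≤S with subset-of-size S t t≤S
... | X , X⊆S , refl = ≤-trans (card-pos (𝓐 [ X ]) (∈-[]⁺ 𝓐 S∈ X⊆S)) (card[X]≤Δ 𝓐 X)

nonempty⊎∅ : (𝓕 : Family n) → Nonempty 𝓕 ⊎ (∀ S → ¬ S ∈ᶠ 𝓕)
nonempty⊎∅ 𝓕 with anySubset? (T? ∘ 𝓕)
... | yes some = inj₁ some
... | no none  = inj₂ λ S S∈ → none (S , S∈)

card-∅ : (𝓕 : Family n) → (∀ S → ¬ S ∈ᶠ 𝓕) → card 𝓕 ≡ 0
card-∅ {n} 𝓕 ∅ = countᵇ-∅ 𝓕 ∅ (subsets n)

star⊎miss : (𝓕 : Family n) (X : Subset n) → (∀ S → S ∈ᶠ 𝓕 → X ⊆ S) ⊎ ∃[ S ] S ∈ᶠ 𝓕 × X ⊈ S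
star⊎miss 𝓕 X with anySubset? (λ S → T? (𝓕 S) ×-dec ¬? (X ⊆? S))
... | yes some = inj₂ some
... | no none  = inj₁ λ S S∈ → decidable-stable (X ⊆? S) (λ X⊈S → none (S , S∈ , X⊈S))

-- A set S ⊇ X meeting H in t elements contains an element of H outside X, because X ⊈ H.
missed : (𝓐 : Family n) (t : ℕ) (X H : Subset n) → ∣ X ∣ ≡ t → X ⊈ H →
         AtMost (λ S → S ∈ᶠ 𝓐 × X ⊆ S × t ≤ ∣ S ∩ H ∣) (∣ H ∣ * Δ (t + 1) 𝓐)
missed {n} 𝓐 t X H ∣X∣≡t X⊈H = atMost-mono (λ _ → id)
  (*-monoˡ-≤ (Δ (t + 1) 𝓐) (∣p─q∣≤∣p∣ H X))
  (atMost-⋃ _ (H ─ X) refl split λ z z∈ → atMost-⊇ 𝓐 (X ∪ ⁅ z ⁆)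
    (trans (∣p∪⁅x⁆∣≡1+∣p∣ (x∈p─q⇒x∉q H X z∈)) (trans (cong suc ∣X∣≡t) (+-comm 1 t))))
  where
  X∩H<t : ∣ X ∩ H ∣ < t
  X∩H<t = ≰⇒> λ t≤ → X⊈H (subst (_⊆ H)
    (p⊆q∧∣q∣≤∣p∣⇒p≡q (X ∩ H) X (p∩q⊆p X H) (≤-trans (≤-reflexive ∣X∣≡t) t≤)) (p∩q⊆q X H))
  split : ∀ S → S ∈ᶠ 𝓐 × X ⊆ S × t ≤ ∣ S ∩ H ∣ → ∃[ z ] z ∈ H ─ X × S ∈ᶠ 𝓐 × (X ∪ ⁅ z ⁆) ⊆ S
  split S (S∈ , X⊆S , t≤) with ∣p∣<∣q∣⇒∃∈∖ (X ∩ H) (S ∩ H) (≤-trans X∩H<t t≤)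
  ... | z , z∈S∩H , z∉X∩H = z , x∈p∧x∉q⇒x∈p─q z∈H (λ z∈X → z∉X∩H (x∈p∩q⁺ (z∈X , z∈H)))
      , S∈ , ⊆-∪⁅⁆ X⊆S (proj₁ (x∈p∩q⁻ S H z∈S∩H))
    where
    z∈H = proj₂ (x∈p∩q⁻ S H z∈S∩H)

⊆star⇒card≤Δ : (𝓐 𝓕 : Family n) {t : ℕ} (X : Subset n) → ∣ X ∣ ≡ t → 𝓕 ⊆ᶠ 𝓐 [ X ] → card 𝓕 ≤ Δ t 𝓐
⊆star⇒card≤Δ {n} 𝓐 𝓕 X refl 𝓕⊆ = ≤-trans (countᵇ-mono 𝓕 (𝓐 [ X ]) 𝓕⊆ (subsets n)) (card[X]≤Δ 𝓐 X)

⊆star∧Δ≤card⇒≗ : (𝓐 𝓕 : Family n) {t : ℕ} (X : Subset n) → ∣ X ∣ ≡ t → 𝓕 ⊆ᶠ 𝓐 [ X ] → Δ t 𝓐 ≤ card 𝓕 →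
                 (𝓕 ≗ 𝓐 [ X ]) × (card (𝓐 [ X ]) ≡ Δ t 𝓐)
⊆star∧Δ≤card⇒≗ {n} 𝓐 𝓕 X refl 𝓕⊆ Δ≤card = ⊆ᶠ∧card≥⇒≗ 𝓕 (𝓐 [ X ]) 𝓕⊆ (≤-trans (card[X]≤Δ 𝓐 X) Δ≤card)
  , ≤-antisym (card[X]≤Δ 𝓐 X) (≤-trans Δ≤card (countᵇ-mono 𝓕 (𝓐 [ X ]) 𝓕⊆ (subsets n)))

∣p─q∣≤ : ∀ {t m} (p q : Subset n) → ∣ p ∣ ≤ t + m → t ≤ ∣ p ∩ q ∣ → ∣ p ─ q ∣ ≤ m
∣p─q∣≤ {t = t} {m} p q p≤ t≤ = +-cancelʳ-≤ t _ _ (begin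
  ∣ p ─ q ∣ + t            ≤⟨ +-monoʳ-≤ ∣ p ─ q ∣ t≤ ⟩
  ∣ p ─ q ∣ + ∣ p ∩ q ∣    ≡⟨ ∣p─q∣+∣p∩q∣≡∣p∣ p q ⟩
  ∣ p ∣                    ≤⟨ p≤ ⟩
  t + m                    ≡⟨ +-comm t m ⟩
  m + t                    ∎)
  where open ≤-Reasoning

scaled-< : ∀ {x a b y} → a < b → 1 ≤ y → b * x ≤ a * y → x < y
scaled-< {x} {a} {b} {y@(suc _)} a<b _ bx≤ay = *-cancelˡ-< b x y (≤-<-trans bx≤ay (*-monoˡ-< y a<b))

module Intersecting-t (t K : ℕ) (1≤t : 1 ≤ t) (𝓐 : Family n) (uniform : Uniform (t + K) 𝓐)
  (spread : ∀ s → Δ (t + s) 𝓐 * (16 * (t + K)) ^ s ≤ 3 ^ s * Δ t 𝓐)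
  (𝓕 : Family n) (𝓕⊆𝓐 : 𝓕 ⊆ᶠ 𝓐) (intersecting : Intersecting t 𝓕) where

  open IntersectingSum t K 1≤t (λ I → Δ (t + I) 𝓐) (Δ t 𝓐) spread

  small-or-star : Nonempty 𝓕 → (card 𝓕 < Δ t 𝓐) ⊎ ∃[ X ] ∣ X ∣ ≡ t × 𝓕 ⊆ᶠ 𝓐 [ X ]
  small-or-star ne@(S , S∈) = conclude outcome
    where
    open Peeling t K (λ _ _ → true) (λ _ _ → id) (λ _ → _) (const 𝓐) (const 𝓕) (λ _ → 𝓕⊆𝓐)
      (λ _ H H∈ → ≤-reflexive (uniform H (𝓕⊆𝓐 H H∈))) (λ _ _ _ → intersecting) (λ _ → ne) id
      -- All generators meet each other here, so T₁ meets A directly and D can be the identity.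
      (λ J b H T₁ A _ _ _ T₁≤ _ _ t≤ → ∣p─q∣≤ T₁ A T₁≤ (t≤ _))
    1≤Δ : 1 ≤ Δ t 𝓐
    1≤Δ = Δ-pos 𝓐 (𝓕⊆𝓐 S S∈) (≤-trans (m≤m+n t K) (≤-reflexive (sym (uniform S (𝓕⊆𝓐 S S∈)))))
    conclude : Outcome → (card 𝓕 < Δ t 𝓐) ⊎ ∃[ X ] ∣ X ∣ ≡ t × 𝓕 ⊆ᶠ 𝓐 [ X ]
    conclude (exhausted b J d eq card≤ _) = inj₁ (scaled-< {a = 171} {224} (m≤m+n 172 52) 1≤Δ (begin
      224 * card 𝓕                               ≤⟨ *-monoʳ-≤ 224 card≤ ⟩
      224 * sumAbove term J (suc d)              ≡⟨ cong (λ x → 224 * sumAbove term x (suc d)) (+-identityʳ J) ⟨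
      224 * sumAbove term (J + 0) (suc d)        ≤⟨ *-monoʳ-≤ 224 (sumAbove-drop term 0 J (suc d)) ⟩
      224 * sumAbove term 0 (J + suc d)          ≤⟨ sum≤ (J + suc d) (trans (+-suc J d) eq) ⟩
      171 * Δ t 𝓐                                ∎))
      where open ≤-Reasoning
    conclude (star X ∣X∣≡t card≤) with star⊎miss 𝓕 X
    ... | inj₁ all = inj₂ (X , ∣X∣≡t , λ H H∈ → ∈-[]⁺ 𝓐 (𝓕⊆𝓐 H H∈) (all H H∈))
    ... | inj₂ (H , H∈ , X⊈H) = inj₁ (scaled-< {a = 213} {224} (m≤m+n 214 10) 1≤Δ (begin
      224 * card 𝓕
        ≤⟨ *-monoʳ-≤ 224 (card≤ false (atMost-mono
             (λ S (S∈ , X⊆S) → 𝓕⊆𝓐 S S∈ , (λ {x} → X⊆S {x}) , intersecting S H S∈ H∈) ≤-refl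
             (missed 𝓐 t X H ∣X∣≡t X⊈H))) ⟩
      224 * (∣ H ∣ * Δ (t + 1) 𝓐 + sumAbove term 0 K)
        ≡⟨ cong (λ x → 224 * (x * Δ (t + 1) 𝓐 + sumAbove term 0 K)) (uniform H (𝓕⊆𝓐 H H∈)) ⟩
      224 * ((t + K) * Δ (t + 1) 𝓐 + sumAbove term 0 K)
        ≡⟨ re₁ (t + K) (Δ (t + 1) 𝓐) (sumAbove term 0 K) ⟩
      14 * (Δ (t + 1) 𝓐 * (16 * (t + K) * 1)) + 224 * sumAbove term 0 K
        ≤⟨ +-mono-≤ (*-monoʳ-≤ 14 (spread 1)) (sum≤ K refl) ⟩
      14 * (3 * Δ t 𝓐) + 171 * Δ t 𝓐
        ≡⟨ re₂ (Δ t 𝓐) ⟩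
      213 * Δ t 𝓐 ∎))
      where
      open ≤-Reasoning
      re₁ : ∀ k X S → 224 * (k * X + S) ≡ 14 * (X * (16 * k * 1)) + 224 * S
      re₁ = solve-∀
      re₂ : ∀ Y → 14 * (3 * Y) + 171 * Y ≡ 213 * Y
      re₂ = solve-∀

  -- For empty 𝓕 any set of size t serves as X, and t ≤ n provides one.
  small-or-star′ : t ≤ n → (card 𝓕 < Δ t 𝓐) ⊎ ∃[ X ] ∣ X ∣ ≡ t × 𝓕 ⊆ᶠ 𝓐 [ X ]
  small-or-star′ t≤n with nonempty⊎∅ 𝓕
  ... | inj₁ ne = small-or-star ne
  ... | inj₂ ∅  = let X , _ , ∣X∣≡t = subset-of-size Sub.⊤ t (≤-trans t≤n (≤-reflexive (sym (∣⊤∣≡n n)))) in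
    inj₂ (X , ∣X∣≡t , λ S S∈ → contradiction S∈ (∅ S))

  card≤Δ : card 𝓕 ≤ Δ t 𝓐
  card≤Δ with nonempty⊎∅ 𝓕
  ... | inj₂ ∅  = ≤-trans (≤-reflexive (card-∅ 𝓕 ∅)) z≤n
  ... | inj₁ ne = either <⇒≤ (λ (X , ∣X∣≡t , 𝓕⊆) → ⊆star⇒card≤Δ 𝓐 𝓕 X ∣X∣≡t 𝓕⊆) (small-or-star ne)

  card≡Δ⇔star : t ≤ n → (card 𝓕 ≡ Δ t 𝓐)
    ⇔ (∃[ X ] (∣ X ∣ ≡ t) × (𝓕 ≗ 𝓐 [ X ]) × (card (𝓐 [ X ]) ≡ Δ t 𝓐))
  card≡Δ⇔star t≤n = mk⇔ to λ (X , _ , 𝓕≗ , card≡) → trans (card-cong 𝓕≗) card≡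
    where
    to : card 𝓕 ≡ Δ t 𝓐 → ∃[ X ] (∣ X ∣ ≡ t) × (𝓕 ≗ 𝓐 [ X ]) × (card (𝓐 [ X ]) ≡ Δ t 𝓐)
    to card≡Δ with small-or-star′ t≤n
    ... | inj₁ card<Δ = contradiction card≡Δ (<⇒≢ card<Δ)
    ... | inj₂ (X , ∣X∣≡t , 𝓕⊆) = X , ∣X∣≡t , ⊆star∧Δ≤card⇒≗ 𝓐 𝓕 X ∣X∣≡t 𝓕⊆ (≤-reflexive (sym card≡Δ))

-- 7/8 + 7/16 · 1/6 = 91/96.
exhausted-product : ∀ {c P Q Y Y′ f g} → 1 ≤ Y → 1 ≤ Y′ → f ≤ P → g ≤ c * Y′ + Q →
  8 * (c * P) ≤ 7 * Y → 16 * P ≤ 7 * Y → 6 * Q ≤ Y′ → f * g < Y * Y′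
exhausted-product {c} {P} {Q} {Y} {Y′} {f} {g} 1≤Y 1≤Y′ f≤ g≤ cP≤ P≤ Q≤ =
  scaled-< {a = 91} {96} (m≤m+n 92 4) (*-mono-≤ 1≤Y 1≤Y′) (begin
    96 * (f * g)                                  ≤⟨ *-monoʳ-≤ 96 (*-mono-≤ f≤ g≤) ⟩
    96 * (P * (c * Y′ + Q))                       ≡⟨ re₁ P c Y′ Q ⟩
    12 * (8 * (c * P) * Y′) + 16 * P * (6 * Q)    ≤⟨ +-mono-≤ (*-monoʳ-≤ 12 (*-monoˡ-≤ Y′ cP≤)) (*-mono-≤ P≤ Q≤) ⟩
    12 * (7 * Y * Y′) + 7 * Y * Y′                ≡⟨ re₂ Y Y′ ⟩
    91 * (Y * Y′)                                 ∎)
  where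
  open ≤-Reasoning
  re₁ : ∀ P c Y Q → 96 * (P * (c * Y + Q)) ≡ 12 * (8 * (c * P) * Y) + 16 * P * (6 * Q)
  re₁ = solve-∀
  re₂ : ∀ Y Y′ → 12 * (7 * Y * Y′) + 7 * Y * Y′ ≡ 91 * (Y * Y′)
  re₂ = solve-∀

-- The side with a member missing X may keep a full star, the other keeps 3/16 of one: (1 +
-- 7/16)(3/16 + 7/16) = 230/256.
missed-product : ∀ {z P Q Y Y′ f g} → 1 ≤ Y → 1 ≤ Y′ → f ≤ Y + P → g ≤ z + Q →
  16 * z ≤ 3 * Y′ → 16 * P ≤ 7 * Y → 16 * Q ≤ 7 * Y′ → f * g < Y * Y′
missed-product {z} {P} {Q} {Y} {Y′} {f} {g} 1≤Y 1≤Y′ f≤ g≤ z≤ P≤ Q≤ =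
  scaled-< {a = 230} {256} (m≤m+n 231 25) (*-mono-≤ 1≤Y 1≤Y′) (begin
    256 * (f * g)                               ≤⟨ *-monoʳ-≤ 256 (*-mono-≤ f≤ g≤) ⟩
    256 * ((Y + P) * (z + Q))                   ≡⟨ re₁ Y P z Q ⟩
    (16 * Y + 16 * P) * (16 * z + 16 * Q)       ≤⟨ *-mono-≤ (+-monoʳ-≤ (16 * Y) P≤) (+-mono-≤ z≤ Q≤) ⟩
    (16 * Y + 7 * Y) * (3 * Y′ + 7 * Y′)        ≡⟨ re₂ Y Y′ ⟩
    230 * (Y * Y′)                              ∎)
  where
  open ≤-Reasoning
  re₁ : ∀ Y P z Q → 256 * ((Y + P) * (z + Q)) ≡ (16 * Y + 16 * P) * (16 * z + 16 * Q)
  re₁ = solve-∀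
  re₂ : ∀ Y Y′ → (16 * Y + 7 * Y) * (3 * Y′ + 7 * Y′) ≡ 230 * (Y * Y′)
  re₂ = solve-∀

-- I + min(I, t) is the minimum of 2 I and I + t.
branching-bound : ∀ t i {x} → x ≤ suc i + suc i → x ≤ t + suc i → x ≤ branching t (suc i)
branching-bound t 0 x≤2i _ = x≤2i
branching-bound t 1 x≤2i _ = x≤2i
branching-bound t 2 x≤2i _ = x≤2i
branching-bound t (suc (suc (suc i))) {x} x≤2i x≤t+i = subst (x ≤_) (sym (+-distribˡ-⊓ I I t))
  (⊓-glb x≤2i (≤-trans x≤t+i (≤-reflexive (+-comm t I))))
  where
  I = 4 + i

-- Two sets that each meet S in t elements, where ∣ S ∣ ≤ t + m, meet each other in at least t - m.
∣p─q∣≤2m : ∀ {t m} (s p q : Subset n) → ∣ s ∣ ≤ t + m → ∣ p ∣ ≤ t + m → t ≤ ∣ p ∩ s ∣ → t ≤ ∣ q ∩ s ∣ →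
           ∣ p ─ q ∣ ≤ m + m
∣p─q∣≤2m {t = t} {m} s p q s≤ p≤ t≤p∩s t≤q∩s = +-cancelʳ-≤ (t + t) _ _ (begin
  ∣ p ─ q ∣ + (t + t)                        ≤⟨ +-monoʳ-≤ ∣ p ─ q ∣ (+-mono-≤ t≤p∩s t≤q∩s) ⟩
  ∣ p ─ q ∣ + (∣ p ∩ s ∣ + ∣ q ∩ s ∣)        ≤⟨ +-monoʳ-≤ ∣ p ─ q ∣ (∣p∩s∣+∣q∩s∣≤∣s∣+∣p∩q∣ s p q) ⟩
  ∣ p ─ q ∣ + (∣ s ∣ + ∣ p ∩ q ∣)            ≡⟨ re₁ (∣ p ─ q ∣) (∣ s ∣) (∣ p ∩ q ∣) ⟩
  ∣ s ∣ + (∣ p ─ q ∣ + ∣ p ∩ q ∣)            ≡⟨ cong (∣ s ∣ +_) (∣p─q∣+∣p∩q∣≡∣p∣ p q) ⟩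
  ∣ s ∣ + ∣ p ∣                              ≤⟨ +-mono-≤ s≤ p≤ ⟩
  (t + m) + (t + m)                          ≡⟨ re₂ t m ⟩
  m + m + (t + t)                            ∎)
  where
  open ≤-Reasoning
  re₁ : ∀ a b c → a + (b + c) ≡ b + (a + c)
  re₁ = solve-∀
  re₂ : ∀ t m → (t + m) + (t + m) ≡ m + m + (t + t)
  re₂ = solve-∀

module CrossIntersecting-t (t K M ℓ : ℕ) (1≤t : 1 ≤ t) (t≤ℓ : t ≤ ℓ) (ℓ≤k : ℓ ≤ t + K)
  (M≥[t+2]² : (t + 2) * (t + 2) ≤ M) (M≥k : t + K ≤ M)
  (𝓐 𝓑 : Family n) (𝓐-uniform : Uniform (t + K) 𝓐) (𝓑-uniform : Uniform ℓ 𝓑)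
  (𝓐-spread : ∀ s → Δ (t + s) 𝓐 * (16 * M) ^ s ≤ 3 ^ s * Δ t 𝓐)
  (𝓑-spread : ∀ s → Δ (t + s) 𝓑 * (16 * M) ^ s ≤ 3 ^ s * Δ t 𝓑)
  (𝓕 𝓖 : Family n) (𝓕⊆𝓐 : 𝓕 ⊆ᶠ 𝓐) (𝓖⊆𝓑 : 𝓖 ⊆ᶠ 𝓑) (cross : CrossIntersecting t 𝓕 𝓖) where

  private
    pick : Family n → Family n → Bool → Family n
    pick 𝓧 𝓨 false = 𝓧
    pick 𝓧 𝓨 true  = 𝓨

    𝓒 𝓗 : Bool → Family n
    𝓒 = pick 𝓐 𝓑
    𝓗 = pick 𝓕 𝓖

    𝓗⊆𝓒 : ∀ b → 𝓗 b ⊆ᶠ 𝓒 b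
    𝓗⊆𝓒 false = 𝓕⊆𝓐
    𝓗⊆𝓒 true  = 𝓖⊆𝓑

    ∣𝓒∣≤ : ∀ b S → S ∈ᶠ 𝓒 b → ∣ S ∣ ≤ t + K
    ∣𝓒∣≤ false S S∈ = ≤-reflexive (𝓐-uniform S S∈)
    ∣𝓒∣≤ true  S S∈ = ≤-trans (≤-reflexive (𝓑-uniform S S∈)) ℓ≤k

    t≤∣𝓒∣ : ∀ b S → S ∈ᶠ 𝓒 b → t ≤ ∣ S ∣
    t≤∣𝓒∣ false S S∈ = ≤-trans (m≤m+n t K) (≤-reflexive (sym (𝓐-uniform S S∈)))
    t≤∣𝓒∣ true  S S∈ = ≤-trans t≤ℓ (≤-reflexive (sym (𝓑-uniform S S∈)))

    meets : ∀ b c → T (b xor c) → ∀ S S′ → S ∈ᶠ 𝓗 b → S′ ∈ᶠ 𝓗 c → t ≤ ∣ S ∩ S′ ∣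
    meets false true  _ S S′ S∈ S′∈ = cross S S′ S∈ S′∈
    meets true  false _ S S′ S∈ S′∈ = subst (λ p → t ≤ ∣ p ∣) (∩-comm S′ S) (cross S′ S S′∈ S∈)

    spread : ∀ b s → Δ (t + s) (𝓒 b) * (16 * M) ^ s ≤ 3 ^ s * Δ t (𝓒 b)
    spread false = 𝓐-spread
    spread true  = 𝓑-spread

    module Sum (b : Bool) =
      CrossSum t K M 1≤t M≥[t+2]² M≥k (λ I → Δ (t + I) (𝓒 b)) (Δ t (𝓒 b)) (spread b)

    xor-not : ∀ b → T (b xor not b)
    xor-not false = _
    xor-not true  = _

    xor-sym : ∀ b c → T (b xor c) → T (c xor b)
    xor-sym false true  _ = _
    xor-sym true  false _ = _

    sym-< : ∀ b → card (𝓗 b) * card (𝓗 (not b)) < Δ t (𝓒 b) * Δ t (𝓒 (not b)) →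
            card 𝓕 * card 𝓖 < Δ t 𝓐 * Δ t 𝓑
    sym-< false p = p
    sym-< true  p = subst₂ _<_ (*-comm (card 𝓖) (card 𝓕)) (*-comm (Δ t 𝓑) (Δ t 𝓐)) p

  small-or-star : Nonempty 𝓕 → Nonempty 𝓖 →
    (card 𝓕 * card 𝓖 < Δ t 𝓐 * Δ t 𝓑) ⊎ ∃[ X ] ∣ X ∣ ≡ t × (𝓕 ⊆ᶠ 𝓐 [ X ]) × (𝓖 ⊆ᶠ 𝓑 [ X ])
  small-or-star 𝓕≢∅ 𝓖≢∅ = conclude outcome
    where
    𝓗≢∅ : ∀ b → Nonempty (𝓗 b)
    𝓗≢∅ false = 𝓕≢∅
    𝓗≢∅ true  = 𝓖≢∅
    open Peeling t K _xor_ xor-sym xor-not 𝓒 𝓗 𝓗⊆𝓒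
      (λ b S S∈ → ∣𝓒∣≤ b S (𝓗⊆𝓒 b S S∈)) meets 𝓗≢∅ (branching t)
      (λ J b S T₁ A _ _ S≤ T₁≤ t≤T₁∩S t≤A∩S _ → branching-bound t J
        (∣p─q∣≤2m S T₁ A S≤ T₁≤ t≤T₁∩S t≤A∩S) (≤-trans (∣p─q∣≤∣p∣ T₁ A) T₁≤))
    1≤Δ : ∀ b → 1 ≤ Δ t (𝓒 b)
    1≤Δ b = let S , S∈ = 𝓗≢∅ b in Δ-pos (𝓒 b) (𝓗⊆𝓒 b S S∈) (t≤∣𝓒∣ b S (𝓗⊆𝓒 b S S∈))

    missing : ∀ b X → ∣ X ∣ ≡ t →
      (∀ b {m} → AtMost (λ H → H ∈ᶠ 𝓗 b × X ⊆ H) m → card (𝓗 b) ≤ m + peeled b 0 K) →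
      (∃[ S ] S ∈ᶠ 𝓗 b × X ⊈ S) → card 𝓕 * card 𝓖 < Δ t 𝓐 * Δ t 𝓑
    missing b X ∣X∣≡t card≤ (H , H∈ , X⊈H) = sym-< b (missed-product
      {z = M * Δ (t + 1) (𝓒 (not b))} {P = peeled b 0 K} {Q = peeled (not b) 0 K} (1≤Δ b) (1≤Δ (not b))
      (card≤ b (atMost-mono (λ S (S∈ , X⊆S) → 𝓗⊆𝓒 b S S∈ , λ {x} → X⊆S {x}) ≤-refl (atMost-⊇ (𝓒 b) X ∣X∣≡t)))
      (card≤ (not b) (atMost-mono
        (λ S (S∈ , X⊆S) → 𝓗⊆𝓒 (not b) S S∈ , (λ {x} → X⊆S {x}) , meets (not b) b (xor-sym b (not b) (xor-not b)) S H S∈ H∈)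
        (*-monoˡ-≤ (Δ (t + 1) (𝓒 (not b))) (≤-trans (∣𝓒∣≤ b H (𝓗⊆𝓒 b H H∈)) M≥k)) (missed (𝓒 (not b)) t X H ∣X∣≡t X⊈H)))
      (≤-trans (≤-reflexive (re M (Δ (t + 1) (𝓒 (not b))))) (spread (not b) 1))
      (Sum.sum≤ b) (Sum.sum≤ (not b)))
      where
      re : ∀ M X → 16 * (M * X) ≡ X * (16 * M * 1)
      re = solve-∀

    conclude : Outcome →
      (card 𝓕 * card 𝓖 < Δ t 𝓐 * Δ t 𝓑) ⊎ ∃[ X ] ∣ X ∣ ≡ t × (𝓕 ⊆ᶠ 𝓐 [ X ]) × (𝓖 ⊆ᶠ 𝓑 [ X ])
    conclude (exhausted b J d eq card≤ card′≤) = inj₁ (sym-< b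
      (exhausted-product {c = (t + suc J) C suc J} {P = peeled b J (suc d)} {Q = peeled (not b) (suc J) d} (1≤Δ b) (1≤Δ (not b)) card≤
        (subst (λ c → card (𝓗 (not b)) ≤ c * Δ t (𝓒 (not b)) + peeled (not b) (suc J) d) C≡ card′≤)
        (Sum.C*sum≤ b J d eq)
        (≤-trans (*-monoʳ-≤ 16 all≤) (Sum.sum≤ b))
        (Sum.sum⁺≤ (not b) J d eq)))
      where
      C≡ : (t + suc J) C t ≡ (t + suc J) C suc J
      C≡ = trans (nCk≡nC[n∸k] (m≤m+n t (suc J))) (cong ((t + suc J) C_) (m+n∸m≡n t (suc J)))
      all≤ : peeled b J (suc d) ≤ peeled b 0 K
      all≤ = subst₂ (λ x y → peeled b x (suc d) ≤ peeled b 0 y) (+-identityʳ J) (trans (+-suc J d) eq)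
        (sumAbove-drop (levelTerm b) 0 J (suc d))
    conclude (star X ∣X∣≡t card≤) with star⊎miss 𝓕 X | star⊎miss 𝓖 X
    ... | inj₂ miss | _         = inj₁ (missing false X ∣X∣≡t card≤ miss)
    ... | inj₁ _    | inj₂ miss = inj₁ (missing true X ∣X∣≡t card≤ miss)
    ... | inj₁ 𝓕⊇X  | inj₁ 𝓖⊇X  = inj₂ (X , ∣X∣≡t
      , (λ S S∈ → ∈-[]⁺ 𝓐 (𝓕⊆𝓐 S S∈) (𝓕⊇X S S∈)) , λ S S∈ → ∈-[]⁺ 𝓑 (𝓖⊆𝓑 S S∈) (𝓖⊇X S S∈))

  -- An empty family is a case of its own, since its partner is then unrestricted and a common star
  -- need not exist.
  small-or-star′ : (card 𝓕 * card 𝓖 ≡ 0)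
    ⊎ (card 𝓕 * card 𝓖 < Δ t 𝓐 * Δ t 𝓑) ⊎ ∃[ X ] ∣ X ∣ ≡ t × (𝓕 ⊆ᶠ 𝓐 [ X ]) × (𝓖 ⊆ᶠ 𝓑 [ X ])
  small-or-star′ with nonempty⊎∅ 𝓕 | nonempty⊎∅ 𝓖
  ... | inj₁ 𝓕≢∅ | inj₁ 𝓖≢∅ = inj₂ (small-or-star 𝓕≢∅ 𝓖≢∅)
  ... | inj₂ ∅   | _        = inj₁ (cong (_* card 𝓖) (card-∅ 𝓕 ∅))
  ... | inj₁ _   | inj₂ ∅   = inj₁ (trans (cong (card 𝓕 *_) (card-∅ 𝓖 ∅)) (*-zeroʳ (card 𝓕)))

  product≤ : card 𝓕 * card 𝓖 ≤ Δ t 𝓐 * Δ t 𝓑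
  product≤ with small-or-star′
  ... | inj₁ ≡0        = ≤-trans (≤-reflexive ≡0) z≤n
  ... | inj₂ (inj₁ <Δ) = <⇒≤ <Δ
  ... | inj₂ (inj₂ (X , ∣X∣≡t , 𝓕⊆ , 𝓖⊆)) =
    *-mono-≤ (⊆star⇒card≤Δ 𝓐 𝓕 X ∣X∣≡t 𝓕⊆) (⊆star⇒card≤Δ 𝓑 𝓖 X ∣X∣≡t 𝓖⊆)

  product≡⇔star : Nonempty 𝓐 → Nonempty 𝓑 → (card 𝓕 * card 𝓖 ≡ Δ t 𝓐 * Δ t 𝓑)
    ⇔ (∃[ X ] (∣ X ∣ ≡ t) × (𝓕 ≗ 𝓐 [ X ]) × (𝓖 ≗ 𝓑 [ X ])
              × (card (𝓐 [ X ]) ≡ Δ t 𝓐) × (card (𝓑 [ X ]) ≡ Δ t 𝓑))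
  product≡⇔star (A , A∈) (B , B∈) = mk⇔ to λ (X , _ , 𝓕≗ , 𝓖≗ , 𝓐≡ , 𝓑≡) →
    cong₂ _*_ (trans (card-cong 𝓕≗) 𝓐≡) (trans (card-cong 𝓖≗) 𝓑≡)
    where
    1≤Δ𝓐 : 1 ≤ Δ t 𝓐
    1≤Δ𝓐 = Δ-pos 𝓐 A∈ (t≤∣𝓒∣ false A A∈)
    1≤Δ𝓑 : 1 ≤ Δ t 𝓑
    1≤Δ𝓑 = Δ-pos 𝓑 B∈ (t≤∣𝓒∣ true B B∈)
    tight : ∀ {f g a b} → 1 ≤ a → f ≤ a → g ≤ b → f * g ≡ a * b → b ≤ g
    tight {f} {g} {a@(suc _)} {b} _ f≤a g≤b fg≡ab =
      *-cancelˡ-≤ a (≤-trans (≤-reflexive (sym fg≡ab)) (*-monoˡ-≤ g f≤a))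
    to : card 𝓕 * card 𝓖 ≡ Δ t 𝓐 * Δ t 𝓑 → ∃[ X ] (∣ X ∣ ≡ t) × (𝓕 ≗ 𝓐 [ X ]) × (𝓖 ≗ 𝓑 [ X ])
              × (card (𝓐 [ X ]) ≡ Δ t 𝓐) × (card (𝓑 [ X ]) ≡ Δ t 𝓑)
    to eq with small-or-star′
    -- Members of 𝓐 and 𝓑 make both degrees positive, which rules out the product 0.
    ... | inj₁ ≡0        = contradiction (trans (sym eq) ≡0) (>⇒≢ (*-mono-≤ 1≤Δ𝓐 1≤Δ𝓑))
    ... | inj₂ (inj₁ <Δ) = contradiction eq (<⇒≢ <Δ)
    ... | inj₂ (inj₂ (X , ∣X∣≡t , 𝓕⊆ , 𝓖⊆)) =
      let f≤ = ⊆star⇒card≤Δ 𝓐 𝓕 X ∣X∣≡t 𝓕⊆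
          g≤ = ⊆star⇒card≤Δ 𝓑 𝓖 X ∣X∣≡t 𝓖⊆
          𝓕≗ , 𝓐≡ = ⊆star∧Δ≤card⇒≗ 𝓐 𝓕 X ∣X∣≡t 𝓕⊆
            (tight 1≤Δ𝓑 g≤ f≤ (trans (*-comm (card 𝓖) (card 𝓕)) (trans eq (*-comm (Δ t 𝓐) (Δ t 𝓑)))))
          𝓖≗ , 𝓑≡ = ⊆star∧Δ≤card⇒≗ 𝓑 𝓖 X ∣X∣≡t 𝓖⊆ (tight 1≤Δ𝓐 f≤ g≤ eq)
      in X , ∣X∣≡t , 𝓕≗ , 𝓖≗ , 𝓐≡ , 𝓑≡

intersecting-theorem : ∀ {t} K k → t + K ≡ k → 1 ≤ t → (𝓐 : Family n) → Uniform k 𝓐 →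
  (∀ s → Δ (t + s) 𝓐 * (16 * k) ^ s ≤ 3 ^ s * Δ t 𝓐) →
  (𝓕 : Family n) → 𝓕 ⊆ᶠ 𝓐 → Intersecting t 𝓕 →
  (card 𝓕 ≤ Δ t 𝓐)
  × (t ≤ n → (card 𝓕 ≡ Δ t 𝓐)
     ⇔ (∃[ X ] (∣ X ∣ ≡ t) × (𝓕 ≗ 𝓐 [ X ]) × (card (𝓐 [ X ]) ≡ Δ t 𝓐)))
intersecting-theorem {t = t} K _ refl 1≤t 𝓐 uniform spread 𝓕 𝓕⊆𝓐 inter = card≤Δ , card≡Δ⇔star
  where open Intersecting-t t K 1≤t 𝓐 uniform spread 𝓕 𝓕⊆𝓐 inter

cross-theorem : ∀ {t} K k M ℓ → t + K ≡ k → 1 ≤ t → t ≤ ℓ → ℓ ≤ k → (t + 2) * (t + 2) ≤ M → k ≤ M →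
  (𝓐 𝓑 : Family n) → Uniform k 𝓐 → Uniform ℓ 𝓑 →
  (∀ s → Δ (t + s) 𝓐 * (16 * M) ^ s ≤ 3 ^ s * Δ t 𝓐) →
  (∀ s → Δ (t + s) 𝓑 * (16 * M) ^ s ≤ 3 ^ s * Δ t 𝓑) →
  (𝓕 𝓖 : Family n) → 𝓕 ⊆ᶠ 𝓐 → 𝓖 ⊆ᶠ 𝓑 → CrossIntersecting t 𝓕 𝓖 →
  (card 𝓕 * card 𝓖 ≤ Δ t 𝓐 * Δ t 𝓑)
  × (Nonempty 𝓐 → Nonempty 𝓑 → (card 𝓕 * card 𝓖 ≡ Δ t 𝓐 * Δ t 𝓑)
     ⇔ (∃[ X ] (∣ X ∣ ≡ t) × (𝓕 ≗ 𝓐 [ X ]) × (𝓖 ≗ 𝓑 [ X ])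
               × (card (𝓐 [ X ]) ≡ Δ t 𝓐) × (card (𝓑 [ X ]) ≡ Δ t 𝓑)))
cross-theorem {t = t} K _ M ℓ refl 1≤t t≤ℓ ℓ≤k M≥[t+2]² M≥k 𝓐 𝓑 𝓐-uni 𝓑-uni 𝓐-spr 𝓑-spr 𝓕 𝓖 𝓕⊆𝓐 𝓖⊆𝓑 cross =
  product≤ , product≡⇔star
  where
  open CrossIntersecting-t t K M ℓ 1≤t t≤ℓ ℓ≤k M≥[t+2]² M≥k 𝓐 𝓑 𝓐-uni 𝓑-uni 𝓐-spr 𝓑-spr 𝓕 𝓖 𝓕⊆𝓐 𝓖⊆𝓑 cross

theorem1p3 : ∀ (n k ℓ t : ℕ) → 1 ≤ t → (t<ℓ : t < ℓ) → (ℓ≤k : ℓ ≤ k) →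
    (r : ℝ) (1≤r : fromℕ 1 ≤ᴿ r) →
    (𝓐 𝓑 : Family n) →
    Uniform k 𝓐 → Uniform ℓ 𝓑 →
    WeaklySpread r (1≤⇒0< {r} 1≤r) t 𝓐 →
    WeaklySpread r (1≤⇒0< {r} 1≤r) t 𝓑 →
    ( (fromℕ 2 *ᴿ e) *ᴿ fromℕ k ≤ᴿ r →
    (𝓕 : Family n) → 𝓕 ⊆ᶠ 𝓐 → Intersecting t 𝓕 →
    (card 𝓕 ≤ Δ t 𝓐)
    × (t ≤ n →
    (card 𝓕 ≡ Δ t 𝓐)
    ⇔ (∃[ X ] (∣ X ∣ ≡ t) × (𝓕 ≗ 𝓐 [ X ]) × (card (𝓐 [ X ]) ≡ Δ t 𝓐))) )
    ×
    ( (fromℕ 2 *ᴿ e) *ᴿ fromℚ (crossBound k t (<-≤-trans t<ℓ ℓ≤k)) ≤ᴿ r →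
    (𝓕 𝓖 : Family n) → 𝓕 ⊆ᶠ 𝓐 → 𝓖 ⊆ᶠ 𝓑 → CrossIntersecting t 𝓕 𝓖 →
    (card 𝓕 * card 𝓖 ≤ Δ t 𝓐 * Δ t 𝓑)
    × (Nonempty 𝓐 → Nonempty 𝓑 →
    (card 𝓕 * card 𝓖 ≡ Δ t 𝓐 * Δ t 𝓑)
    ⇔ (∃[ X ] (∣ X ∣ ≡ t) × (𝓕 ≗ 𝓐 [ X ]) × (𝓖 ≗ 𝓑 [ X ])
    × (card (𝓐 [ X ]) ≡ Δ t 𝓐) × (card (𝓑 [ X ]) ≡ Δ t 𝓑))) )
theorem1p3 n k ℓ t 1≤t t<ℓ ℓ≤k r 1≤r 𝓐 𝓑 𝓐-uniform 𝓑-uniform 𝓐-spread 𝓑-spread =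
    (λ 2ek≤r → intersecting-theorem (k ∸ t) k (m+[n∸m]≡n t≤k) 1≤t 𝓐 𝓐-uniform
      (spread⇒ℕ r (1≤⇒0< {r} 1≤r) t 𝓐 k 1≤k (2eM≤r⇒16M≤3r r (k /1) k 1≤k ℚ.≤-refl 2ek≤r) 𝓐-spread))
  , (λ 2eM≤r →
      let large = 2eM≤r⇒16M≤3r r (crossBound k t (<-≤-trans t<ℓ ℓ≤k)) ((t + 2) * (t + 2) ⊔ k)
                    1≤M (max≤crossBound k t (<-≤-trans t<ℓ ℓ≤k)) 2eM≤r
      in cross-theorem (k ∸ t) k ((t + 2) * (t + 2) ⊔ k) ℓ (m+[n∸m]≡n t≤k) 1≤t (<⇒≤ t<ℓ) ℓ≤k
           (m≤m⊔n ((t + 2) * (t + 2)) k) (m≤n⊔m ((t + 2) * (t + 2)) k) 𝓐 𝓑 𝓐-uniform 𝓑-uniform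
           (spread⇒ℕ r (1≤⇒0< {r} 1≤r) t 𝓐 ((t + 2) * (t + 2) ⊔ k) 1≤M large 𝓐-spread)
           (spread⇒ℕ r (1≤⇒0< {r} 1≤r) t 𝓑 ((t + 2) * (t + 2) ⊔ k) 1≤M large 𝓑-spread))
  where
  t≤k : t ≤ k
  t≤k = <⇒≤ (<-≤-trans t<ℓ ℓ≤k)
  1≤k : 1 ≤ k
  1≤k = ≤-trans 1≤t t≤k
  1≤M : 1 ≤ (t + 2) * (t + 2) ⊔ k
  1≤M = ≤-trans 1≤k (m≤n⊔m ((t + 2) * (t + 2)) k)
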